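{- For every integer $n\ge 2$, the coordinator polynomial $h_{D_n}(x)$ of the root lattice $D_n$ is real-rooted, i.e. all of its complex zeros are real.
   Context: Let $\mathcal{L}$ be a lattice (a discrete subgroup of a finite-dimensional real Euclidean space) of rank $d$, generated as a monoid by a finite set $M$, i.e. every vector of $\mathcal{L}$ is a nonnegative integer linear combination of elements of $M$. For $v\in\mathcal{L}$ define its length $\ell(v)=\min\{\sum_{m\in M}c_m : v=\sum_{m\in M}c_m m,\ c_m\in\mathbb{Z}_{\ge0}\}$, and let $S(k)$ be the number of $v\in\mathcal{L}$ with $\ell(v)=k$. Then $\sum_{k\ge0}S(k)x^k=h(x)/(1-x)^d$ for a polynomial $h(x)$ of degree at most $d$, called the coordinator polynomial of $\mathcal{L}$ with respect to $M$. The root lattice $D_n$ is the lattice in $\mathbb{R}^n$ generated as a monoid by $M_{D_n}=\{\pm e_i\pm e_j : 1\le i<j\le n\}$, where $e_i$ are the standard basis vectors; $h_{D_n}(x)$ denotes its coordinator polynomial with respect to $M_{D_n}$. (It is known that $h_{D_n}(x)=\frac{(1+\sqrt{x})^{2n}+(1-\sqrt{x})^{2n}}{2}-2nx(1+x)^{n-2}$.) -}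

module Defs where

import Algebra.Bundles as Bundles
import Algebra.Properties.CommutativeSemigroup as CommutativeSemigroupProperties
open import Data.Nat as ℕ using (ℕ; zero; suc)
import Data.Nat.Properties as ℕₚ
open import Data.Integer as ℤ using (ℤ; +_; 0ℤ; 1ℤ; -1ℤ)
open import Data.Rational as ℚ using (ℚ; 0ℚ; 1ℚ; ½)
import Data.Rational.Properties as ℚₚ
open import Data.Fin as Fin using (Fin; toℕ)
import Data.Fin.Properties as Finₚ
open import Data.List as List using (List; []; _∷_; length; lookup; concatMap; filter; allFin; cartesianProduct)
open import Data.List.Membership.Propositional using (_∈_)
open import Data.List.Relation.Unary.Unique.Propositional using (Unique)
open import Data.Vec as Vec using (Vec; replicate; zipWith; _[_]≔_)
open import Data.Vec.Functional as Vector using (Vector)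
open import Data.Product using (Σ-syntax; ∃-syntax; _×_; _,_)
open import Function.Bundles using (_⇔_)
open import Relation.Binary.PropositionalEquality using (_≡_; refl; sym; trans; cong; cong₂; subst)

-- Only integer coordinates are needed: Dₙ is a sublattice of ℤⁿ.

ℤ^ : ℕ → Set
ℤ^ n = Vec ℤ n

infixl 6 _⊕_
infixr 7 _•_

_⊕_ : ∀ {n} → ℤ^ n → ℤ^ n → ℤ^ n
_⊕_ = zipWith ℤ._+_

_•_ : ∀ {n} → ℤ → ℤ^ n → ℤ^ n
a • v = Vec.map (a ℤ.*_) v

e : ∀ {n} → Fin n → ℤ^ n
e {n} i = replicate n 0ℤ [ i ]≔ 1ℤ

sumℕ : ∀ {m} → Vector ℕ m → ℕ
sumℕ = Vector.foldr ℕ._+_ 0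

-- A finite generating set M is given by a repetition-free list, and a
-- family of coefficients c_m (m ∈ M) by a function on its positions.

combination : ∀ {n} (M : List (ℤ^ n)) → Vector ℕ (length M) → ℤ^ n
combination {n} M c =
  Vector.foldr _⊕_ (replicate n 0ℤ) (λ i → (+ c i) • lookup M i)

-- ℓ(v) = k.  In particular v belongs to the monoid generated by M.

HasLength : ∀ {n} → List (ℤ^ n) → ℤ^ n → ℕ → Set
HasLength M v k =
  (∃[ c ] (combination M c ≡ v × sumℕ c ≡ k)) ×
  (∀ c → combination M c ≡ v → k ℕ.≤ sumℕ c)

HasCardinality : ∀ {A : Set} → (A → Set) → ℕ → Set
HasCardinality {A} P s =
  Σ[ xs ∈ List A ] Unique xs × (∀ x → x ∈ xs ⇔ P x) × length xs ≡ s

PowerSeries : Set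
PowerSeries = ℕ → ℤ

infixl 7 _⊛_

_⊛_ : PowerSeries → PowerSeries → PowerSeries
(f ⊛ g) k =
  Vector.foldr ℤ._+_ 0ℤ {suc k} (λ i → f (toℕ i) ℤ.* g (k ℕ.∸ toℕ i))

one : PowerSeries
one zero    = 1ℤ
one (suc _) = 0ℤ

1-x : PowerSeries
1-x zero          = 1ℤ
1-x (suc zero)    = -1ℤ
1-x (suc (suc _)) = 0ℤ

[1-x]^_ : ℕ → PowerSeries
[1-x]^ zero  = one
[1-x]^ suc d = 1-x ⊛ ([1-x]^ d)

-- Polynomials are coefficient lists, constant term first.

Polynomial : Set
Polynomial = List ℤ

coeff : Polynomial → PowerSeries
coeff []      _       = 0ℤ
coeff (a ∷ _) zero    = a
coeff (_ ∷ p) (suc k) = coeff p k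

-- d is the rank of the lattice generated by M.  The identity
-- Σ S(k) xᵏ = h(x) / (1 - x)ᵈ is stated after multiplying by the
-- invertible power series (1 - x)ᵈ; it determines h up to trailing zeros.

IsCoordinatorPolynomial : ∀ {n} → ℕ → List (ℤ^ n) → Polynomial → Set
IsCoordinatorPolynomial d M h =
  Σ[ S ∈ (ℕ → ℕ) ]
    (∀ k → HasCardinality (λ v → HasLength M v k) (S k)) ×
    (∀ k → ((λ j → + S j) ⊛ ([1-x]^ d)) k ≡ coeff h k)

M-D : ∀ n → List (ℤ^ n)
M-D n = concatMap signs (filter (λ (i , j) → i Finₚ.<? j)
                                (cartesianProduct (allFin n) (allFin n)))
  where
  signs : Fin n × Fin n → List (ℤ^ n)
  signs (i , j) = (  1ℤ • e i ⊕  1ℤ • e j)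
                ∷ (  1ℤ • e i ⊕ -1ℤ • e j)
                ∷ ( -1ℤ • e i ⊕  1ℤ • e j)
                ∷ ( -1ℤ • e i ⊕ -1ℤ • e j)
                ∷ []

-- For n ≥ 2 the lattice Dₙ has rank n, since 2ℤⁿ ⊆ Dₙ ⊆ ℤⁿ.

IsCoordinatorPolynomialD : ℕ → Polynomial → Set
IsCoordinatorPolynomialD n = IsCoordinatorPolynomial n (M-D n)

-- Real numbers are Cauchy sequences of rationals, with the equality _≈ᴿ_
-- of sequences whose difference tends to zero; operations are termwise.

IsCauchy : (ℕ → ℚ) → Set
IsCauchy x = ∀ ε → 0ℚ ℚ.< ε →
  ∃[ N ] (∀ m n → N ℕ.≤ m → N ℕ.≤ n → ℚ.∣ x m ℚ.- x n ∣ ℚ.≤ ε)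

record ℝ : Set where
  constructor mkℝ
  field
    seq    : ℕ → ℚ
    cauchy : IsCauchy seq

open ℝ public

infix 4 _≈ᴿ_ _≈ᶜ_

_≈ᴿ_ : ℝ → ℝ → Set
x ≈ᴿ y = ∀ ε → 0ℚ ℚ.< ε →
  ∃[ N ] (∀ n → N ℕ.≤ n → ℚ.∣ seq x n ℚ.- seq y n ∣ ℚ.≤ ε)

private
  open ℚₚ.≤-Reasoning
  open CommutativeSemigroupProperties
    (Bundles.CommutativeMonoid.commutativeSemigroup ℚₚ.+-0-commutativeMonoid) using (interchange)

  +-rearrange : ∀ a b c d → (a ℚ.+ b) ℚ.- (c ℚ.+ d) ≡ (a ℚ.- c) ℚ.+ (b ℚ.- d)
  +-rearrange a b c d =
    trans (cong ((a ℚ.+ b) ℚ.+_) (ℚₚ.neg-distrib-+ c d)) (interchange a b (ℚ.- c) (ℚ.- d))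

  neg-rearrange : ∀ a b → (ℚ.- a) ℚ.- (ℚ.- b) ≡ ℚ.- (a ℚ.- b)
  neg-rearrange a b = sym (ℚₚ.neg-distrib-+ a (ℚ.- b))

  split : ∀ a b → a ≡ (a ℚ.- b) ℚ.+ b
  split a b = sym (trans (ℚₚ.+-assoc a (ℚ.- b) b)
    (trans (cong (a ℚ.+_) (ℚₚ.+-inverseˡ b)) (ℚₚ.+-identityʳ a)))

  factor : ∀ a b δ → a ℚ.* δ ℚ.+ δ ℚ.* b ≡ (a ℚ.+ b) ℚ.* δ
  factor a b δ =
    trans (cong (a ℚ.* δ ℚ.+_) (ℚₚ.*-comm δ b)) (sym (ℚₚ.*-distribʳ-+ δ a b))

  *-rearrange : ∀ a b c d →
    a ℚ.* b ℚ.- c ℚ.* d ≡ a ℚ.* (b ℚ.- d) ℚ.+ (a ℚ.- c) ℚ.* d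
  *-rearrange a b c d = begin-equality
    a ℚ.* b ℚ.- c ℚ.* d
      ≡⟨ cong (ℚ._- c ℚ.* d) (split (a ℚ.* b) (a ℚ.* d)) ⟩
    (a ℚ.* b ℚ.- a ℚ.* d ℚ.+ a ℚ.* d) ℚ.- c ℚ.* d
      ≡⟨ ℚₚ.+-assoc (a ℚ.* b ℚ.- a ℚ.* d) (a ℚ.* d) (ℚ.- (c ℚ.* d)) ⟩
    (a ℚ.* b ℚ.- a ℚ.* d) ℚ.+ (a ℚ.* d ℚ.- c ℚ.* d)
      ≡⟨ cong₂ (λ s t → (a ℚ.* b ℚ.+ s) ℚ.+ (a ℚ.* d ℚ.+ t))
               (ℚₚ.neg-distribʳ-* a d) (ℚₚ.neg-distribˡ-* c d) ⟩
    (a ℚ.* b ℚ.+ a ℚ.* (ℚ.- d)) ℚ.+ (a ℚ.* d ℚ.+ (ℚ.- c) ℚ.* d)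
      ≡⟨ sym (cong₂ ℚ._+_ (ℚₚ.*-distribˡ-+ a b (ℚ.- d)) (ℚₚ.*-distribʳ-+ d a (ℚ.- c))) ⟩
    a ℚ.* (b ℚ.- d) ℚ.+ (a ℚ.- c) ℚ.* d ∎

  const-cauchy : ∀ q → IsCauchy (λ _ → q)
  const-cauchy q ε 0<ε = 0 , λ _ _ _ _ →
    subst (λ t → ℚ.∣ t ∣ ℚ.≤ ε) (sym (ℚₚ.+-inverseʳ q)) (ℚₚ.<⇒≤ 0<ε)

  0<½* : ∀ {ε} → 0ℚ ℚ.< ε → 0ℚ ℚ.< ½ ℚ.* ε
  0<½* {ε} 0<ε = ℚₚ.positive⁻¹ (½ ℚ.* ε) {{ℚₚ.pos*pos⇒pos ½ ε {{ℚ.positive 0<ε}}}}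

  ½+½ : ∀ ε → ½ ℚ.* ε ℚ.+ ½ ℚ.* ε ≡ ε
  ½+½ ε = trans (sym (ℚₚ.*-distribʳ-+ ε ½ ½)) (ℚₚ.*-identityˡ ε)

  +-cauchy : ∀ x y → IsCauchy x → IsCauchy y → IsCauchy (λ n → x n ℚ.+ y n)
  +-cauchy x y cx cy ε 0<ε
    with cx (½ ℚ.* ε) (0<½* 0<ε) | cy (½ ℚ.* ε) (0<½* 0<ε)
  ... | N₁ , p | N₂ , q = N₁ ℕ.⊔ N₂ , λ m n N≤m N≤n → begin
    ℚ.∣ (x m ℚ.+ y m) ℚ.- (x n ℚ.+ y n) ∣
      ≡⟨ cong ℚ.∣_∣ (+-rearrange (x m) (y m) (x n) (y n)) ⟩
    ℚ.∣ (x m ℚ.- x n) ℚ.+ (y m ℚ.- y n) ∣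
      ≤⟨ ℚₚ.∣p+q∣≤∣p∣+∣q∣ (x m ℚ.- x n) (y m ℚ.- y n) ⟩
    ℚ.∣ x m ℚ.- x n ∣ ℚ.+ ℚ.∣ y m ℚ.- y n ∣
      ≤⟨ ℚₚ.+-mono-≤
           (p m n (ℕₚ.≤-trans (ℕₚ.m≤m⊔n N₁ N₂) N≤m) (ℕₚ.≤-trans (ℕₚ.m≤m⊔n N₁ N₂) N≤n))
           (q m n (ℕₚ.≤-trans (ℕₚ.m≤n⊔m N₁ N₂) N≤m) (ℕₚ.≤-trans (ℕₚ.m≤n⊔m N₁ N₂) N≤n)) ⟩
    ½ ℚ.* ε ℚ.+ ½ ℚ.* ε
      ≡⟨ ½+½ ε ⟩
    ε ∎

  neg-cauchy : ∀ x → IsCauchy x → IsCauchy (λ n → ℚ.- x n)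
  neg-cauchy x cx ε 0<ε with cx ε 0<ε
  ... | N , p = N , λ m n N≤m N≤n → begin
    ℚ.∣ (ℚ.- x m) ℚ.- (ℚ.- x n) ∣ ≡⟨ cong ℚ.∣_∣ (neg-rearrange (x m) (x n)) ⟩
    ℚ.∣ ℚ.- (x m ℚ.- x n) ∣       ≡⟨ ℚₚ.∣-p∣≡∣p∣ (x m ℚ.- x n) ⟩
    ℚ.∣ x m ℚ.- x n ∣             ≤⟨ p m n N≤m N≤n ⟩
    ε                             ∎

  EventuallyBounded : (ℕ → ℚ) → Set
  EventuallyBounded x =
    Σ[ B ∈ ℚ ] 0ℚ ℚ.< B × ∃[ N ] (∀ n → N ℕ.≤ n → ℚ.∣ x n ∣ ℚ.≤ B)

  bounded : ∀ x → IsCauchy x → EventuallyBounded x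
  bounded x cx with cx 1ℚ (ℚₚ.positive⁻¹ 1ℚ)
  ... | N , p =
    1ℚ ℚ.+ ℚ.∣ x N ∣ ,
    ℚₚ.+-mono-<-≤ (ℚₚ.positive⁻¹ 1ℚ) (ℚₚ.0≤∣p∣ (x N)) ,
    N , λ n N≤n → begin
      ℚ.∣ x n ∣                       ≡⟨ cong ℚ.∣_∣ (split (x n) (x N)) ⟩
      ℚ.∣ (x n ℚ.- x N) ℚ.+ x N ∣     ≤⟨ ℚₚ.∣p+q∣≤∣p∣+∣q∣ (x n ℚ.- x N) (x N) ⟩
      ℚ.∣ x n ℚ.- x N ∣ ℚ.+ ℚ.∣ x N ∣ ≤⟨ ℚₚ.+-monoˡ-≤ ℚ.∣ x N ∣ (p n N N≤n ℕₚ.≤-refl) ⟩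
      1ℚ ℚ.+ ℚ.∣ x N ∣                ∎

  abs-*-≤ : ∀ p q {A B} → 0ℚ ℚ.≤ A → ℚ.∣ p ∣ ℚ.≤ A → ℚ.∣ q ∣ ℚ.≤ B →
            ℚ.∣ p ℚ.* q ∣ ℚ.≤ A ℚ.* B
  abs-*-≤ p q {A} {B} 0≤A p≤A q≤B = begin
    ℚ.∣ p ℚ.* q ∣         ≡⟨ ℚₚ.∣p*q∣≡∣p∣*∣q∣ p q ⟩
    ℚ.∣ p ∣ ℚ.* ℚ.∣ q ∣   ≤⟨ ℚₚ.*-monoʳ-≤-nonNeg ℚ.∣ q ∣ {{ℚ.nonNegative (ℚₚ.0≤∣p∣ q)}} p≤A ⟩
    A ℚ.* ℚ.∣ q ∣         ≤⟨ ℚₚ.*-monoˡ-≤-nonNeg A {{ℚ.nonNegative 0≤A}} q≤B ⟩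
    A ℚ.* B               ∎

  divide : ∀ B ε → 0ℚ ℚ.< B → 0ℚ ℚ.< ε → Σ[ δ ∈ ℚ ] 0ℚ ℚ.< δ × B ℚ.* δ ≡ ε
  divide B ε 0<B 0<ε = δ , 0<δ , Bδ≡ε
    where
    instance
      _ = ℚ.positive 0<B
      _ = ℚ.positive 0<ε
      _ = ℚₚ.pos⇒nonZero B
      _ = ℚₚ.1/pos⇒pos B
    δ = (ℚ.1/ B) ℚ.* ε
    0<δ : 0ℚ ℚ.< δ
    0<δ = ℚₚ.positive⁻¹ δ {{ℚₚ.pos*pos⇒pos (ℚ.1/ B) ε}}
    Bδ≡ε : B ℚ.* δ ≡ ε
    Bδ≡ε = trans (sym (ℚₚ.*-assoc B (ℚ.1/ B) ε))
             (trans (cong (ℚ._* ε) (ℚₚ.*-inverseʳ B)) (ℚₚ.*-identityˡ ε))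

  *-cauchy : ∀ x y → IsCauchy x → IsCauchy y → IsCauchy (λ n → x n ℚ.* y n)
  *-cauchy x y cx cy ε 0<ε with bounded x cx | bounded y cy
  ... | A , 0<A , N₁ , x≤A | B , 0<B , N₂ , y≤B
    with divide (A ℚ.+ B) ε (ℚₚ.+-mono-< 0<A 0<B) 0<ε
  ... | δ , 0<δ , eq with cx δ 0<δ | cy δ 0<δ
  ... | N₃ , p | N₄ , q = (N₁ ℕ.⊔ N₂) ℕ.⊔ (N₃ ℕ.⊔ N₄) , λ m n N≤m N≤n → begin
    ℚ.∣ x m ℚ.* y m ℚ.- x n ℚ.* y n ∣
      ≡⟨ cong ℚ.∣_∣ (*-rearrange (x m) (y m) (x n) (y n)) ⟩
    ℚ.∣ x m ℚ.* (y m ℚ.- y n) ℚ.+ (x m ℚ.- x n) ℚ.* y n ∣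
      ≤⟨ ℚₚ.∣p+q∣≤∣p∣+∣q∣ (x m ℚ.* (y m ℚ.- y n)) ((x m ℚ.- x n) ℚ.* y n) ⟩
    ℚ.∣ x m ℚ.* (y m ℚ.- y n) ∣ ℚ.+ ℚ.∣ (x m ℚ.- x n) ℚ.* y n ∣
      ≤⟨ ℚₚ.+-mono-≤
           (abs-*-≤ (x m) (y m ℚ.- y n) (ℚₚ.<⇒≤ 0<A) (x≤A m (≤₁ N≤m)) (q m n (≤₄ N≤m) (≤₄ N≤n)))
           (abs-*-≤ (x m ℚ.- x n) (y n) (ℚₚ.<⇒≤ 0<δ) (p m n (≤₃ N≤m) (≤₃ N≤n)) (y≤B n (≤₂ N≤n))) ⟩
    A ℚ.* δ ℚ.+ δ ℚ.* B
      ≡⟨ factor A B δ ⟩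
    (A ℚ.+ B) ℚ.* δ
      ≡⟨ eq ⟩
    ε ∎
    where
    ≤₁₂ : ∀ {k} → (N₁ ℕ.⊔ N₂) ℕ.⊔ (N₃ ℕ.⊔ N₄) ℕ.≤ k → N₁ ℕ.⊔ N₂ ℕ.≤ k
    ≤₁₂ = ℕₚ.m⊔n≤o⇒m≤o (N₁ ℕ.⊔ N₂) (N₃ ℕ.⊔ N₄)
    ≤₃₄ : ∀ {k} → (N₁ ℕ.⊔ N₂) ℕ.⊔ (N₃ ℕ.⊔ N₄) ℕ.≤ k → N₃ ℕ.⊔ N₄ ℕ.≤ k
    ≤₃₄ = ℕₚ.m⊔n≤o⇒n≤o (N₁ ℕ.⊔ N₂) (N₃ ℕ.⊔ N₄)
    ≤₁ : ∀ {k} → (N₁ ℕ.⊔ N₂) ℕ.⊔ (N₃ ℕ.⊔ N₄) ℕ.≤ k → N₁ ℕ.≤ k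
    ≤₁ r = ℕₚ.m⊔n≤o⇒m≤o N₁ N₂ (≤₁₂ r)
    ≤₂ : ∀ {k} → (N₁ ℕ.⊔ N₂) ℕ.⊔ (N₃ ℕ.⊔ N₄) ℕ.≤ k → N₂ ℕ.≤ k
    ≤₂ r = ℕₚ.m⊔n≤o⇒n≤o N₁ N₂ (≤₁₂ r)
    ≤₃ : ∀ {k} → (N₁ ℕ.⊔ N₂) ℕ.⊔ (N₃ ℕ.⊔ N₄) ℕ.≤ k → N₃ ℕ.≤ k
    ≤₃ r = ℕₚ.m⊔n≤o⇒m≤o N₃ N₄ (≤₃₄ r)
    ≤₄ : ∀ {k} → (N₁ ℕ.⊔ N₂) ℕ.⊔ (N₃ ℕ.⊔ N₄) ℕ.≤ k → N₄ ℕ.≤ k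
    ≤₄ r = ℕₚ.m⊔n≤o⇒n≤o N₃ N₄ (≤₃₄ r)

infixl 6 _+ᴿ_ _+ᶜ_
infixl 7 _*ᴿ_ _*ᶜ_
infix  8 -ᴿ_

fromℤᴿ : ℤ → ℝ
fromℤᴿ a = mkℝ (λ _ → a ℚ./ 1) (const-cauchy (a ℚ./ 1))

0ᴿ : ℝ
0ᴿ = fromℤᴿ 0ℤ

_+ᴿ_ _*ᴿ_ : ℝ → ℝ → ℝ
x +ᴿ y = mkℝ (λ n → seq x n ℚ.+ seq y n) (+-cauchy (seq x) (seq y) (cauchy x) (cauchy y))
x *ᴿ y = mkℝ (λ n → seq x n ℚ.* seq y n) (*-cauchy (seq x) (seq y) (cauchy x) (cauchy y))

-ᴿ_ : ℝ → ℝ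
-ᴿ x = mkℝ (λ n → ℚ.- seq x n) (neg-cauchy (seq x) (cauchy x))

record ℂ : Set where
  constructor _+i_
  field
    re im : ℝ

open ℂ public

_≈ᶜ_ : ℂ → ℂ → Set
z ≈ᶜ w = re z ≈ᴿ re w × im z ≈ᴿ im w

fromℤᶜ : ℤ → ℂ
fromℤᶜ a = fromℤᴿ a +i 0ᴿ

0ᶜ : ℂ
0ᶜ = fromℤᶜ 0ℤ

_+ᶜ_ _*ᶜ_ : ℂ → ℂ → ℂ
z +ᶜ w = (re z +ᴿ re w) +i (im z +ᴿ im w)
z *ᶜ w = (re z *ᴿ re w +ᴿ -ᴿ (im z *ᴿ im w)) +i (re z *ᴿ im w +ᴿ im z *ᴿ re w)

eval : Polynomial → ℂ → ℂ
eval []      z = 0ᶜ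
eval (a ∷ p) z = fromℤᶜ a +ᶜ z *ᶜ eval p z

RealRooted : Polynomial → Set
RealRooted p = ∀ z → eval p z ≈ᶜ 0ᶜ → im z ≈ᴿ 0ᴿ

{-# OPTIONS --safe #-}

-- Put (1 + s)ᵐ = Wₘ(s²) + s Vₘ(s²).  The length of v ∈ Dₙ is the maximum of
-- ‖v‖∞ and ‖v‖₁ / 2, and at most one coordinate of v can exceed ‖v‖₁ / 2;
-- counting gives h = W₂ₙ - 2n x (1 + x)ⁿ⁻².  If Im x > 0 then every Wₘ / Vₘ
-- lies in the sector spanned by 1 and x, so for k + j = n both W₂ₖ W₂ⱼ / V₂ₙ
-- and x V₂ₖ V₂ⱼ / V₂ₙ have nonnegative imaginary part.  Moments of a simple
-- random walk show that 4 n (n - 1) 2ⁿ h equals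
--
--   n (n - 2) 2ⁿ W₂ₙ + Σₖ C(n,k) ((n - 2k)⁴ x V₂ₖ V₂ₙ₋₂ₖ + ((n - 2k)² - 2n)² W₂ₖ W₂ₙ₋₂ₖ),
--
-- whose term k = 1 makes the imaginary part of h / V₂ₙ strictly positive.  At
-- Gaussian rationals this becomes |Im x|³ ≤ K |h(x)| |V₂ₙ(x)|, an estimate that
-- applies to the terms of the Cauchy sequences representing a complex zero.

module Submission where

open import Defs

-- The subtracted term `2n x (1 + x)ⁿ⁻²` has no evident sign relative to `V₂ₙ`, so it has to be
-- absorbed by products that do have one. Let `A = (1 + s)²` and `B = (1 - s)²`, so that
-- `A + B = 2(1 + x)` and `(A - B)² = 16x`. Weighting the 2ⁿ words in `A` and `B` by `n - t²`, where
-- `t` is the difference of the two letter counts, gives the sum `-16 n (n - 1) x (2 + 2x)ⁿ⁻²`. The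
-- rational part of `AᵏBʲ` is `W₂ₖ W₂ⱼ - x V₂ₖ V₂ⱼ`, and the same expression with a plus sign is
-- `W₂ₙ`. A sum of terms `α W₂ₖ W₂ⱼ + β x V₂ₖ V₂ⱼ` therefore needs `α - β = 4n (n - t²)`, and this
-- is the difference of the squares `(t² - 2n)²` and `t⁴`. For reals given by Cauchy sequences the
-- sign of `Im z` cannot be decided, so refuting `Im z > 0` would not produce the required modulus
-- of convergence. An explicit inequality at every Gaussian rational, where signs are decidable,
-- produces it directly.

module GaussianRationals where

  open import Data.Nat as ℕ using (ℕ; zero; suc)
  import Data.Nat.Properties as ℕₚ
  open import Data.Rational as ℚ using (ℚ; 0ℚ; 1ℚ; _≤_)
  import Data.Rational
  import Data.Rational.Properties as ℚₚ
  open import Data.Product using (_,_; uncurry; _×_; proj₁; proj₂; Σ-syntax; ∃-syntax)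
  open import Relation.Binary.Definitions using (DecidableEquality)
  open import Relation.Nullary.Decidable using (dec⇒maybe; map′; _×-dec_; from-yes)
  open import Relation.Binary.PropositionalEquality
  open import Algebra.Bundles using (CommutativeRing)
  open import Tactic.RingSolver using (solve-∀)
  open import Tactic.RingSolver.Core.AlmostCommutativeRing using (AlmostCommutativeRing; fromCommutativeRing)
  open import Data.Sum using (inj₁; inj₂; [_,_]′)
  open import Data.Integer as ℤ using (ℤ; +_; 0ℤ; 1ℤ)
  import Data.Integer.Properties as ℤₚ
  open import Data.Integer.Tactic.RingSolver using () renaming (solve-∀ to solveℤ)
  open import Data.List as List using (List; []; _∷_)
  import Data.Rational.Unnormalised as ℚᵘ
  import Data.Rational.Unnormalised.Properties as ℚᵘₚ

  -- Arithmetic of Gaussian rationals.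

  ℚ-ring : AlmostCommutativeRing _ _
  ℚ-ring = fromCommutativeRing ℚₚ.+-*-commutativeRing (λ x → dec⇒maybe (0ℚ ℚₚ.≟ x))

  -- Without η the ring operations do not unfold on neutral arguments.

  record ℚ[i] : Set where
    no-eta-equality
    pattern
    constructor _+𝕚_
    field
      Re Im : ℚ

  open ℚ[i]

  infix 5 _+𝕚_

  infixl 6 _+ᵍ_
  infixl 7 _*ᵍ_
  infix  8 -ᵍ_

  -- The components copy `_+ᶜ_` and `_*ᶜ_` symbol by symbol, so that `term-eval` needs no rational
  -- arithmetic.
  _+ᵍ_ _*ᵍ_ : ℚ[i] → ℚ[i] → ℚ[i]
  (a +𝕚 b) +ᵍ (c +𝕚 d) = a ℚ.+ c +𝕚 b ℚ.+ d
  (a +𝕚 b) *ᵍ (c +𝕚 d) = a ℚ.* c ℚ.+ ℚ.- (b ℚ.* d) +𝕚 a ℚ.* d ℚ.+ b ℚ.* c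

  -ᵍ_ conj : ℚ[i] → ℚ[i]
  -ᵍ (a +𝕚 b) = ℚ.- a +𝕚 ℚ.- b
  conj (a +𝕚 b) = a +𝕚 ℚ.- b

  real : ℚ → ℚ[i]
  real a = a +𝕚 0ℚ

  0ᵍ 1ᵍ : ℚ[i]
  0ᵍ = real 0ℚ
  1ᵍ = real 1ℚ

  *ᵍ-assoc : ∀ x y z → (x *ᵍ y) *ᵍ z ≡ x *ᵍ (y *ᵍ z)
  *ᵍ-assoc (a +𝕚 b) (c +𝕚 d) (e +𝕚 f) = cong₂ _+𝕚_ (re′ a b c d e f) (im′ a b c d e f)
    where
    open Data.Rational using (_+_; _*_; -_)
    re′ : ∀ a b c d e f → (a * c + - (b * d)) * e + - ((a * d + b * c) * f) ≡ a * (c * e + - (d * f)) + - (b * (c * f + d * e))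
    re′ = solve-∀ ℚ-ring
    im′ : ∀ a b c d e f → (a * c + - (b * d)) * f + (a * d + b * c) * e ≡ a * (c * f + d * e) + b * (c * e + - (d * f))
    im′ = solve-∀ ℚ-ring

  *ᵍ-comm : ∀ x y → x *ᵍ y ≡ y *ᵍ x
  *ᵍ-comm (a +𝕚 b) (c +𝕚 d) = cong₂ _+𝕚_ (re′ a b c d) (im′ a b c d)
    where
    open Data.Rational using (_+_; _*_; -_)
    re′ : ∀ a b c d → a * c + - (b * d) ≡ c * a + - (d * b)
    re′ = solve-∀ ℚ-ring
    im′ : ∀ a b c d → a * d + b * c ≡ c * b + d * a
    im′ = solve-∀ ℚ-ring

  *ᵍ-identityˡ : ∀ x → 1ᵍ *ᵍ x ≡ x
  *ᵍ-identityˡ (a +𝕚 b) = cong₂ _+𝕚_ (re′ a b) (im′ a b)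
    where
    open Data.Rational using (_+_; _*_; -_)
    re′ : ∀ a b → 1ℚ * a + - (0ℚ * b) ≡ a
    re′ = solve-∀ ℚ-ring
    im′ : ∀ a b → 1ℚ * b + 0ℚ * a ≡ b
    im′ = solve-∀ ℚ-ring

  *ᵍ-distribˡ : ∀ x y z → x *ᵍ (y +ᵍ z) ≡ x *ᵍ y +ᵍ x *ᵍ z
  *ᵍ-distribˡ (a +𝕚 b) (c +𝕚 d) (e +𝕚 f) = cong₂ _+𝕚_ (re′ a b c d e f) (im′ a b c d e f)
    where
    open Data.Rational using (_+_; _*_; -_)
    re′ : ∀ a b c d e f → a * (c + e) + - (b * (d + f)) ≡ (a * c + - (b * d)) + (a * e + - (b * f))
    re′ = solve-∀ ℚ-ring
    im′ : ∀ a b c d e f → a * (d + f) + b * (c + e) ≡ (a * d + b * c) + (a * f + b * e)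
    im′ = solve-∀ ℚ-ring

  ℚ[i]-commutativeRing : CommutativeRing _ _
  ℚ[i]-commutativeRing = record
    { Carrier = ℚ[i] ; _≈_ = _≡_ ; _+_ = _+ᵍ_ ; _*_ = _*ᵍ_ ; -_ = -ᵍ_ ; 0# = 0ᵍ ; 1# = 1ᵍ
    ; isCommutativeRing = record
      { *-comm = *ᵍ-comm
      ; isRing = record
        { *-cong = cong₂ _*ᵍ_
        ; *-assoc = *ᵍ-assoc
        ; *-identity = *ᵍ-identityˡ , λ x → trans (*ᵍ-comm x 1ᵍ) (*ᵍ-identityˡ x)
        ; distrib = *ᵍ-distribˡ , λ x y z → trans (*ᵍ-comm (y +ᵍ z) x)
            (trans (*ᵍ-distribˡ x y z) (cong₂ _+ᵍ_ (*ᵍ-comm x y) (*ᵍ-comm x z)))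
        ; +-isAbelianGroup = record
          { comm = λ { (a +𝕚 b) (c +𝕚 d) → cong₂ _+𝕚_ (ℚₚ.+-comm a c) (ℚₚ.+-comm b d) }
          ; isGroup = record
            { ⁻¹-cong = cong -ᵍ_
            ; inverse = (λ { (a +𝕚 b) → cong₂ _+𝕚_ (ℚₚ.+-inverseˡ a) (ℚₚ.+-inverseˡ b) })
                      , (λ { (a +𝕚 b) → cong₂ _+𝕚_ (ℚₚ.+-inverseʳ a) (ℚₚ.+-inverseʳ b) })
            ; isMonoid = record
              { identity = (λ { (a +𝕚 b) → cong₂ _+𝕚_ (ℚₚ.+-identityˡ a) (ℚₚ.+-identityˡ b) })
                         , (λ { (a +𝕚 b) → cong₂ _+𝕚_ (ℚₚ.+-identityʳ a) (ℚₚ.+-identityʳ b) })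
              ; isSemigroup = record
                { assoc = λ { (a +𝕚 b) (c +𝕚 d) (e +𝕚 f) → cong₂ _+𝕚_ (ℚₚ.+-assoc a c e) (ℚₚ.+-assoc b d f) }
                ; isMagma = record { isEquivalence = isEquivalence ; ∙-cong = cong₂ _+ᵍ_ }
                } } } } } } }

  _≟ᵍ_ : DecidableEquality ℚ[i]
  (a +𝕚 b) ≟ᵍ (c +𝕚 d) = map′ (uncurry (cong₂ _+𝕚_)) (λ { refl → refl , refl }) (a ℚₚ.≟ c ×-dec b ℚₚ.≟ d)

  ℚ[i]-ring : AlmostCommutativeRing _ _
  ℚ[i]-ring = fromCommutativeRing ℚ[i]-commutativeRing (λ x → dec⇒maybe (0ᵍ ≟ᵍ x))

  2ᵍ 4ᵍ 8ᵍ 16ᵍ : ℚ[i]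
  2ᵍ = 1ᵍ +ᵍ 1ᵍ
  4ᵍ = 2ᵍ +ᵍ 2ᵍ
  8ᵍ = 4ᵍ +ᵍ 4ᵍ
  16ᵍ = 8ᵍ +ᵍ 8ᵍ

  ratℕ : ℕ → ℚ
  ratℕ zero = 0ℚ
  ratℕ (suc n) = 1ℚ ℚ.+ ratℕ n

  -- Unary, so that `natᵍ (suc n)` unfolds to `1ᵍ +ᵍ natᵍ n` and ring identities can treat `natᵍ n`
  -- as a variable.
  natᵍ : ℕ → ℚ[i]
  natᵍ zero = 0ᵍ
  natᵍ (suc n) = 1ᵍ +ᵍ natᵍ n

  natᵍ≡real : ∀ n → natᵍ n ≡ real (ratℕ n)
  natᵍ≡real zero = refl
  natᵍ≡real (suc n) rewrite natᵍ≡real n = refl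

  _^ᵍ_ : ℚ[i] → ℕ → ℚ[i]
  z ^ᵍ zero = 1ᵍ
  z ^ᵍ suc n = z *ᵍ (z ^ᵍ n)

  -- Rational and irrational parts of powers of 1 + s.

  module EvenOdd (x : ℚ[i]) where

    -- With s² = x, (1 + s)²ᵏ = w k + s · v k.

    w v : ℕ → ℚ[i]
    w zero = 1ᵍ
    w (suc k) = (w k +ᵍ x *ᵍ v k) +ᵍ x *ᵍ (w k +ᵍ v k)
    v zero = 0ᵍ
    v (suc k) = (w k +ᵍ x *ᵍ v k) +ᵍ (w k +ᵍ v k)

    -- Both parts of `(1 + s)²ᵏ (1 + s)²ʲ`; each induction step uses both identities.
    w-+ : ∀ k j → w (k ℕ.+ j) ≡ w k *ᵍ w j +ᵍ x *ᵍ (v k *ᵍ v j)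
    v-+ : ∀ k j → v (k ℕ.+ j) ≡ v k *ᵍ w j +ᵍ w k *ᵍ v j
    w-+ zero j = eq x (w j) (v j)
      where
      eq : ∀ x a b → a ≡ 1ᵍ *ᵍ a +ᵍ x *ᵍ (0ᵍ *ᵍ b)
      eq = solve-∀ ℚ[i]-ring
    w-+ (suc k) j rewrite w-+ k j | v-+ k j = eq x (w k) (v k) (w j) (v j)
      where
      eq : ∀ x a b c d → ((a *ᵍ c +ᵍ x *ᵍ (b *ᵍ d)) +ᵍ x *ᵍ (b *ᵍ c +ᵍ a *ᵍ d)) +ᵍ x *ᵍ ((a *ᵍ c +ᵍ x *ᵍ (b *ᵍ d)) +ᵍ (b *ᵍ c +ᵍ a *ᵍ d))
        ≡ ((a +ᵍ x *ᵍ b) +ᵍ x *ᵍ (a +ᵍ b)) *ᵍ c +ᵍ x *ᵍ (((a +ᵍ x *ᵍ b) +ᵍ (a +ᵍ b)) *ᵍ d)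
      eq = solve-∀ ℚ[i]-ring
    v-+ zero j = eq (w j) (v j)
      where
      eq : ∀ a b → b ≡ 0ᵍ *ᵍ a +ᵍ 1ᵍ *ᵍ b
      eq = solve-∀ ℚ[i]-ring
    v-+ (suc k) j rewrite w-+ k j | v-+ k j = eq x (w k) (v k) (w j) (v j)
      where
      eq : ∀ x a b c d → ((a *ᵍ c +ᵍ x *ᵍ (b *ᵍ d)) +ᵍ x *ᵍ (b *ᵍ c +ᵍ a *ᵍ d)) +ᵍ ((a *ᵍ c +ᵍ x *ᵍ (b *ᵍ d)) +ᵍ (b *ᵍ c +ᵍ a *ᵍ d))
        ≡ ((a +ᵍ x *ᵍ b) +ᵍ (a +ᵍ b)) *ᵍ c +ᵍ ((a +ᵍ x *ᵍ b) +ᵍ x *ᵍ (a +ᵍ b)) *ᵍ d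
      eq = solve-∀ ℚ[i]-ring

    -- M and N are the rational and the s-part of (1 + s)²ᵏ (1 - s)²ʲ.

    M N : ℕ → ℕ → ℚ[i]
    M k j = w k *ᵍ w j +ᵍ -ᵍ (x *ᵍ (v k *ᵍ v j))
    N k j = v k *ᵍ w j +ᵍ -ᵍ (w k *ᵍ v j)

    1+x : ℚ[i]
    1+x = 1ᵍ +ᵍ x

    -- A further factor `(1 + s)² = (1 + x) + 2s`. On the right the factor is `(1 - s)²`, which
    -- reverses the sign of `2s`.
    M-sucˡ : ∀ k j → M (suc k) j ≡ 1+x *ᵍ M k j +ᵍ 2ᵍ *ᵍ (x *ᵍ N k j)
    M-sucˡ k j = eq x (w k) (v k) (w j) (v j)
      where
      eq : ∀ x a b c d → ((a +ᵍ x *ᵍ b) +ᵍ x *ᵍ (a +ᵍ b)) *ᵍ c +ᵍ -ᵍ (x *ᵍ (((a +ᵍ x *ᵍ b) +ᵍ (a +ᵍ b)) *ᵍ d))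
        ≡ (1ᵍ +ᵍ x) *ᵍ (a *ᵍ c +ᵍ -ᵍ (x *ᵍ (b *ᵍ d))) +ᵍ 2ᵍ *ᵍ (x *ᵍ (b *ᵍ c +ᵍ -ᵍ (a *ᵍ d)))
      eq = solve-∀ ℚ[i]-ring

    N-sucˡ : ∀ k j → N (suc k) j ≡ 1+x *ᵍ N k j +ᵍ 2ᵍ *ᵍ M k j
    N-sucˡ k j = eq x (w k) (v k) (w j) (v j)
      where
      eq : ∀ x a b c d → ((a +ᵍ x *ᵍ b) +ᵍ (a +ᵍ b)) *ᵍ c +ᵍ -ᵍ (((a +ᵍ x *ᵍ b) +ᵍ x *ᵍ (a +ᵍ b)) *ᵍ d)
        ≡ (1ᵍ +ᵍ x) *ᵍ (b *ᵍ c +ᵍ -ᵍ (a *ᵍ d)) +ᵍ 2ᵍ *ᵍ (a *ᵍ c +ᵍ -ᵍ (x *ᵍ (b *ᵍ d)))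
      eq = solve-∀ ℚ[i]-ring

    M-sucʳ : ∀ k j → M k (suc j) ≡ 1+x *ᵍ M k j +ᵍ -ᵍ (2ᵍ *ᵍ (x *ᵍ N k j))
    M-sucʳ k j = eq x (w k) (v k) (w j) (v j)
      where
      eq : ∀ x a b c d → a *ᵍ ((c +ᵍ x *ᵍ d) +ᵍ x *ᵍ (c +ᵍ d)) +ᵍ -ᵍ (x *ᵍ (b *ᵍ ((c +ᵍ x *ᵍ d) +ᵍ (c +ᵍ d))))
        ≡ (1ᵍ +ᵍ x) *ᵍ (a *ᵍ c +ᵍ -ᵍ (x *ᵍ (b *ᵍ d))) +ᵍ -ᵍ (2ᵍ *ᵍ (x *ᵍ (b *ᵍ c +ᵍ -ᵍ (a *ᵍ d))))
      eq = solve-∀ ℚ[i]-ring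

    N-sucʳ : ∀ k j → N k (suc j) ≡ 1+x *ᵍ N k j +ᵍ -ᵍ (2ᵍ *ᵍ M k j)
    N-sucʳ k j = eq x (w k) (v k) (w j) (v j)
      where
      eq : ∀ x a b c d → b *ᵍ ((c +ᵍ x *ᵍ d) +ᵍ x *ᵍ (c +ᵍ d)) +ᵍ -ᵍ (a *ᵍ ((c +ᵍ x *ᵍ d) +ᵍ (c +ᵍ d)))
        ≡ (1ᵍ +ᵍ x) *ᵍ (b *ᵍ c +ᵍ -ᵍ (a *ᵍ d)) +ᵍ -ᵍ (2ᵍ *ᵍ (a *ᵍ c +ᵍ -ᵍ (x *ᵍ (b *ᵍ d))))
      eq = solve-∀ ℚ[i]-ring

  -- First and second derivative of pⁿ with respect to p.

  ^′ ^″ : ℚ[i] → ℕ → ℚ[i]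
  ^′ p zero = 0ᵍ
  ^′ p (suc n) = p *ᵍ ^′ p n +ᵍ p ^ᵍ n
  ^″ p zero = 0ᵍ
  ^″ p (suc n) = p *ᵍ ^″ p n +ᵍ 2ᵍ *ᵍ ^′ p n

  ^′-closed : ∀ p n → ^′ p (suc n) ≡ natᵍ (suc n) *ᵍ p ^ᵍ n
  ^′-closed p zero = eq p
    where
    eq : ∀ p → p *ᵍ 0ᵍ +ᵍ 1ᵍ ≡ 1ᵍ *ᵍ 1ᵍ
    eq = solve-∀ ℚ[i]-ring
  ^′-closed p (suc n) rewrite ^′-closed p n = eq p (natᵍ n) (p ^ᵍ n)
    where
    eq : ∀ p m q → p *ᵍ ((1ᵍ +ᵍ m) *ᵍ q) +ᵍ p *ᵍ q ≡ (1ᵍ +ᵍ (1ᵍ +ᵍ m)) *ᵍ (p *ᵍ q)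
    eq = solve-∀ ℚ[i]-ring

  ^″-closed : ∀ p n → ^″ p (suc (suc n)) ≡ natᵍ (suc (suc n)) *ᵍ (natᵍ (suc n) *ᵍ p ^ᵍ n)
  ^″-closed p zero = eq p
    where
    eq : ∀ p → p *ᵍ (p *ᵍ 0ᵍ +ᵍ 2ᵍ *ᵍ 0ᵍ) +ᵍ 2ᵍ *ᵍ (p *ᵍ 0ᵍ +ᵍ 1ᵍ) ≡ 2ᵍ *ᵍ (1ᵍ *ᵍ 1ᵍ)
    eq = solve-∀ ℚ[i]-ring
  ^″-closed p (suc n) rewrite ^″-closed p n | ^′-closed p (suc n) = eq p (natᵍ n) (p ^ᵍ n)
    where
    eq : ∀ p m q → p *ᵍ ((1ᵍ +ᵍ (1ᵍ +ᵍ m)) *ᵍ ((1ᵍ +ᵍ m) *ᵍ q)) +ᵍ 2ᵍ *ᵍ ((1ᵍ +ᵍ (1ᵍ +ᵍ m)) *ᵍ (p *ᵍ q))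
      ≡ (1ᵍ +ᵍ (1ᵍ +ᵍ (1ᵍ +ᵍ m))) *ᵍ ((1ᵍ +ᵍ (1ᵍ +ᵍ m)) *ᵍ (p *ᵍ q))
    eq = solve-∀ ℚ[i]-ring

  ^-*-distrib : ∀ z u n → (z *ᵍ u) ^ᵍ n ≡ z ^ᵍ n *ᵍ u ^ᵍ n
  ^-*-distrib z u zero = refl
  ^-*-distrib z u (suc n) rewrite ^-*-distrib z u n = eq z u (z ^ᵍ n) (u ^ᵍ n)
    where
    eq : ∀ z u p q → z *ᵍ u *ᵍ (p *ᵍ q) ≡ z *ᵍ p *ᵍ (u *ᵍ q)
    eq = solve-∀ ℚ[i]-ring

  -- Sums over the 2ⁿ words in two letters.  A word with k letters of the
  -- first and j of the second kind contributes φ (t + k - j) k j.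

  module Walk (φ : ℚ[i] → ℕ → ℕ → ℚ[i]) where
    walk : ℕ → ℚ[i] → ℕ → ℕ → ℚ[i]
    walk zero t k j = φ t k j
    walk (suc n) t k j = walk n (t +ᵍ 1ᵍ) (suc k) j +ᵍ walk n (t +ᵍ -ᵍ 1ᵍ) k (suc j)

  -- Moments of the walk and the resulting decomposition.

  module Decomposition (x ν : ℚ[i]) where
    open EvenOdd x

    sq : ℚ[i] → ℚ[i]
    sq t = t *ᵍ t

    -- `ν` is kept apart from the number of steps: the induction lowers the latter and must leave
    -- the weights alone.
    summand : ℚ[i] → ℕ → ℕ → ℚ[i]
    summand t k j = sq (sq t) *ᵍ (x *ᵍ (v k *ᵍ v j)) +ᵍ sq (sq t +ᵍ -ᵍ (2ᵍ *ᵍ ν)) *ᵍ (w k *ᵍ w j)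

    open Walk summand

    p : ℚ[i]
    p = 2ᵍ *ᵍ 1+x

    -- 2ⁿ times the expectation of t⁴ - 2νt² + 2ν² after n steps.
    wMoment : ℕ → ℚ[i] → ℚ[i]
    wMoment n t = (2ᵍ ^ᵍ n) *ᵍ (sq (sq t) +ᵍ (4ᵍ +ᵍ 2ᵍ) *ᵍ (m *ᵍ sq t) +ᵍ (2ᵍ +ᵍ 1ᵍ) *ᵍ sq m +ᵍ -ᵍ (2ᵍ *ᵍ m)
       +ᵍ -ᵍ (2ᵍ *ᵍ (ν *ᵍ (sq t +ᵍ m))) +ᵍ 2ᵍ *ᵍ sq ν)
      where m = natᵍ n

    -- With `A = (1 + s)²`, `B = (1 - s)²`, `A + B = p` and `A - B = 4s`, the sum of `(ν - T²) AᵍBʰ`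
    -- over words with `g + h = n` letters and `T = t + g - h` is
    -- `(ν - t² - n) pⁿ - 8ts (pⁿ)′ - 16x (pⁿ)″`. This is the rational part of its product with
    -- `a + s b`.
    Mform : ℕ → ℚ[i] → ℚ[i] → ℚ[i] → ℚ[i]
    Mform n t a b =
      (ν +ᵍ -ᵍ sq t +ᵍ -ᵍ natᵍ n) *ᵍ ((p ^ᵍ n) *ᵍ a)
      +ᵍ -ᵍ (16ᵍ *ᵍ (x *ᵍ (^″ p n *ᵍ a)))
      +ᵍ -ᵍ (8ᵍ *ᵍ (x *ᵍ (t *ᵍ (^′ p n *ᵍ b))))

    Mmoment : ℕ → ℚ[i] → ℕ → ℕ → ℚ[i]
    Mmoment n t k j = Mform n t (M k j) (N k j)

    wMoment-suc : ∀ n t → wMoment (suc n) t ≡ wMoment n (t +ᵍ 1ᵍ) +ᵍ wMoment n (t +ᵍ -ᵍ 1ᵍ)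
    wMoment-suc n t = eq (2ᵍ ^ᵍ n) (natᵍ n) ν t
      where
      eq : ∀ q m ν t →
        (2ᵍ *ᵍ q) *ᵍ (t *ᵍ t *ᵍ (t *ᵍ t) +ᵍ (4ᵍ +ᵍ 2ᵍ) *ᵍ ((1ᵍ +ᵍ m) *ᵍ (t *ᵍ t)) +ᵍ (2ᵍ +ᵍ 1ᵍ) *ᵍ ((1ᵍ +ᵍ m) *ᵍ (1ᵍ +ᵍ m)) +ᵍ -ᵍ (2ᵍ *ᵍ (1ᵍ +ᵍ m))
          +ᵍ -ᵍ (2ᵍ *ᵍ (ν *ᵍ (t *ᵍ t +ᵍ (1ᵍ +ᵍ m)))) +ᵍ 2ᵍ *ᵍ (ν *ᵍ ν))
        ≡ q *ᵍ ((t +ᵍ 1ᵍ) *ᵍ (t +ᵍ 1ᵍ) *ᵍ ((t +ᵍ 1ᵍ) *ᵍ (t +ᵍ 1ᵍ)) +ᵍ (4ᵍ +ᵍ 2ᵍ) *ᵍ (m *ᵍ ((t +ᵍ 1ᵍ) *ᵍ (t +ᵍ 1ᵍ))) +ᵍ (2ᵍ +ᵍ 1ᵍ) *ᵍ (m *ᵍ m) +ᵍ -ᵍ (2ᵍ *ᵍ m)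
          +ᵍ -ᵍ (2ᵍ *ᵍ (ν *ᵍ ((t +ᵍ 1ᵍ) *ᵍ (t +ᵍ 1ᵍ) +ᵍ m))) +ᵍ 2ᵍ *ᵍ (ν *ᵍ ν))
        +ᵍ q *ᵍ ((t +ᵍ -ᵍ 1ᵍ) *ᵍ (t +ᵍ -ᵍ 1ᵍ) *ᵍ ((t +ᵍ -ᵍ 1ᵍ) *ᵍ (t +ᵍ -ᵍ 1ᵍ)) +ᵍ (4ᵍ +ᵍ 2ᵍ) *ᵍ (m *ᵍ ((t +ᵍ -ᵍ 1ᵍ) *ᵍ (t +ᵍ -ᵍ 1ᵍ))) +ᵍ (2ᵍ +ᵍ 1ᵍ) *ᵍ (m *ᵍ m) +ᵍ -ᵍ (2ᵍ *ᵍ m)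
          +ᵍ -ᵍ (2ᵍ *ᵍ (ν *ᵍ ((t +ᵍ -ᵍ 1ᵍ) *ᵍ (t +ᵍ -ᵍ 1ᵍ) +ᵍ m))) +ᵍ 2ᵍ *ᵍ (ν *ᵍ ν))
      eq = solve-∀ ℚ[i]-ring

    Mmoment-suc : ∀ n t k j → Mmoment (suc n) t k j ≡ Mmoment n (t +ᵍ 1ᵍ) (suc k) j +ᵍ Mmoment n (t +ᵍ -ᵍ 1ᵍ) k (suc j)
    Mmoment-suc n t k j =
      trans (eq (natᵍ n) ν t x 1+x (p ^ᵍ n) (^′ p n) (^″ p n) (M k j) (N k j))
            (sym (cong₂ _+ᵍ_ (cong₂ (Mform n (t +ᵍ 1ᵍ)) (M-sucˡ k j) (N-sucˡ k j))
                             (cong₂ (Mform n (t +ᵍ -ᵍ 1ᵍ)) (M-sucʳ k j) (N-sucʳ k j))))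
      where
      eq : ∀ m ν t x X q q′ q″ a b →
          (ν +ᵍ -ᵍ (t *ᵍ t) +ᵍ -ᵍ (1ᵍ +ᵍ m)) *ᵍ ((2ᵍ *ᵍ X *ᵍ q) *ᵍ a)
            +ᵍ -ᵍ (16ᵍ *ᵍ (x *ᵍ ((2ᵍ *ᵍ X *ᵍ q″ +ᵍ 2ᵍ *ᵍ q′) *ᵍ a)))
            +ᵍ -ᵍ (8ᵍ *ᵍ (x *ᵍ (t *ᵍ ((2ᵍ *ᵍ X *ᵍ q′ +ᵍ q) *ᵍ b))))
        ≡ ((ν +ᵍ -ᵍ ((t +ᵍ 1ᵍ) *ᵍ (t +ᵍ 1ᵍ)) +ᵍ -ᵍ m) *ᵍ (q *ᵍ (X *ᵍ a +ᵍ 2ᵍ *ᵍ (x *ᵍ b)))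
            +ᵍ -ᵍ (16ᵍ *ᵍ (x *ᵍ (q″ *ᵍ (X *ᵍ a +ᵍ 2ᵍ *ᵍ (x *ᵍ b)))))
            +ᵍ -ᵍ (8ᵍ *ᵍ (x *ᵍ ((t +ᵍ 1ᵍ) *ᵍ (q′ *ᵍ (X *ᵍ b +ᵍ 2ᵍ *ᵍ a))))))
         +ᵍ ((ν +ᵍ -ᵍ ((t +ᵍ -ᵍ 1ᵍ) *ᵍ (t +ᵍ -ᵍ 1ᵍ)) +ᵍ -ᵍ m) *ᵍ (q *ᵍ (X *ᵍ a +ᵍ -ᵍ (2ᵍ *ᵍ (x *ᵍ b))))
            +ᵍ -ᵍ (16ᵍ *ᵍ (x *ᵍ (q″ *ᵍ (X *ᵍ a +ᵍ -ᵍ (2ᵍ *ᵍ (x *ᵍ b))))))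
            +ᵍ -ᵍ (8ᵍ *ᵍ (x *ᵍ ((t +ᵍ -ᵍ 1ᵍ) *ᵍ (q′ *ᵍ (X *ᵍ b +ᵍ -ᵍ (2ᵍ *ᵍ a)))))))
      eq = solve-∀ ℚ[i]-ring

    moments : ℕ → ℚ[i] → ℕ → ℕ → ℚ[i] → ℚ[i]
    moments n t k j z = wMoment n t *ᵍ z +ᵍ 2ᵍ *ᵍ (ν *ᵍ Mmoment n t k j)

    -- Split each summand along `w k w j + x v k v j` and `M k j`. The former is `w (k + j)`, which
    -- at the end of the walk is the same for all words, so only a scalar moment multiplies it; the
    -- latter has coefficient `2ν (ν - t²)`.
    walk≡moments : ∀ n t k j → walk n t k j ≡ moments n t k j (w (k ℕ.+ j ℕ.+ n))
    walk≡moments zero t k j =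
      trans (eq ν t x (w k) (w j) (v k) (v j))
            (cong (moments zero t k j) (sym (trans (cong w (ℕₚ.+-identityʳ (k ℕ.+ j))) (w-+ k j))))
      where
      eq : ∀ ν t x a b c d →
         t *ᵍ t *ᵍ (t *ᵍ t) *ᵍ (x *ᵍ (c *ᵍ d)) +ᵍ (t *ᵍ t +ᵍ -ᵍ (2ᵍ *ᵍ ν)) *ᵍ (t *ᵍ t +ᵍ -ᵍ (2ᵍ *ᵍ ν)) *ᵍ (a *ᵍ b)
         ≡ 1ᵍ *ᵍ (t *ᵍ t *ᵍ (t *ᵍ t) +ᵍ (4ᵍ +ᵍ 2ᵍ) *ᵍ (0ᵍ *ᵍ (t *ᵍ t)) +ᵍ (2ᵍ +ᵍ 1ᵍ) *ᵍ (0ᵍ *ᵍ 0ᵍ) +ᵍ -ᵍ (2ᵍ *ᵍ 0ᵍ)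
             +ᵍ -ᵍ (2ᵍ *ᵍ (ν *ᵍ (t *ᵍ t +ᵍ 0ᵍ))) +ᵍ 2ᵍ *ᵍ (ν *ᵍ ν)) *ᵍ (a *ᵍ b +ᵍ x *ᵍ (c *ᵍ d))
           +ᵍ 2ᵍ *ᵍ (ν *ᵍ ((ν +ᵍ -ᵍ (t *ᵍ t) +ᵍ -ᵍ 0ᵍ) *ᵍ (1ᵍ *ᵍ (a *ᵍ b +ᵍ -ᵍ (x *ᵍ (c *ᵍ d))))
              +ᵍ -ᵍ (16ᵍ *ᵍ (x *ᵍ (0ᵍ *ᵍ (a *ᵍ b +ᵍ -ᵍ (x *ᵍ (c *ᵍ d))))))
              +ᵍ -ᵍ (8ᵍ *ᵍ (x *ᵍ (t *ᵍ (0ᵍ *ᵍ (c *ᵍ b +ᵍ -ᵍ (a *ᵍ d))))))))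
      eq = solve-∀ ℚ[i]-ring
    walk≡moments (suc n) t k j = begin
      walk n (t +ᵍ 1ᵍ) (suc k) j +ᵍ walk n (t +ᵍ -ᵍ 1ᵍ) k (suc j)
        ≡⟨ cong₂ _+ᵍ_ (walk≡moments n (t +ᵍ 1ᵍ) (suc k) j) (walk≡moments n (t +ᵍ -ᵍ 1ᵍ) k (suc j)) ⟩
      moments n (t +ᵍ 1ᵍ) (suc k) j (w (suc k ℕ.+ j ℕ.+ n)) +ᵍ moments n (t +ᵍ -ᵍ 1ᵍ) k (suc j) (w (k ℕ.+ suc j ℕ.+ n))
        ≡⟨ cong₂ (λ m m′ → moments n (t +ᵍ 1ᵍ) (suc k) j (w m) +ᵍ moments n (t +ᵍ -ᵍ 1ᵍ) k (suc j) (w m′))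
             (sym (ℕₚ.+-suc (k ℕ.+ j) n))
             (trans (cong (ℕ._+ n) (ℕₚ.+-suc k j)) (sym (ℕₚ.+-suc (k ℕ.+ j) n))) ⟩
      moments n (t +ᵍ 1ᵍ) (suc k) j W +ᵍ moments n (t +ᵍ -ᵍ 1ᵍ) k (suc j) W
        ≡⟨ eq (wMoment n (t +ᵍ 1ᵍ)) (wMoment n (t +ᵍ -ᵍ 1ᵍ)) ν W
              (Mmoment n (t +ᵍ 1ᵍ) (suc k) j) (Mmoment n (t +ᵍ -ᵍ 1ᵍ) k (suc j)) ⟩
      (wMoment n (t +ᵍ 1ᵍ) +ᵍ wMoment n (t +ᵍ -ᵍ 1ᵍ)) *ᵍ W
        +ᵍ 2ᵍ *ᵍ (ν *ᵍ (Mmoment n (t +ᵍ 1ᵍ) (suc k) j +ᵍ Mmoment n (t +ᵍ -ᵍ 1ᵍ) k (suc j)))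
        ≡⟨ cong₂ (λ a b → a *ᵍ W +ᵍ 2ᵍ *ᵍ (ν *ᵍ b)) (wMoment-suc n t) (Mmoment-suc n t k j) ⟨
      moments (suc n) t k j W ∎
      where
      open ≡-Reasoning
      W : ℚ[i]
      W = w (k ℕ.+ j ℕ.+ suc n)
      eq : ∀ a b ν c d f → a *ᵍ c +ᵍ 2ᵍ *ᵍ (ν *ᵍ d) +ᵍ (b *ᵍ c +ᵍ 2ᵍ *ᵍ (ν *ᵍ f)) ≡ (a +ᵍ b) *ᵍ c +ᵍ 2ᵍ *ᵍ (ν *ᵍ (d +ᵍ f))
      eq = solve-∀ ℚ[i]-ring

  module _ (x : ℚ[i]) (n : ℕ) where
    private
      ν : ℚ[i]
      ν = natᵍ (2 ℕ.+ n)
    open EvenOdd x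
    open Decomposition x ν
    open Walk summand

    -- At `t = 0` and `ν` steps the `pⁿ` and `^′` terms of `Mform` vanish, and `^″` yields the
    -- subtracted term of the closed form. The scalar moment is `3ν² - 2ν` times the power of two,
    -- which falls short of `4ν (ν - 1)` by `ν (ν - 2)`; this is the extra multiple of `w`.
    decomposition :
      4ᵍ *ᵍ (ν *ᵍ (natᵍ (suc n) *ᵍ (2ᵍ ^ᵍ (2 ℕ.+ n)))) *ᵍ (w (2 ℕ.+ n) +ᵍ -ᵍ (2ᵍ *ᵍ (ν *ᵍ (x *ᵍ (1+x ^ᵍ n)))))
      ≡ walk (2 ℕ.+ n) 0ᵍ 0 0 +ᵍ (2ᵍ ^ᵍ (2 ℕ.+ n)) *ᵍ (ν *ᵍ natᵍ n) *ᵍ w (2 ℕ.+ n)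
    decomposition = trans (eq (natᵍ n) (2ᵍ ^ᵍ n) x (1+x ^ᵍ n) (w (2 ℕ.+ n)) (^′ p (2 ℕ.+ n)) (p ^ᵍ n))
      (cong (_+ᵍ (2ᵍ ^ᵍ (2 ℕ.+ n)) *ᵍ (ν *ᵍ natᵍ n) *ᵍ w (2 ℕ.+ n)) (sym lemma))
      where
      -- The moments at the start, with the second derivative abstracted so that its closed form can
      -- be substituted.
      rhs : ℚ[i] → ℚ[i]
      rhs q = wMoment (2 ℕ.+ n) 0ᵍ *ᵍ w (2 ℕ.+ n) +ᵍ
              2ᵍ *ᵍ (ν *ᵍ ((ν +ᵍ -ᵍ sq 0ᵍ +ᵍ -ᵍ ν) *ᵍ ((p *ᵍ (p *ᵍ (p ^ᵍ n))) *ᵍ M 0 0)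
                     +ᵍ -ᵍ (16ᵍ *ᵍ (x *ᵍ (q *ᵍ M 0 0)))
                     +ᵍ -ᵍ (8ᵍ *ᵍ (x *ᵍ (0ᵍ *ᵍ (^′ p (2 ℕ.+ n) *ᵍ N 0 0))))))
      lemma : walk (2 ℕ.+ n) 0ᵍ 0 0 ≡ rhs (ν *ᵍ (natᵍ (suc n) *ᵍ ((2ᵍ ^ᵍ n) *ᵍ (1+x ^ᵍ n))))
      lemma = trans (walk≡moments (2 ℕ.+ n) 0ᵍ 0 0)
        (cong rhs (trans (^″-closed p n) (cong (λ q → ν *ᵍ (natᵍ (suc n) *ᵍ q)) (^-*-distrib 2ᵍ 1+x n))))
      eq : ∀ m q x u w q′ pn →
        4ᵍ *ᵍ ((1ᵍ +ᵍ (1ᵍ +ᵍ m)) *ᵍ ((1ᵍ +ᵍ m) *ᵍ (2ᵍ *ᵍ (2ᵍ *ᵍ q)))) *ᵍ (w +ᵍ -ᵍ (2ᵍ *ᵍ ((1ᵍ +ᵍ (1ᵍ +ᵍ m)) *ᵍ (x *ᵍ u))))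
        ≡ (2ᵍ *ᵍ (2ᵍ *ᵍ q)) *ᵍ (0ᵍ *ᵍ 0ᵍ *ᵍ (0ᵍ *ᵍ 0ᵍ) +ᵍ (4ᵍ +ᵍ 2ᵍ) *ᵍ ((1ᵍ +ᵍ (1ᵍ +ᵍ m)) *ᵍ (0ᵍ *ᵍ 0ᵍ))
              +ᵍ (2ᵍ +ᵍ 1ᵍ) *ᵍ ((1ᵍ +ᵍ (1ᵍ +ᵍ m)) *ᵍ (1ᵍ +ᵍ (1ᵍ +ᵍ m))) +ᵍ -ᵍ (2ᵍ *ᵍ (1ᵍ +ᵍ (1ᵍ +ᵍ m)))
              +ᵍ -ᵍ (2ᵍ *ᵍ ((1ᵍ +ᵍ (1ᵍ +ᵍ m)) *ᵍ (0ᵍ *ᵍ 0ᵍ +ᵍ (1ᵍ +ᵍ (1ᵍ +ᵍ m))))) +ᵍ 2ᵍ *ᵍ ((1ᵍ +ᵍ (1ᵍ +ᵍ m)) *ᵍ (1ᵍ +ᵍ (1ᵍ +ᵍ m)))) *ᵍ w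
          +ᵍ 2ᵍ *ᵍ ((1ᵍ +ᵍ (1ᵍ +ᵍ m)) *ᵍ (((1ᵍ +ᵍ (1ᵍ +ᵍ m)) +ᵍ -ᵍ (0ᵍ *ᵍ 0ᵍ) +ᵍ -ᵍ (1ᵍ +ᵍ (1ᵍ +ᵍ m)))
                 *ᵍ ((2ᵍ *ᵍ (1ᵍ +ᵍ x) *ᵍ (2ᵍ *ᵍ (1ᵍ +ᵍ x) *ᵍ pn)) *ᵍ (1ᵍ *ᵍ 1ᵍ +ᵍ -ᵍ (x *ᵍ (0ᵍ *ᵍ 0ᵍ))))
               +ᵍ -ᵍ (16ᵍ *ᵍ (x *ᵍ ((1ᵍ +ᵍ (1ᵍ +ᵍ m)) *ᵍ ((1ᵍ +ᵍ m) *ᵍ (q *ᵍ u)) *ᵍ (1ᵍ *ᵍ 1ᵍ +ᵍ -ᵍ (x *ᵍ (0ᵍ *ᵍ 0ᵍ))))))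
               +ᵍ -ᵍ (8ᵍ *ᵍ (x *ᵍ (0ᵍ *ᵍ (q′ *ᵍ (0ᵍ *ᵍ 1ᵍ +ᵍ -ᵍ (1ᵍ *ᵍ 0ᵍ))))))))
          +ᵍ 2ᵍ *ᵍ (2ᵍ *ᵍ q) *ᵍ ((1ᵍ +ᵍ (1ᵍ +ᵍ m)) *ᵍ m) *ᵍ w
      eq = solve-∀ ℚ[i]-ring

  -- Imaginary parts of quotients and the sector of 1 and x.

  open ℚ[i]

  ≤-by : ∀ {p q} r → 0ℚ ≤ r → q ≡ p ℚ.+ r → p ≤ q
  ≤-by {p} r 0≤r q≡p+r = subst₂ _≤_ (ℚₚ.+-identityʳ p) (sym q≡p+r) (ℚₚ.+-monoʳ-≤ p 0≤r)

  0≤+ : ∀ {p q} → 0ℚ ≤ p → 0ℚ ≤ q → 0ℚ ≤ p ℚ.+ q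
  0≤+ = ℚₚ.+-mono-≤

  0≤* : ∀ {p q} → 0ℚ ≤ p → 0ℚ ≤ q → 0ℚ ≤ p ℚ.* q
  0≤* {p} {q} 0≤p 0≤q = subst (_≤ p ℚ.* q) (ℚₚ.*-zeroʳ p) (ℚₚ.*-monoˡ-≤-nonNeg p {{ℚ.nonNegative 0≤p}} 0≤q)

  0≤² : ∀ p → 0ℚ ≤ p ℚ.* p
  0≤² p with ℚₚ.≤-total 0ℚ p
  ... | inj₁ 0≤p = 0≤* 0≤p 0≤p
  ... | inj₂ p≤0 = subst (0ℚ ≤_) (eq p) (0≤* (ℚₚ.neg-antimono-≤ p≤0) (ℚₚ.neg-antimono-≤ p≤0))
    where
    eq : ∀ p → (ℚ.- p) ℚ.* (ℚ.- p) ≡ p ℚ.* p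
    eq = solve-∀ ℚ-ring

  0≤ratℕ : ∀ n → 0ℚ ≤ ratℕ n
  0≤ratℕ zero = ℚₚ.≤-refl
  0≤ratℕ (suc n) = 0≤+ (from-yes (0ℚ ℚ.≤? 1ℚ)) (0≤ratℕ n)

  norm² : ℚ[i] → ℚ
  norm² z = Re z ℚ.* Re z ℚ.+ Im z ℚ.* Im z

  0≤norm² : ∀ z → 0ℚ ≤ norm² z
  0≤norm² z = 0≤+ (0≤² (Re z)) (0≤² (Im z))

  infix 8 _∧_

  -- For nonzero `u` this is `|u|² Im (z / u)`: the sign of the imaginary part of a quotient,
  -- without division.
  _∧_ : ℚ[i] → ℚ[i] → ℚ
  z ∧ u = Im (z *ᵍ conj u)

  ∧-distribʳ-+ : ∀ z z′ u → (z +ᵍ z′) ∧ u ≡ z ∧ u ℚ.+ z′ ∧ u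
  ∧-distribʳ-+ (a +𝕚 b) (c +𝕚 d) (e +𝕚 f) = eq a b c d e f
    where
    open Data.Rational using (_+_; _*_; -_)
    eq : ∀ a b c d e f → (a + c) * - f + (b + d) * e ≡ (a * - f + b * e) + (c * - f + d * e)
    eq = solve-∀ ℚ-ring

  ∧-realˡ : ∀ r z u → (real r *ᵍ z) ∧ u ≡ r ℚ.* z ∧ u
  ∧-realˡ r (c +𝕚 d) (e +𝕚 f) = eq r c d e f
    where
    open Data.Rational using (_+_; _*_; -_)
    eq : ∀ r c d e f → (r * c + - (0ℚ * d)) * - f + (r * d + 0ℚ * c) * e ≡ r * (c * - f + d * e)
    eq = solve-∀ ℚ-ring

  -- The reciprocal quotient is `b/a + d/c`, so imaginary parts add up. Likewise `∧-product₂` rests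
  -- on `c/(x d) + a/(x b)`.
  ∧-product₁ : ∀ a b c d → (a *ᵍ c) ∧ (b *ᵍ c +ᵍ a *ᵍ d) ≡ norm² c ℚ.* a ∧ b ℚ.+ norm² a ℚ.* c ∧ d
  ∧-product₁ (a₁ +𝕚 a₂) (b₁ +𝕚 b₂) (c₁ +𝕚 c₂) (d₁ +𝕚 d₂) = eq a₁ a₂ b₁ b₂ c₁ c₂ d₁ d₂
    where
    open Data.Rational using (_+_; _*_; -_)
    eq : ∀ a₁ a₂ b₁ b₂ c₁ c₂ d₁ d₂ →
      (a₁ * c₁ + - (a₂ * c₂)) * - ((b₁ * c₂ + b₂ * c₁) + (a₁ * d₂ + a₂ * d₁))
       + (a₁ * c₂ + a₂ * c₁) * ((b₁ * c₁ + - (b₂ * c₂)) + (a₁ * d₁ + - (a₂ * d₂)))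
      ≡ (c₁ * c₁ + c₂ * c₂) * (a₁ * - b₂ + a₂ * b₁) + (a₁ * a₁ + a₂ * a₂) * (c₁ * - d₂ + c₂ * d₁)
    eq = solve-∀ ℚ-ring

  ∧-product₂ : ∀ x a b c d →
    (x *ᵍ (b *ᵍ d)) ∧ (b *ᵍ c +ᵍ a *ᵍ d) ≡ norm² b ℚ.* (x *ᵍ d) ∧ c ℚ.+ norm² d ℚ.* (x *ᵍ b) ∧ a
  ∧-product₂ (x₁ +𝕚 x₂) (a₁ +𝕚 a₂) (b₁ +𝕚 b₂) (c₁ +𝕚 c₂) (d₁ +𝕚 d₂) = eq x₁ x₂ a₁ a₂ b₁ b₂ c₁ c₂ d₁ d₂
    where
    open Data.Rational using (_+_; _*_; -_)
    eq : ∀ x₁ x₂ a₁ a₂ b₁ b₂ c₁ c₂ d₁ d₂ →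
      (x₁ * (b₁ * d₁ + - (b₂ * d₂)) + - (x₂ * (b₁ * d₂ + b₂ * d₁))) * - ((b₁ * c₂ + b₂ * c₁) + (a₁ * d₂ + a₂ * d₁))
       + (x₁ * (b₁ * d₂ + b₂ * d₁) + x₂ * (b₁ * d₁ + - (b₂ * d₂))) * ((b₁ * c₁ + - (b₂ * c₂)) + (a₁ * d₁ + - (a₂ * d₂)))
      ≡ (b₁ * b₁ + b₂ * b₂) * ((x₁ * d₁ + - (x₂ * d₂)) * - c₂ + (x₁ * d₂ + x₂ * d₁) * c₁)
        + (d₁ * d₁ + d₂ * d₂) * ((x₁ * b₁ + - (x₂ * b₂)) * - a₂ + (x₁ * b₂ + x₂ * b₁) * a₁)
    eq = solve-∀ ℚ-ring

  -- Multiplying `a + s b` by `1 + s` gives `(a + x b) + s (a + b)`. Here and in `∧-step₂` the new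
  -- wedges are combinations of the old ones and of `Im x` times squared moduli, with nonnegative
  -- coefficients in the upper half plane.
  ∧-step₁ : ∀ x a b → (a +ᵍ x *ᵍ b) ∧ (a +ᵍ b) ≡ a ∧ b ℚ.+ ((x *ᵍ b) ∧ a ℚ.+ Im x ℚ.* norm² b)
  ∧-step₁ (x₁ +𝕚 x₂) (a₁ +𝕚 a₂) (b₁ +𝕚 b₂) = eq x₁ x₂ a₁ a₂ b₁ b₂
    where
    open Data.Rational using (_+_; _*_; -_)
    eq : ∀ x₁ x₂ a₁ a₂ b₁ b₂ →
      (a₁ + (x₁ * b₁ + - (x₂ * b₂))) * - (a₂ + b₂) + (a₂ + (x₁ * b₂ + x₂ * b₁)) * (a₁ + b₁)
      ≡ (a₁ * - b₂ + a₂ * b₁) + (((x₁ * b₁ + - (x₂ * b₂)) * - a₂ + (x₁ * b₂ + x₂ * b₁) * a₁) + x₂ * (b₁ * b₁ + b₂ * b₂))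
    eq = solve-∀ ℚ-ring

  ∧-step₂ : ∀ x a b → (x *ᵍ (a +ᵍ b)) ∧ (a +ᵍ x *ᵍ b) ≡ Im x ℚ.* norm² a ℚ.+ (norm² x ℚ.* a ∧ b ℚ.+ (x *ᵍ b) ∧ a)
  ∧-step₂ (x₁ +𝕚 x₂) (a₁ +𝕚 a₂) (b₁ +𝕚 b₂) = eq x₁ x₂ a₁ a₂ b₁ b₂
    where
    open Data.Rational using (_+_; _*_; -_)
    eq : ∀ x₁ x₂ a₁ a₂ b₁ b₂ →
      (x₁ * (a₁ + b₁) + - (x₂ * (a₂ + b₂))) * - (a₂ + (x₁ * b₂ + x₂ * b₁)) + (x₁ * (a₂ + b₂) + x₂ * (a₁ + b₁)) * (a₁ + (x₁ * b₁ + - (x₂ * b₂)))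
      ≡ x₂ * (a₁ * a₁ + a₂ * a₂) + ((x₁ * x₁ + x₂ * x₂) * (a₁ * - b₂ + a₂ * b₁) + ((x₁ * b₁ + - (x₂ * b₂)) * - a₂ + (x₁ * b₂ + x₂ * b₁) * a₁))
    eq = solve-∀ ℚ-ring

  module UpperHalfPlane (x : ℚ[i]) (0≤y : 0ℚ ≤ Im x) where
    open EvenOdd x

    -- a / b lies in the sector spanned by 1 and x.
    Sector : ℚ[i] → ℚ[i] → Set
    Sector a b = 0ℚ ≤ a ∧ b × 0ℚ ≤ (x *ᵍ b) ∧ a

    -- The increment `(x b) ∧ a + Im x |b|²` is nonnegative. Monotonicity turns the sign statement
    -- into a lower bound, since `w k ∧ v k` stays above its value at `k = 1`.
    step-increasing : ∀ {a b} → Sector a b → a ∧ b ≤ (a +ᵍ x *ᵍ b) ∧ (a +ᵍ b)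
    step-increasing {a} {b} (_ , 0≤J) = ≤-by _ (0≤+ 0≤J (0≤* 0≤y (0≤norm² b))) (∧-step₁ x a b)

    Sector-step : ∀ {a b} → Sector a b → Sector (a +ᵍ x *ᵍ b) (a +ᵍ b)
    Sector-step {a} {b} s@(0≤I , 0≤J) =
      ℚₚ.≤-trans 0≤I (step-increasing s) ,
      subst (0ℚ ≤_) (sym (∧-step₂ x a b)) (0≤+ (0≤* 0≤y (0≤norm² a)) (0≤+ (0≤* (0≤norm² x) 0≤I) 0≤J))

    sector : ∀ k → Sector (w k) (v k)
    sector zero = subst (0ℚ ≤_) refl ℚₚ.≤-refl , subst (0ℚ ≤_) (eq x) ℚₚ.≤-refl
      where
      eq : ∀ x → 0ℚ ≡ (x *ᵍ 0ᵍ) ∧ 1ᵍ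
      eq (a +𝕚 b) = eq′ a b
        where
        open Data.Rational using (_+_; _*_; -_)
        eq′ : ∀ a b → 0ℚ ≡ (a * 0ℚ + - (b * 0ℚ)) * 0ℚ + (a * 0ℚ + b * 0ℚ) * 1ℚ
        eq′ = solve-∀ ℚ-ring
    sector (suc k) = Sector-step (Sector-step (sector k))

    w∧v-increasing : ∀ k → w k ∧ v k ≤ w (suc k) ∧ v (suc k)
    w∧v-increasing k = ℚₚ.≤-trans (step-increasing (sector k)) (step-increasing (Sector-step (sector k)))

    y≤w∧v : ∀ k → Im x ≤ w (suc k) ∧ v (suc k)
    -- `w 1 = 1 + x` and `v 1 = 2`, so the wedge equals `2 Im x`.
    y≤w∧v zero = ≤-by (Im x) 0≤y (eq x)
      where
      eq : ∀ x → EvenOdd.w x 1 ∧ EvenOdd.v x 1 ≡ Im x ℚ.+ Im x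
      eq (a +𝕚 b) = eq′ a b
        where
        open Data.Rational using (_+_; _*_; -_)
        eq′ : ∀ a b → ((1ℚ + (a * 0ℚ + - (b * 0ℚ))) + (a * (1ℚ + 0ℚ) + - (b * (0ℚ + 0ℚ)))) * - ((0ℚ + (a * 0ℚ + b * 0ℚ)) + (0ℚ + 0ℚ))
                    + ((0ℚ + (a * 0ℚ + b * 0ℚ)) + (a * (0ℚ + 0ℚ) + b * (1ℚ + 0ℚ))) * ((1ℚ + (a * 0ℚ + - (b * 0ℚ))) + (1ℚ + 0ℚ)) ≡ b + b
        eq′ = solve-∀ ℚ-ring
    y≤w∧v (suc k) = ℚₚ.≤-trans (y≤w∧v k) (w∧v-increasing (suc k))

    y²≤norm²w₁ : Im x ℚ.* Im x ≤ norm² (w 1)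
    y²≤norm²w₁ = ≤-by _ (0≤² (Re x ℚ.+ 1ℚ)) (eq x)
      where
      eq : ∀ x → norm² (EvenOdd.w x 1) ≡ Im x ℚ.* Im x ℚ.+ (Re x ℚ.+ 1ℚ) ℚ.* (Re x ℚ.+ 1ℚ)
      eq (a +𝕚 b) = eq′ a b
        where
        open Data.Rational using (_+_; _*_; -_)
        eq′ : ∀ a b → ((1ℚ + (a * 0ℚ + - (b * 0ℚ))) + (a * (1ℚ + 0ℚ) + - (b * (0ℚ + 0ℚ)))) * ((1ℚ + (a * 0ℚ + - (b * 0ℚ))) + (a * (1ℚ + 0ℚ) + - (b * (0ℚ + 0ℚ))))
                    + ((0ℚ + (a * 0ℚ + b * 0ℚ)) + (a * (0ℚ + 0ℚ) + b * (1ℚ + 0ℚ))) * ((0ℚ + (a * 0ℚ + b * 0ℚ)) + (a * (0ℚ + 0ℚ) + b * (1ℚ + 0ℚ))) ≡ b * b + (a + 1ℚ) * (a + 1ℚ)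
        eq′ = solve-∀ ℚ-ring

    ww∧v : ∀ k j → (w k *ᵍ w j) ∧ v (k ℕ.+ j) ≡ norm² (w j) ℚ.* w k ∧ v k ℚ.+ norm² (w k) ℚ.* w j ∧ v j
    ww∧v k j = trans (cong ((w k *ᵍ w j) ∧_) (v-+ k j)) (∧-product₁ (w k) (v k) (w j) (v j))

    0≤ww∧v : ∀ k j → 0ℚ ≤ (w k *ᵍ w j) ∧ v (k ℕ.+ j)
    0≤ww∧v k j = subst (0ℚ ≤_) (sym (ww∧v k j))
      (0≤+ (0≤* (0≤norm² (w j)) (proj₁ (sector k))) (0≤* (0≤norm² (w k)) (proj₁ (sector j))))

    0≤xvv∧v : ∀ k j → 0ℚ ≤ (x *ᵍ (v k *ᵍ v j)) ∧ v (k ℕ.+ j)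
    0≤xvv∧v k j = subst (0ℚ ≤_)
      (sym (trans (cong ((x *ᵍ (v k *ᵍ v j)) ∧_) (v-+ k j)) (∧-product₂ x (w k) (v k) (w j) (v j))))
      (0≤+ (0≤* (0≤norm² (v k)) (proj₂ (sector j))) (0≤* (0≤norm² (v j)) (proj₂ (sector k))))

  -- Positivity of the walk and the cubic lower bound.

  real-* : ∀ a b → real a *ᵍ real b ≡ real (a ℚ.* b)
  real-* a b = cong₂ _+𝕚_ (eq₁ a b) (eq₂ a b)
    where
    open Data.Rational using (_+_; _*_; -_)
    eq₁ : ∀ a b → a * b + - (0ℚ * 0ℚ) ≡ a * b
    eq₁ = solve-∀ ℚ-ring
    eq₂ : ∀ a b → a * 0ℚ + 0ℚ * b ≡ 0ℚ
    eq₂ = solve-∀ ℚ-ring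

  -- The constants of `decomposition` are Gaussian rationals for the sake of the ring solver; this
  -- lets them be pulled out of a wedge as nonnegative rationals.
  NonNegReal : ℚ[i] → Set
  NonNegReal z = ∃[ r ] 0ℚ ≤ r × z ≡ real r

  nonNegReal-* : ∀ {z u} → NonNegReal z → NonNegReal u → NonNegReal (z *ᵍ u)
  nonNegReal-* (r , 0≤r , refl) (s , 0≤s , refl) = r ℚ.* s , 0≤* 0≤r 0≤s , real-* r s

  nonNegReal-natᵍ : ∀ n → NonNegReal (natᵍ n)
  nonNegReal-natᵍ n = ratℕ n , 0≤ratℕ n , natᵍ≡real n

  nonNegReal-2^ : ∀ n → NonNegReal (2ᵍ ^ᵍ n)
  nonNegReal-2^ zero = 1ℚ , from-yes (0ℚ ℚ.≤? 1ℚ) , refl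
  nonNegReal-2^ (suc n) = nonNegReal-* (1ℚ ℚ.+ 1ℚ , from-yes (0ℚ ℚ.≤? 1ℚ ℚ.+ 1ℚ) , refl) (nonNegReal-2^ n)

  gap : ℚ → ℚ → ℚ
  gap q t = t ℚ.* t ℚ.+ ℚ.- ((1ℚ ℚ.+ 1ℚ) ℚ.* q)

  module WalkPositivity (x : ℚ[i]) (0≤y : 0ℚ ≤ Im x) (n₀ : ℕ) (q : ℚ) where
    open EvenOdd x
    open UpperHalfPlane x 0≤y
    open Decomposition x (real q)
    open Walk summand

    real-gap : ∀ t → sq (real t) +ᵍ -ᵍ (2ᵍ *ᵍ real q) ≡ real (gap q t)
    real-gap t = cong₂ (λ a b → a +ᵍ -ᵍ b) (real-* t t) (real-* (1ℚ ℚ.+ 1ℚ) q)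

    summand∧v : ∀ t k j → summand (real t) k j ∧ v n₀ ≡
      (t ℚ.* t) ℚ.* (t ℚ.* t) ℚ.* (x *ᵍ (v k *ᵍ v j)) ∧ v n₀ ℚ.+ gap q t ℚ.* gap q t ℚ.* (w k *ᵍ w j) ∧ v n₀
    summand∧v t k j = trans
      (∧-distribʳ-+ (sq (sq (real t)) *ᵍ (x *ᵍ (v k *ᵍ v j))) (sq (sq (real t) +ᵍ -ᵍ (2ᵍ *ᵍ real q)) *ᵍ (w k *ᵍ w j)) (v n₀))
      (cong₂ ℚ._+_
        (trans (cong (λ z → (z *ᵍ (x *ᵍ (v k *ᵍ v j))) ∧ v n₀) (trans (cong sq (real-* t t)) (real-* (t ℚ.* t) (t ℚ.* t))))
               (∧-realˡ _ (x *ᵍ (v k *ᵍ v j)) (v n₀)))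
        (trans (cong (λ z → (z *ᵍ (w k *ᵍ w j)) ∧ v n₀) (trans (cong sq (real-gap t)) (real-* (gap q t) (gap q t))))
               (∧-realˡ _ (w k *ᵍ w j) (v n₀))))

    summand-lower : ∀ t k j → k ℕ.+ j ≡ n₀ → gap q t ℚ.* gap q t ℚ.* (w k *ᵍ w j) ∧ v n₀ ≤ summand (real t) k j ∧ v n₀
    summand-lower t k j refl = ≤-by _ (0≤* (0≤² (t ℚ.* t)) (0≤xvv∧v k j)) (trans (summand∧v t k j) (ℚₚ.+-comm _ (gap q t ℚ.* gap q t ℚ.* (w k *ᵍ w j) ∧ v n₀)))

    0≤summand : ∀ t k j → k ℕ.+ j ≡ n₀ → 0ℚ ≤ summand (real t) k j ∧ v n₀
    0≤summand t k j refl = ℚₚ.≤-trans (0≤* (0≤² (gap q t)) (0≤ww∧v k j)) (summand-lower t k j refl)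

    0≤walk : ∀ n t k j → k ℕ.+ j ℕ.+ n ≡ n₀ → 0ℚ ≤ walk n (real t) k j ∧ v n₀
    0≤walk zero t k j eq = 0≤summand t k j (trans (sym (ℕₚ.+-identityʳ _)) eq)
    0≤walk (suc n) t k j eq = subst (0ℚ ≤_) (sym (∧-distribʳ-+ (walk n (real (t ℚ.+ 1ℚ)) (suc k) j) (walk n (real (t ℚ.+ ℚ.- 1ℚ)) k (suc j)) (v n₀)))
      (0≤+ (0≤walk n (t ℚ.+ 1ℚ) (suc k) j (trans (sym (ℕₚ.+-suc (k ℕ.+ j) n)) eq))
           (0≤walk n (t ℚ.+ ℚ.- 1ℚ) k (suc j) (trans (cong (ℕ._+ n) (ℕₚ.+-suc k j)) (trans (sym (ℕₚ.+-suc (k ℕ.+ j) n)) eq))))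

    -- All words contribute nonnegatively, so it suffices to keep the one whose remaining letters
    -- are all of the second kind.
    walk-lower : ∀ n t k j → k ℕ.+ j ℕ.+ n ≡ n₀ →
      summand (real (t ℚ.+ ℚ.- ratℕ n)) k (j ℕ.+ n) ∧ v n₀ ≤ walk n (real t) k j ∧ v n₀
    walk-lower zero t k j eq rewrite ℕₚ.+-identityʳ j | ℚₚ.+-identityʳ t = ℚₚ.≤-refl
    walk-lower (suc n) t k j eq = ℚₚ.≤-trans
      (ℚₚ.≤-reflexive (cong₂ (λ s i → summand (real s) k i ∧ v n₀) (eq′ t (ratℕ n)) (ℕₚ.+-suc j n)))
      (ℚₚ.≤-trans (walk-lower n (t ℚ.+ ℚ.- 1ℚ) k (suc j) (trans (cong (ℕ._+ n) (ℕₚ.+-suc k j)) (trans (sym (ℕₚ.+-suc (k ℕ.+ j) n)) eq)))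
        (≤-by _ (0≤walk n (t ℚ.+ 1ℚ) (suc k) j (trans (sym (ℕₚ.+-suc (k ℕ.+ j) n)) eq))
          (trans (∧-distribʳ-+ (walk n (real (t ℚ.+ 1ℚ)) (suc k) j) (walk n (real (t ℚ.+ ℚ.- 1ℚ)) k (suc j)) (v n₀))
                 (ℚₚ.+-comm (walk n (real (t ℚ.+ 1ℚ)) (suc k) j ∧ v n₀) _))))
      where
      eq′ : ∀ t m → t ℚ.+ ℚ.- (1ℚ ℚ.+ m) ≡ t ℚ.+ ℚ.- 1ℚ ℚ.+ ℚ.- m
      eq′ = solve-∀ ℚ-ring

  -- The gap is `n² - 2n - 4 = (n - 1)² - 5`, an integer that is never zero because 5 is not a
  -- square. For `n = m + 4` it is `Q + 4` with `Q = m² + 6m`, and `(Q + 4)² = 1 + 15 + 8Q + Q²`.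
  -- The word without letters of the first kind could not replace this one: its weight `ν² (ν - 2)²`
  -- vanishes in dimension 2.
  1≤gap² : ∀ n → let c = gap (ratℕ (2 ℕ.+ n)) (1ℚ ℚ.+ ℚ.- ratℕ (suc n)) in 1ℚ ≤ c ℚ.* c
  1≤gap² 0 = from-yes (1ℚ ℚ.≤? gap (ratℕ 2) (1ℚ ℚ.+ ℚ.- ratℕ 1) ℚ.* gap (ratℕ 2) (1ℚ ℚ.+ ℚ.- ratℕ 1))
  1≤gap² 1 = from-yes (1ℚ ℚ.≤? gap (ratℕ 3) (1ℚ ℚ.+ ℚ.- ratℕ 2) ℚ.* gap (ratℕ 3) (1ℚ ℚ.+ ℚ.- ratℕ 2))
  1≤gap² 2 = from-yes (1ℚ ℚ.≤? gap (ratℕ 4) (1ℚ ℚ.+ ℚ.- ratℕ 3) ℚ.* gap (ratℕ 4) (1ℚ ℚ.+ ℚ.- ratℕ 3))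
  1≤gap² 3 = from-yes (1ℚ ℚ.≤? gap (ratℕ 5) (1ℚ ℚ.+ ℚ.- ratℕ 4) ℚ.* gap (ratℕ 5) (1ℚ ℚ.+ ℚ.- ratℕ 4))
  1≤gap² (suc (suc (suc (suc n)))) = ≤-by _
    (0≤+ (from-yes (0ℚ ℚ.≤? ratℕ 15)) (0≤+ (0≤* (0≤ratℕ 8) 0≤Q) (0≤² Q))) (eq m)
    where
    open Data.Rational using (_+_; _*_; -_)
    m = ratℕ n
    Q = m * m + ratℕ 6 * m
    0≤Q : 0ℚ ≤ Q
    0≤Q = 0≤+ (0≤² m) (0≤* (0≤ratℕ 6) (0≤ratℕ n))
    eq : ∀ m → let N = 1ℚ + (1ℚ + (1ℚ + (1ℚ + m))) in
      ((1ℚ + - (1ℚ + N)) * (1ℚ + - (1ℚ + N)) + - ((1ℚ + 1ℚ) * (1ℚ + (1ℚ + N)))) * ((1ℚ + - (1ℚ + N)) * (1ℚ + - (1ℚ + N)) + - ((1ℚ + 1ℚ) * (1ℚ + (1ℚ + N))))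
      ≡ 1ℚ + (ratℕ 15 + (ratℕ 8 * (m * m + ratℕ 6 * m) + (m * m + ratℕ 6 * m) * (m * m + ratℕ 6 * m)))
    eq = solve-∀ ℚ-ring

  -- The value at `x` of the coordinator polynomial in dimension `2 + n`.
  closedForm : ℚ[i] → ℕ → ℚ[i]
  closedForm x n = w (2 ℕ.+ n) +ᵍ -ᵍ (2ᵍ *ᵍ (natᵍ (2 ℕ.+ n) *ᵍ (x *ᵍ (1+x ^ᵍ n))))
    where open EvenOdd x

  -- The retained word is bounded below by `|w 1|² (w (n + 1) ∧ v (n + 1))`; the first factor
  -- supplies `(Im x)²` and the second `Im x`. `K` is the constant multiplying the closed form in
  -- `decomposition`.
  closedForm-bound : ∀ n → Σ[ K ∈ ℚ ] 0ℚ ≤ K ×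
    (∀ x → 0ℚ ≤ Im x → Im x ℚ.* Im x ℚ.* Im x ≤ K ℚ.* closedForm x n ∧ EvenOdd.v x (2 ℕ.+ n))
  closedForm-bound n with
    nonNegReal-* (1ℚ ℚ.+ 1ℚ ℚ.+ (1ℚ ℚ.+ 1ℚ) , from-yes (0ℚ ℚ.≤? 1ℚ ℚ.+ 1ℚ ℚ.+ (1ℚ ℚ.+ 1ℚ)) , refl)
      (nonNegReal-* (nonNegReal-natᵍ (2 ℕ.+ n)) (nonNegReal-* (nonNegReal-natᵍ (suc n)) (nonNegReal-2^ (2 ℕ.+ n))))
  ... | K , 0≤K , eqK = K , 0≤K , bound
    where
    bound : ∀ x → 0ℚ ≤ Im x → Im x ℚ.* Im x ℚ.* Im x ≤ K ℚ.* closedForm x n ∧ EvenOdd.v x (2 ℕ.+ n)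
    bound x 0≤y = begin
      y ℚ.* y ℚ.* y
        ≤⟨ ℚₚ.*-monoˡ-≤-nonNeg (y ℚ.* y) {{ℚ.nonNegative (0≤² y)}} (y≤w∧v n) ⟩
      y ℚ.* y ℚ.* w (suc n) ∧ v (suc n)
        ≤⟨ ℚₚ.*-monoʳ-≤-nonNeg (w (suc n) ∧ v (suc n)) {{ℚ.nonNegative (proj₁ (sector (suc n)))}} y²≤norm²w₁ ⟩
      norm² (w 1) ℚ.* w (suc n) ∧ v (suc n)
        ≤⟨ ≤-by _ (0≤* (0≤norm² (w (suc n))) (proj₁ (sector 1))) (trans (ww∧v 1 (suc n)) (ℚₚ.+-comm (norm² (w (suc n)) ℚ.* w 1 ∧ v 1) _)) ⟩
      (w 1 *ᵍ w (suc n)) ∧ V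
        ≡⟨ ℚₚ.*-identityˡ _ ⟨
      1ℚ ℚ.* (w 1 *ᵍ w (suc n)) ∧ V
        ≤⟨ ℚₚ.*-monoʳ-≤-nonNeg ((w 1 *ᵍ w (suc n)) ∧ V) {{ℚ.nonNegative (0≤ww∧v 1 (suc n))}} (1≤gap² n) ⟩
      gap q t ℚ.* gap q t ℚ.* (w 1 *ᵍ w (suc n)) ∧ V
        ≤⟨ summand-lower t 1 (suc n) refl ⟩
      D.summand (real t) 1 (suc n) ∧ V
        -- The word with a single letter of the first kind, in front.
        ≤⟨ walk-lower (suc n) 1ℚ 1 0 refl ⟩
      W.walk (suc n) (real 1ℚ) 1 0 ∧ V
        ≤⟨ ≤-by _ (0≤walk (suc n) (0ℚ ℚ.+ ℚ.- 1ℚ) 0 1 refl) (∧-distribʳ-+ (W.walk (suc n) (real 1ℚ) 1 0) (W.walk (suc n) (real (0ℚ ℚ.+ ℚ.- 1ℚ)) 0 1) V) ⟩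
      W.walk (2 ℕ.+ n) 0ᵍ 0 0 ∧ V
        ≤⟨ extra ⟩
      (W.walk (2 ℕ.+ n) 0ᵍ 0 0 +ᵍ E *ᵍ w (2 ℕ.+ n)) ∧ V
        ≡⟨ cong (_∧ V) eqD ⟨
      (c *ᵍ closedForm x n) ∧ V
        ≡⟨ cong (λ z → (z *ᵍ closedForm x n) ∧ V) eqK ⟩
      (real K *ᵍ closedForm x n) ∧ V
        ≡⟨ ∧-realˡ K (closedForm x n) V ⟩
      K ℚ.* closedForm x n ∧ V ∎
      where
      open ℚₚ.≤-Reasoning
      y q t : ℚ
      y = Im x
      q = ratℕ (2 ℕ.+ n)
      t = 1ℚ ℚ.+ ℚ.- ratℕ (suc n)
      open EvenOdd x
      open UpperHalfPlane x 0≤y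
      open WalkPositivity x 0≤y (2 ℕ.+ n) q
      module D = Decomposition x (real q)
      module W = Walk D.summand
      V E c : ℚ[i]
      V = v (2 ℕ.+ n)
      E = (2ᵍ ^ᵍ (2 ℕ.+ n)) *ᵍ (natᵍ (2 ℕ.+ n) *ᵍ natᵍ n)
      c = 4ᵍ *ᵍ (natᵍ (2 ℕ.+ n) *ᵍ (natᵍ (suc n) *ᵍ (2ᵍ ^ᵍ (2 ℕ.+ n))))
      eqD : c *ᵍ closedForm x n ≡ W.walk (2 ℕ.+ n) 0ᵍ 0 0 +ᵍ E *ᵍ w (2 ℕ.+ n)
      -- The identity was proved for `natᵍ`, which unfolds; positivity needs the same number as a
      -- `real`.
      eqD = subst (λ ν → c *ᵍ closedForm x n ≡ Walk.walk (Decomposition.summand x ν) (2 ℕ.+ n) 0ᵍ 0 0 +ᵍ E *ᵍ w (2 ℕ.+ n))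
                  (natᵍ≡real (2 ℕ.+ n)) (decomposition x n)
      extra : W.walk (2 ℕ.+ n) 0ᵍ 0 0 ∧ V ≤ (W.walk (2 ℕ.+ n) 0ᵍ 0 0 +ᵍ E *ᵍ w (2 ℕ.+ n)) ∧ V
      extra with nonNegReal-* (nonNegReal-2^ (2 ℕ.+ n)) (nonNegReal-* (nonNegReal-natᵍ (2 ℕ.+ n)) (nonNegReal-natᵍ n))
      ... | r , 0≤r , eqE = ≤-by (r ℚ.* w (2 ℕ.+ n) ∧ V) (0≤* 0≤r (proj₁ (sector (2 ℕ.+ n))))
        (trans (∧-distribʳ-+ (W.walk (2 ℕ.+ n) 0ᵍ 0 0) (E *ᵍ w (2 ℕ.+ n)) V)
          (cong (W.walk (2 ℕ.+ n) 0ᵍ 0 0 ∧ V ℚ.+_) (trans (cong (λ z → (z *ᵍ w (2 ℕ.+ n)) ∧ V) eqE) (∧-realˡ r (w (2 ℕ.+ n)) V))))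

  -- Integer polynomials evaluated at Gaussian rationals.

  open ℚ[i]

  ι : ℤ → ℚ
  ι a = a ℚ./ 1

  toℚᵘ-ι : ∀ a → ℚ.toℚᵘ (ι a) ℚᵘ.≃ ℚᵘ.mkℚᵘ a 0
  toℚᵘ-ι a = ℚₚ.toℚᵘ-fromℚᵘ (ℚᵘ.mkℚᵘ a 0)

  -- Normalisation by a gcd is stuck on variables, so the identity is checked on unnormalised
  -- fractions.
  ι-+ : ∀ a b → ι (a ℤ.+ b) ≡ ι a ℚ.+ ι b
  ι-+ a b = ℚₚ.toℚᵘ-injective (begin
    ℚ.toℚᵘ (ι (a ℤ.+ b))               ≈⟨ toℚᵘ-ι (a ℤ.+ b) ⟩
    ℚᵘ.mkℚᵘ (a ℤ.+ b) 0                 ≈⟨ ℚᵘ.*≡* (eq a b) ⟩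
    ℚᵘ.mkℚᵘ a 0 ℚᵘ.+ ℚᵘ.mkℚᵘ b 0         ≈⟨ ℚᵘₚ.+-cong (toℚᵘ-ι a) (toℚᵘ-ι b) ⟨
    ℚ.toℚᵘ (ι a) ℚᵘ.+ ℚ.toℚᵘ (ι b)      ≈⟨ ℚₚ.toℚᵘ-homo-+ (ι a) (ι b) ⟨
    ℚ.toℚᵘ (ι a ℚ.+ ι b)               ∎)
    where
    open ℚᵘₚ.≃-Reasoning
    eq : ∀ a b → (a ℤ.+ b) ℤ.* 1ℤ ≡ (a ℤ.* 1ℤ ℤ.+ b ℤ.* 1ℤ) ℤ.* 1ℤ
    eq = solveℤ

  ι-* : ∀ a b → ι (a ℤ.* b) ≡ ι a ℚ.* ι b
  ι-* a b = ℚₚ.toℚᵘ-injective (begin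
    ℚ.toℚᵘ (ι (a ℤ.* b))               ≈⟨ toℚᵘ-ι (a ℤ.* b) ⟩
    ℚᵘ.mkℚᵘ a 0 ℚᵘ.* ℚᵘ.mkℚᵘ b 0         ≈⟨ ℚᵘₚ.*-cong (toℚᵘ-ι a) (toℚᵘ-ι b) ⟨
    ℚ.toℚᵘ (ι a) ℚᵘ.* ℚ.toℚᵘ (ι b)      ≈⟨ ℚₚ.toℚᵘ-homo-* (ι a) (ι b) ⟨
    ℚ.toℚᵘ (ι a ℚ.* ι b)               ∎)
    where open ℚᵘₚ.≃-Reasoning

  ι-pos : ∀ n → ι (+ n) ≡ ratℕ n
  ι-pos zero = refl
  ι-pos (suc n) = trans (ι-+ 1ℤ (+ n)) (cong (1ℚ ℚ.+_) (ι-pos n))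

  infixl 6 _+ₚ_

  _+ₚ_ : Polynomial → Polynomial → Polynomial
  []      +ₚ q       = q
  (a ∷ p) +ₚ []      = a ∷ p
  (a ∷ p) +ₚ (b ∷ q) = a ℤ.+ b ∷ p +ₚ q

  X*_ : Polynomial → Polynomial
  X* p = 0ℤ ∷ p

  scale : ℤ → Polynomial → Polynomial
  scale a = List.map (a ℤ.*_)

  evalᵍ : Polynomial → ℚ[i] → ℚ[i]
  evalᵍ []      z = 0ᵍ
  evalᵍ (a ∷ p) z = real (ι a) +ᵍ z *ᵍ evalᵍ p z

  evalᵍ-+ : ∀ p q z → evalᵍ (p +ₚ q) z ≡ evalᵍ p z +ᵍ evalᵍ q z
  evalᵍ-+ [] q z = eq (evalᵍ q z)
    where
    eq : ∀ a → a ≡ 0ᵍ +ᵍ a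
    eq = solve-∀ ℚ[i]-ring
  evalᵍ-+ (a ∷ p) [] z = eq (evalᵍ (a ∷ p) z)
    where
    eq : ∀ a → a ≡ a +ᵍ 0ᵍ
    eq = solve-∀ ℚ[i]-ring
  evalᵍ-+ (a ∷ p) (b ∷ q) z = trans
    (cong₂ (λ r u → real r +ᵍ z *ᵍ u) (ι-+ a b) (evalᵍ-+ p q z))
    (eq (real (ι a)) (real (ι b)) z (evalᵍ p z) (evalᵍ q z))
    where
    eq : ∀ a b z u v → (a +ᵍ b) +ᵍ z *ᵍ (u +ᵍ v) ≡ (a +ᵍ z *ᵍ u) +ᵍ (b +ᵍ z *ᵍ v)
    eq = solve-∀ ℚ[i]-ring

  evalᵍ-X* : ∀ p z → evalᵍ (X* p) z ≡ z *ᵍ evalᵍ p z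
  evalᵍ-X* p z = eq (z *ᵍ evalᵍ p z)
    where
    eq : ∀ a → 0ᵍ +ᵍ a ≡ a
    eq = solve-∀ ℚ[i]-ring

  evalᵍ-scale : ∀ a p z → evalᵍ (scale a p) z ≡ real (ι a) *ᵍ evalᵍ p z
  evalᵍ-scale a [] z = eq (real (ι a))
    where
    eq : ∀ a → 0ᵍ ≡ a *ᵍ 0ᵍ
    eq = solve-∀ ℚ[i]-ring
  evalᵍ-scale a (b ∷ p) z = trans
    (cong₂ (λ r u → r +ᵍ z *ᵍ u) (trans (cong real (ι-* a b)) (sym (real-* (ι a) (ι b)))) (evalᵍ-scale a p z))
    (eq (real (ι a)) (real (ι b)) z (evalᵍ p z))
    where
    eq : ∀ a b z u → a *ᵍ b +ᵍ z *ᵍ (a *ᵍ u) ≡ a *ᵍ (b +ᵍ z *ᵍ u)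
    eq = solve-∀ ℚ[i]-ring

  -- The lists may differ by trailing zeros, which is why a nonempty list can meet `[]`.
  evalᵍ-cong : ∀ p q z → coeff p ≗ coeff q → evalᵍ p z ≡ evalᵍ q z
  evalᵍ-cong [] [] z p≗q = refl
  evalᵍ-cong (a ∷ p) [] z p≗q = trans
    (cong₂ (λ r u → real (ι r) +ᵍ z *ᵍ u) (p≗q 0) (evalᵍ-cong p [] z (λ k → p≗q (suc k))))
    (eq z)
    where
    eq : ∀ z → 0ᵍ +ᵍ z *ᵍ 0ᵍ ≡ 0ᵍ
    eq = solve-∀ ℚ[i]-ring
  evalᵍ-cong [] (b ∷ q) z p≗q = trans
    (eq z)
    (cong₂ (λ r u → real (ι r) +ᵍ z *ᵍ u) (p≗q 0) (evalᵍ-cong [] q z (λ k → p≗q (suc k))))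
    where
    eq : ∀ z → 0ᵍ ≡ 0ᵍ +ᵍ z *ᵍ 0ᵍ
    eq = solve-∀ ℚ[i]-ring
  evalᵍ-cong (a ∷ p) (b ∷ q) z p≗q =
    cong₂ (λ r u → real (ι r) +ᵍ z *ᵍ u) (p≗q 0) (evalᵍ-cong p q z (λ k → p≗q (suc k)))

  conj-+ : ∀ z u → conj (z +ᵍ u) ≡ conj z +ᵍ conj u
  conj-+ (a +𝕚 b) (c +𝕚 d) = cong (a ℚ.+ c +𝕚_) (ℚₚ.neg-distrib-+ b d)

  conj-* : ∀ z u → conj (z *ᵍ u) ≡ conj z *ᵍ conj u
  conj-* (a +𝕚 b) (c +𝕚 d) = cong₂ _+𝕚_ (eq₁ a b c d) (eq₂ a b c d)
    where
    open Data.Rational using (_+_; _*_; -_)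
    eq₁ : ∀ a b c d → a * c + - (b * d) ≡ a * c + - (- b * - d)
    eq₁ = solve-∀ ℚ-ring
    eq₂ : ∀ a b c d → - (a * d + b * c) ≡ a * - d + - b * c
    eq₂ = solve-∀ ℚ-ring

  evalᵍ-conj : ∀ p z → evalᵍ p (conj z) ≡ conj (evalᵍ p z)
  evalᵍ-conj [] z = refl
  evalᵍ-conj (a ∷ p) z = trans
    (cong (λ u → real (ι a) +ᵍ conj z *ᵍ u) (evalᵍ-conj p z))
    (sym (trans (conj-+ (real (ι a)) (z *ᵍ evalᵍ p z)) (cong (real (ι a) +ᵍ_) (conj-* z (evalᵍ p z)))))

  wₚ vₚ : ℕ → Polynomial
  wₚ zero = 1ℤ ∷ []
  wₚ (suc k) = (wₚ k +ₚ X* vₚ k) +ₚ X* (wₚ k +ₚ vₚ k)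
  vₚ zero = []
  vₚ (suc k) = (wₚ k +ₚ X* vₚ k) +ₚ (wₚ k +ₚ vₚ k)

  evalᵍ-1 : ∀ z → evalᵍ (1ℤ ∷ []) z ≡ 1ᵍ
  evalᵍ-1 z = eq z
    where
    eq : ∀ z → 1ᵍ +ᵍ z *ᵍ 0ᵍ ≡ 1ᵍ
    eq = solve-∀ ℚ[i]-ring

  module _ (x : ℚ[i]) where
    open EvenOdd x

    evalᵍ-wₚ : ∀ k → evalᵍ (wₚ k) x ≡ w k
    evalᵍ-vₚ : ∀ k → evalᵍ (vₚ k) x ≡ v k

    private
      evalᵍ-step₁ : ∀ k → evalᵍ (wₚ k +ₚ X* vₚ k) x ≡ w k +ᵍ x *ᵍ v k
      evalᵍ-step₁ k = trans (evalᵍ-+ (wₚ k) (X* vₚ k) x)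
        (cong₂ _+ᵍ_ (evalᵍ-wₚ k) (trans (evalᵍ-X* (vₚ k) x) (cong (x *ᵍ_) (evalᵍ-vₚ k))))
      evalᵍ-step₂ : ∀ k → evalᵍ (wₚ k +ₚ vₚ k) x ≡ w k +ᵍ v k
      evalᵍ-step₂ k = trans (evalᵍ-+ (wₚ k) (vₚ k) x) (cong₂ _+ᵍ_ (evalᵍ-wₚ k) (evalᵍ-vₚ k))

    evalᵍ-wₚ zero = evalᵍ-1 x
    evalᵍ-wₚ (suc k) = trans (evalᵍ-+ (wₚ k +ₚ X* vₚ k) (X* (wₚ k +ₚ vₚ k)) x)
      (cong₂ _+ᵍ_ (evalᵍ-step₁ k) (trans (evalᵍ-X* (wₚ k +ₚ vₚ k) x) (cong (x *ᵍ_) (evalᵍ-step₂ k))))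
    evalᵍ-vₚ zero = refl
    evalᵍ-vₚ (suc k) = trans (evalᵍ-+ (wₚ k +ₚ X* vₚ k) (wₚ k +ₚ vₚ k) x)
      (cong₂ _+ᵍ_ (evalᵍ-step₁ k) (evalᵍ-step₂ k))

  [1+x]^ₚ_ : ℕ → Polynomial
  [1+x]^ₚ zero  = 1ℤ ∷ []
  [1+x]^ₚ suc n = [1+x]^ₚ n +ₚ X* ([1+x]^ₚ n)

  evalᵍ-[1+x]^ : ∀ n x → evalᵍ ([1+x]^ₚ n) x ≡ (1ᵍ +ᵍ x) ^ᵍ n
  evalᵍ-[1+x]^ zero x = evalᵍ-1 x
  evalᵍ-[1+x]^ (suc n) x = trans (evalᵍ-+ ([1+x]^ₚ n) (X* ([1+x]^ₚ n)) x)
    (trans (cong₂ _+ᵍ_ (evalᵍ-[1+x]^ n x) (trans (evalᵍ-X* ([1+x]^ₚ n) x) (cong (x *ᵍ_) (evalᵍ-[1+x]^ n x))))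
           (eq x ((1ᵍ +ᵍ x) ^ᵍ n)))
    where
    eq : ∀ x u → u +ᵍ x *ᵍ u ≡ (1ᵍ +ᵍ x) *ᵍ u
    eq = solve-∀ ℚ[i]-ring

  closedFormₚ : ℕ → Polynomial
  closedFormₚ n = wₚ (2 ℕ.+ n) +ₚ scale (ℤ.- (+ 2 ℤ.* + (2 ℕ.+ n))) (X* ([1+x]^ₚ n))

  ι-neg : ∀ a → ι (ℤ.- a) ≡ ℚ.- ι a
  ι-neg a = trans (cong ι (sym (ℤₚ.-1*i≡-i a))) (trans (ι-* ℤ.-1ℤ a) (eq (ι a)))
    where
    eq : ∀ a → ι ℤ.-1ℤ ℚ.* a ≡ ℚ.- a
    eq = solve-∀ ℚ-ring

  evalᵍ-closedForm : ∀ n x → evalᵍ (closedFormₚ n) x ≡ closedForm x n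
  evalᵍ-closedForm n x = trans (evalᵍ-+ (wₚ (2 ℕ.+ n)) (scale a (X* ([1+x]^ₚ n))) x)
    (cong₂ _+ᵍ_ (evalᵍ-wₚ x (2 ℕ.+ n))
      (trans (evalᵍ-scale a (X* ([1+x]^ₚ n)) x)
        (trans (cong₂ _*ᵍ_ lemma (trans (evalᵍ-X* ([1+x]^ₚ n) x) (cong (x *ᵍ_) (evalᵍ-[1+x]^ n x))))
          (eq (natᵍ (2 ℕ.+ n)) (x *ᵍ ((1ᵍ +ᵍ x) ^ᵍ n))))))
    where
    a : ℤ
    a = ℤ.- (+ 2 ℤ.* + (2 ℕ.+ n))
    lemma : real (ι a) ≡ -ᵍ (2ᵍ *ᵍ natᵍ (2 ℕ.+ n))
    lemma = trans (cong real (trans (ι-neg (+ 2 ℤ.* + (2 ℕ.+ n))) (cong ℚ.-_ (trans (ι-* (+ 2) (+ (2 ℕ.+ n))) (cong (ι (+ 2) ℚ.*_) (ι-pos (2 ℕ.+ n)))))))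
      (sym (cong -ᵍ_ (trans (cong (2ᵍ *ᵍ_) (natᵍ≡real (2 ℕ.+ n))) (real-* (1ℚ ℚ.+ 1ℚ) (ratℕ (2 ℕ.+ n))))))
    eq : ∀ m u → -ᵍ (2ᵍ *ᵍ m) *ᵍ u ≡ -ᵍ (2ᵍ *ᵍ (m *ᵍ u))
    eq = solve-∀ ℚ[i]-ring

  -- A rational stand-in for the modulus, which would require a square root.
  ‖_‖₁ : ℚ[i] → ℚ
  ‖ z ‖₁ = ℚ.∣ Re z ∣ ℚ.+ ℚ.∣ Im z ∣

  0≤‖_‖₁ : ∀ z → 0ℚ ≤ ‖ z ‖₁
  0≤‖ z ‖₁ = 0≤+ (ℚₚ.0≤∣p∣ (Re z)) (ℚₚ.0≤∣p∣ (Im z))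

  p≤∣p∣ : ∀ p → p ≤ ℚ.∣ p ∣
  p≤∣p∣ p with ℚₚ.≤-total 0ℚ p
  ... | inj₁ 0≤p = ℚₚ.≤-reflexive (sym (ℚₚ.0≤p⇒∣p∣≡p 0≤p))
  ... | inj₂ p≤0 = ℚₚ.≤-trans p≤0 (ℚₚ.0≤∣p∣ p)

  ∧≤‖‖₁ : ∀ z u → z ∧ u ≤ ‖ z ‖₁ ℚ.* ‖ u ‖₁
  ∧≤‖‖₁ (a +𝕚 b) (c +𝕚 d) = begin
    a ℚ.* ℚ.- d ℚ.+ b ℚ.* c
      ≤⟨ ℚₚ.+-mono-≤ (p≤∣p∣ (a ℚ.* ℚ.- d)) (p≤∣p∣ (b ℚ.* c)) ⟩
    ℚ.∣ a ℚ.* ℚ.- d ∣ ℚ.+ ℚ.∣ b ℚ.* c ∣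
      ≡⟨ cong₂ ℚ._+_ (trans (ℚₚ.∣p*q∣≡∣p∣*∣q∣ a (ℚ.- d)) (cong (ℚ.∣ a ∣ ℚ.*_) (ℚₚ.∣-p∣≡∣p∣ d))) (ℚₚ.∣p*q∣≡∣p∣*∣q∣ b c) ⟩
    ℚ.∣ a ∣ ℚ.* ℚ.∣ d ∣ ℚ.+ ℚ.∣ b ∣ ℚ.* ℚ.∣ c ∣
      ≤⟨ ≤-by _ (0≤+ (0≤* (ℚₚ.0≤∣p∣ a) (ℚₚ.0≤∣p∣ c)) (0≤* (ℚₚ.0≤∣p∣ b) (ℚₚ.0≤∣p∣ d))) (eq ℚ.∣ a ∣ ℚ.∣ b ∣ ℚ.∣ c ∣ ℚ.∣ d ∣) ⟩
    (ℚ.∣ a ∣ ℚ.+ ℚ.∣ b ∣) ℚ.* (ℚ.∣ c ∣ ℚ.+ ℚ.∣ d ∣) ∎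
    where
    open ℚₚ.≤-Reasoning
    open Data.Rational using (_+_; _*_; -_)
    eq : ∀ a b c d → (a + b) * (c + d) ≡ (a * d + b * c) + (a * c + b * d)
    eq = solve-∀ ℚ-ring

  ‖conj‖₁ : ∀ z → ‖ conj z ‖₁ ≡ ‖ z ‖₁
  ‖conj‖₁ (a +𝕚 b) = cong (ℚ.∣ a ∣ ℚ.+_) (ℚₚ.∣-p∣≡∣p∣ b)

  Im-conj : ∀ z → Im (conj z) ≡ ℚ.- Im z
  Im-conj (a +𝕚 b) = refl

  cube : ℚ → ℚ
  cube p = p ℚ.* p ℚ.* p

  -- Integer coefficients make evaluation commute with conjugation, which carries the bound from the
  -- upper to the lower half plane.
  Im³-bound : ∀ n → Σ[ K ∈ ℚ ] 0ℚ ≤ K ×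
    (∀ x → cube ℚ.∣ Im x ∣ ≤ K ℚ.* (‖ evalᵍ (closedFormₚ n) x ‖₁ ℚ.* ‖ evalᵍ (vₚ (2 ℕ.+ n)) x ‖₁))
  Im³-bound n = K , 0≤K , bound′
    where
    K : ℚ
    K = proj₁ (closedForm-bound n)
    0≤K : 0ℚ ≤ K
    0≤K = proj₁ (proj₂ (closedForm-bound n))
    bound : ∀ x → 0ℚ ≤ Im x → cube (Im x) ≤ K ℚ.* closedForm x n ∧ EvenOdd.v x (2 ℕ.+ n)
    bound = proj₂ (proj₂ (closedForm-bound n))
    upper : ∀ x → 0ℚ ≤ Im x → cube ℚ.∣ Im x ∣ ≤ K ℚ.* (‖ evalᵍ (closedFormₚ n) x ‖₁ ℚ.* ‖ evalᵍ (vₚ (2 ℕ.+ n)) x ‖₁)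
    upper x 0≤y = begin
      cube ℚ.∣ Im x ∣
        ≡⟨ cong cube (ℚₚ.0≤p⇒∣p∣≡p 0≤y) ⟩
      cube (Im x)
        ≤⟨ bound x 0≤y ⟩
      K ℚ.* closedForm x n ∧ EvenOdd.v x (2 ℕ.+ n)
        ≡⟨ cong₂ (λ H V → K ℚ.* H ∧ V) (evalᵍ-closedForm n x) (evalᵍ-vₚ x (2 ℕ.+ n)) ⟨
      K ℚ.* evalᵍ (closedFormₚ n) x ∧ evalᵍ (vₚ (2 ℕ.+ n)) x
        ≤⟨ ℚₚ.*-monoˡ-≤-nonNeg K {{ℚ.nonNegative 0≤K}} (∧≤‖‖₁ (evalᵍ (closedFormₚ n) x) (evalᵍ (vₚ (2 ℕ.+ n)) x)) ⟩
      K ℚ.* (‖ evalᵍ (closedFormₚ n) x ‖₁ ℚ.* ‖ evalᵍ (vₚ (2 ℕ.+ n)) x ‖₁) ∎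
      where open ℚₚ.≤-Reasoning
    bound′ : ∀ x → cube ℚ.∣ Im x ∣ ≤ K ℚ.* (‖ evalᵍ (closedFormₚ n) x ‖₁ ℚ.* ‖ evalᵍ (vₚ (2 ℕ.+ n)) x ‖₁)
    bound′ x = [ upper x , lower ]′ (ℚₚ.≤-total 0ℚ (Im x))
      where
      lower : Im x ≤ 0ℚ → cube ℚ.∣ Im x ∣ ≤ K ℚ.* (‖ evalᵍ (closedFormₚ n) x ‖₁ ℚ.* ‖ evalᵍ (vₚ (2 ℕ.+ n)) x ‖₁)
      lower y≤0 = begin
        cube ℚ.∣ Im x ∣
          ≡⟨ cong cube (trans (cong ℚ.∣_∣ (Im-conj x)) (ℚₚ.∣-p∣≡∣p∣ (Im x))) ⟨
        cube ℚ.∣ Im (conj x) ∣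
          ≤⟨ upper (conj x) (subst (0ℚ ≤_) (sym (Im-conj x)) (ℚₚ.neg-antimono-≤ y≤0)) ⟩
        K ℚ.* (‖ evalᵍ (closedFormₚ n) (conj x) ‖₁ ℚ.* ‖ evalᵍ (vₚ (2 ℕ.+ n)) (conj x) ‖₁)
          ≡⟨ cong₂ (λ p q → K ℚ.* (p ℚ.* q))
               (trans (cong ‖_‖₁ (evalᵍ-conj (closedFormₚ n) x)) (‖conj‖₁ (evalᵍ (closedFormₚ n) x)))
               (trans (cong ‖_‖₁ (evalᵍ-conj (vₚ (2 ℕ.+ n)) x)) (‖conj‖₁ (evalᵍ (vₚ (2 ℕ.+ n)) x))) ⟩
        K ℚ.* (‖ evalᵍ (closedFormₚ n) x ‖₁ ℚ.* ‖ evalᵍ (vₚ (2 ℕ.+ n)) x ‖₁) ∎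
        where open ℚₚ.≤-Reasoning

  -- From Gaussian rationals to complex zeros.

  term : ℂ → ℕ → ℚ[i]
  term z k = seq (re z) k +𝕚 seq (im z) k

  term-eval : ∀ p z k → term (eval p z) k ≡ evalᵍ p (term z k)
  term-eval []      z k = refl
  term-eval (a ∷ p) z k = cong (λ u → real (ι a) +ᵍ term z k *ᵍ u) (term-eval p z k)

  eventually-bounded : ∀ x → Σ[ B ∈ ℚ ] 0ℚ ≤ B × (∃[ N ] (∀ k → N ℕ.≤ k → ℚ.∣ seq x k ∣ ≤ B))
  eventually-bounded x with cauchy x 1ℚ (ℚₚ.positive⁻¹ 1ℚ)
  ... | N , close = 1ℚ ℚ.+ ℚ.∣ seq x N ∣ , 0≤+ (from-yes (0ℚ ℚ.≤? 1ℚ)) (ℚₚ.0≤∣p∣ (seq x N)) , N , λ k N≤k → begin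
    ℚ.∣ seq x k ∣
      ≡⟨ cong ℚ.∣_∣ (eq (seq x k) (seq x N)) ⟩
    ℚ.∣ seq x k ℚ.- seq x N ℚ.+ seq x N ∣
      ≤⟨ ℚₚ.∣p+q∣≤∣p∣+∣q∣ (seq x k ℚ.- seq x N) (seq x N) ⟩
    ℚ.∣ seq x k ℚ.- seq x N ∣ ℚ.+ ℚ.∣ seq x N ∣
      ≤⟨ ℚₚ.+-monoˡ-≤ ℚ.∣ seq x N ∣ (close k N N≤k ℕₚ.≤-refl) ⟩
    1ℚ ℚ.+ ℚ.∣ seq x N ∣ ∎
    where
    open ℚₚ.≤-Reasoning
    eq : ∀ a b → a ≡ a ℚ.- b ℚ.+ b
    eq = solve-∀ ℚ-ring

  open ℚ[i]

  cube-mono-< : ∀ {p q} → 0ℚ ℚ.< p → p ℚ.< q → cube p ℚ.< cube q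
  cube-mono-< {p} {q} 0<p p<q = begin-strict
    p ℚ.* p ℚ.* p  <⟨ ℚₚ.*-monoʳ-<-pos (p ℚ.* p) p<q ⟩
    p ℚ.* p ℚ.* q  ≤⟨ ℚₚ.*-monoʳ-≤-nonNeg q (ℚₚ.*-monoˡ-≤-nonNeg p (ℚₚ.<⇒≤ p<q)) ⟩
    p ℚ.* q ℚ.* q  ≤⟨ ℚₚ.*-monoʳ-≤-nonNeg q (ℚₚ.*-monoʳ-≤-nonNeg q (ℚₚ.<⇒≤ p<q)) ⟩
    q ℚ.* q ℚ.* q  ∎
    where
    open ℚₚ.≤-Reasoning
    instance
      _ = ℚ.positive 0<p
      _ = ℚₚ.pos*pos⇒pos p p
      _ = ℚ.nonNegative (ℚₚ.<⇒≤ 0<p)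
      _ = ℚ.nonNegative (ℚₚ.<⇒≤ (ℚₚ.<-trans 0<p p<q))

  cube-cancel-≤ : ∀ {p q} → 0ℚ ℚ.< q → cube p ≤ cube q → p ≤ q
  cube-cancel-≤ 0<q p³≤q³ = ℚₚ.≮⇒≥ (λ q<p → ℚₚ.<-irrefl refl (ℚₚ.<-≤-trans (cube-mono-< 0<q q<p) p³≤q³))

  division : ∀ C ε → 0ℚ ℚ.< C → 0ℚ ℚ.< ε → Σ[ δ ∈ ℚ ] 0ℚ ℚ.< δ × C ℚ.* δ ≡ ε
  division C ε 0<C 0<ε = ℚ.1/ C ℚ.* ε , ℚₚ.positive⁻¹ (ℚ.1/ C ℚ.* ε) {{ℚₚ.pos*pos⇒pos (ℚ.1/ C) ε}} ,
    trans (sym (ℚₚ.*-assoc C (ℚ.1/ C) ε)) (trans (cong (ℚ._* ε) (ℚₚ.*-inverseʳ C)) (ℚₚ.*-identityˡ ε))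
    where
    instance
      _ = ℚ.positive 0<C
      _ = ℚ.positive 0<ε
      _ = ℚₚ.pos⇒nonZero C
      _ = ℚₚ.1/pos⇒pos C

  p-0≡p : ∀ p → p ℚ.- 0ℚ ≡ p
  p-0≡p = ℚₚ.+-identityʳ

  0<cube : ∀ {p} → 0ℚ ℚ.< p → 0ℚ ℚ.< cube p
  0<cube {p} 0<p = ℚₚ.positive⁻¹ (cube p) {{ℚₚ.pos*pos⇒pos (p ℚ.* p) p}}
    where
    instance
      _ = ℚ.positive 0<p
      _ = ℚₚ.pos*pos⇒pos p p

  -- The bound is at most `2KBδ`, which is below `ε³` by the choice of `δ`. The summand 1 keeps the
  -- factor to be inverted positive even when `K B = 0`.
  ≤-from-cube-bound : ∀ {K B δ ε} (a : ℚ) (H V : ℚ[i]) → 0ℚ ≤ K → 0ℚ ℚ.< δ → 0ℚ ℚ.< ε →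
    (1ℚ ℚ.+ K ℚ.* ((1ℚ ℚ.+ 1ℚ) ℚ.* B)) ℚ.* δ ≡ cube ε →
    cube a ≤ K ℚ.* (‖ H ‖₁ ℚ.* ‖ V ‖₁) → ‖ H ‖₁ ≤ δ ℚ.+ δ → ‖ V ‖₁ ≤ B → a ≤ ε
  ≤-from-cube-bound {K} {B} {δ} {ε} a H V 0≤K 0<δ 0<ε Cδ≡ε³ bound H≤ V≤ = cube-cancel-≤ 0<ε (begin
    cube a
      ≤⟨ bound ⟩
    K ℚ.* (‖ H ‖₁ ℚ.* ‖ V ‖₁)
      ≤⟨ ℚₚ.*-monoˡ-≤-nonNeg K {{ℚ.nonNegative 0≤K}} (ℚₚ.≤-trans
           (ℚₚ.*-monoʳ-≤-nonNeg ‖ V ‖₁ {{ℚ.nonNegative 0≤‖ V ‖₁}} H≤)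
           (ℚₚ.*-monoˡ-≤-nonNeg (δ ℚ.+ δ) {{ℚ.nonNegative (0≤+ (ℚₚ.<⇒≤ 0<δ) (ℚₚ.<⇒≤ 0<δ))}} V≤)) ⟩
    K ℚ.* ((δ ℚ.+ δ) ℚ.* B)
      ≤⟨ ≤-by δ (ℚₚ.<⇒≤ 0<δ) (eq K δ B) ⟩
    (1ℚ ℚ.+ K ℚ.* ((1ℚ ℚ.+ 1ℚ) ℚ.* B)) ℚ.* δ
      ≡⟨ Cδ≡ε³ ⟩
    cube ε ∎)
    where
    open ℚₚ.≤-Reasoning
    open Data.Rational using (_+_; _*_)
    eq : ∀ K δ B → (1ℚ + K * ((1ℚ + 1ℚ) * B)) * δ ≡ K * ((δ + δ) * B) + δ
    eq = solve-∀ ℚ-ring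

  EventuallyBoundedBy : (ℕ → ℚ) → ℚ → Set
  EventuallyBoundedBy f B = ∃[ N ] (∀ k → N ℕ.≤ k → f k ≤ B)

  eventually-+ : ∀ {f g A B} → EventuallyBoundedBy f A → EventuallyBoundedBy g B → EventuallyBoundedBy (λ k → f k ℚ.+ g k) (A ℚ.+ B)
  eventually-+ (N₁ , f≤) (N₂ , g≤) = N₁ ℕ.⊔ N₂ , λ k N≤k →
    ℚₚ.+-mono-≤ (f≤ k (ℕₚ.m⊔n≤o⇒m≤o N₁ N₂ N≤k)) (g≤ k (ℕₚ.m⊔n≤o⇒n≤o N₁ N₂ N≤k))

  term-bounded : ∀ V → Σ[ B ∈ ℚ ] 0ℚ ≤ B × EventuallyBoundedBy (λ k → ‖ term V k ‖₁) B
  term-bounded V = sum (eventually-bounded (re V)) (eventually-bounded (im V))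
    where
    sum : (Σ[ B ∈ ℚ ] 0ℚ ≤ B × EventuallyBoundedBy (λ k → ℚ.∣ seq (re V) k ∣) B) →
          (Σ[ B ∈ ℚ ] 0ℚ ≤ B × EventuallyBoundedBy (λ k → ℚ.∣ seq (im V) k ∣) B) →
          Σ[ B ∈ ℚ ] 0ℚ ≤ B × EventuallyBoundedBy (λ k → ‖ term V k ‖₁) B
    sum (A , 0≤A , reV≤) (B , 0≤B , imV≤) = A ℚ.+ B , 0≤+ 0≤A 0≤B , eventually-+ reV≤ imV≤

  ≈0⇒bounded : ∀ x → x ≈ᴿ 0ᴿ → ∀ δ → 0ℚ ℚ.< δ → EventuallyBoundedBy (λ k → ℚ.∣ seq x k ∣) δ
  ≈0⇒bounded x x≈0 δ 0<δ = proj₁ (x≈0 δ 0<δ) ,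
    λ k N≤k → subst (λ p → ℚ.∣ p ∣ ≤ δ) (p-0≡p (seq x k)) (proj₂ (x≈0 δ 0<δ) k N≤k)

  -- The terms of `V` are Cauchy and hence bounded, so their product with the null sequence `H`
  -- tends to zero, and with it the cube.
  ≈0-from-bound : ∀ (H V z : ℂ) K → 0ℚ ≤ K →
    (∀ k → cube ℚ.∣ seq (im z) k ∣ ≤ K ℚ.* (‖ term H k ‖₁ ℚ.* ‖ term V k ‖₁)) →
    H ≈ᶜ 0ᶜ → im z ≈ᴿ 0ᴿ
  ≈0-from-bound H V z K 0≤K bound (reH≈0 , imH≈0) ε 0<ε = go (term-bounded V)
    where
    conclude : ∀ B δ → 0ℚ ℚ.< δ → (1ℚ ℚ.+ K ℚ.* ((1ℚ ℚ.+ 1ℚ) ℚ.* B)) ℚ.* δ ≡ cube ε →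
      EventuallyBoundedBy (λ k → ‖ term V k ‖₁) B → EventuallyBoundedBy (λ k → ‖ term H k ‖₁) (δ ℚ.+ δ) →
      ∃[ N ] (∀ k → N ℕ.≤ k → ℚ.∣ seq (im z) k ℚ.- 0ℚ ∣ ≤ ε)
    conclude B δ 0<δ Cδ≡ε³ (N₁ , V≤) (N₂ , H≤) = N₁ ℕ.⊔ N₂ , λ k N≤k →
      subst (λ p → ℚ.∣ p ∣ ≤ ε) (sym (p-0≡p (seq (im z) k)))
        (≤-from-cube-bound ℚ.∣ seq (im z) k ∣ (term H k) (term V k) 0≤K 0<δ 0<ε Cδ≡ε³ (bound k)
          (H≤ k (ℕₚ.m⊔n≤o⇒n≤o N₁ N₂ N≤k)) (V≤ k (ℕₚ.m⊔n≤o⇒m≤o N₁ N₂ N≤k)))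
    go : Σ[ B ∈ ℚ ] 0ℚ ≤ B × EventuallyBoundedBy (λ k → ‖ term V k ‖₁) B → _
    go (B , 0≤B , V≤) = go′ (division C (cube ε) 0<C (0<cube 0<ε))
      where
      C : ℚ
      C = 1ℚ ℚ.+ K ℚ.* ((1ℚ ℚ.+ 1ℚ) ℚ.* B)
      0<C : 0ℚ ℚ.< C
      0<C = ℚₚ.+-mono-<-≤ (ℚₚ.positive⁻¹ 1ℚ) (0≤* 0≤K (0≤* (from-yes (0ℚ ℚ.≤? 1ℚ ℚ.+ 1ℚ)) 0≤B))
      go′ : Σ[ δ ∈ ℚ ] 0ℚ ℚ.< δ × C ℚ.* δ ≡ cube ε → _
      go′ (δ , 0<δ , Cδ≡ε³) = conclude B δ 0<δ Cδ≡ε³ V≤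
        (eventually-+ (≈0⇒bounded (re H) reH≈0 δ 0<δ) (≈0⇒bounded (im H) imH≈0 δ 0<δ))

  realRooted-closedForm : ∀ n h → coeff h ≗ coeff (closedFormₚ n) → RealRooted h
  realRooted-closedForm n h h≗ z h[z]≈0 =
    ≈0-from-bound (eval h z) (eval (vₚ (2 ℕ.+ n)) z) z (proj₁ (Im³-bound n)) (proj₁ (proj₂ (Im³-bound n)))
      (λ k → subst₂ (λ H V → cube ℚ.∣ seq (im z) k ∣ ≤ proj₁ (Im³-bound n) ℚ.* (‖ H ‖₁ ℚ.* ‖ V ‖₁))
        (sym (trans (term-eval h z k) (evalᵍ-cong h (closedFormₚ n) (term z k) h≗)))
        (sym (term-eval (vₚ (2 ℕ.+ n)) z k))
        (proj₂ (proj₂ (Im³-bound n)) (term z k)))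
      h[z]≈0

-- Generating functions as operators on coefficient sequences.

module Series where

  open import Data.Nat as ℕ using (ℕ; zero; suc)
  import Data.Nat.Properties as ℕₚ
  open import Data.Integer as ℤ using (ℤ; +_; 0ℤ; 1ℤ; -1ℤ; _+_; _*_; _-_)
  import Data.Integer.Properties as ℤₚ
  open import Data.Integer.Tactic.RingSolver using () renaming (solve-∀ to solveℤ)
  open import Algebra.Bundles using (module AbelianGroup)
  open import Algebra.Properties.Group (AbelianGroup.group ℤₚ.+-0-abelianGroup) using (∙-cancelʳ)
  open import Data.List using ([]; _∷_)
  open import Relation.Binary.PropositionalEquality
  open GaussianRationals using (_+ₚ_; X*_; scale; wₚ; vₚ; [1+x]^ₚ_; closedFormₚ)

  open ≡-Reasoning

  -- Multiplication by `x`, `1 - x` and `1 + x`. Rational generating functions are handled with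
  -- their denominators cleared, as identities between iterates of these.
  shift D E : PowerSeries → PowerSeries
  shift f zero    = 0ℤ
  shift f (suc k) = f k
  D f k = f k - shift f k
  E f k = f k + shift f k

  shift-cong : ∀ {f g} → f ≗ g → shift f ≗ shift g
  shift-cong f≗g zero    = refl
  shift-cong f≗g (suc k) = f≗g k

  D-cong : ∀ {f g} → f ≗ g → D f ≗ D g
  D-cong f≗g k = cong₂ _-_ (f≗g k) (shift-cong f≗g k)

  E-cong : ∀ {f g} → f ≗ g → E f ≗ E g
  E-cong f≗g k = cong₂ _+_ (f≗g k) (shift-cong f≗g k)

  iter : (PowerSeries → PowerSeries) → ℕ → PowerSeries → PowerSeries
  iter T zero    f = f
  iter T (suc n) f = T (iter T n f)

  iter-cong : ∀ {T} → (∀ {f g} → f ≗ g → T f ≗ T g) → ∀ n {f g} → f ≗ g → iter T n f ≗ iter T n g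
  iter-cong T-cong zero    f≗g = f≗g
  iter-cong T-cong (suc n) f≗g = T-cong (iter-cong T-cong n f≗g)

  ⊛-vanishing : ∀ f g → (∀ k → f (suc k) ≡ 0ℤ) → ∀ k → (f ⊛ g) k ≡ f 0 * g k
  ⊛-vanishing f g f≡0 zero = ℤₚ.+-identityʳ (f 0 * g 0)
  ⊛-vanishing f g f≡0 (suc k) = trans (cong (_+_ (f 0 * g (suc k))) (trans (⊛-vanishing (λ i → f (suc i)) g (λ i → f≡0 (suc i)) k)
    (cong (_* g k) (f≡0 0)))) (ℤₚ.+-identityʳ (f 0 * g (suc k)))

  ⊛-one : ∀ f → f ⊛ one ≗ f
  ⊛-one f zero = eq (f 0)
    where
    eq : ∀ a → a * 1ℤ + 0ℤ ≡ a
    eq = solveℤ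
  ⊛-one f (suc k) = trans (cong (_+_ (f 0 * 0ℤ)) (⊛-one (λ i → f (suc i)) k)) (eq (f 0) (f (suc k)))
    where
    eq : ∀ a b → a * 0ℤ + b ≡ b
    eq = solveℤ

  1-x⊛ : ∀ g → 1-x ⊛ g ≗ D g
  1-x⊛ g zero = eq (g 0)
    where
    eq : ∀ a → 1ℤ * a + 0ℤ ≡ a - 0ℤ
    eq = solveℤ
  1-x⊛ g (suc k) = trans (cong (_+_ (1ℤ * g (suc k))) (⊛-vanishing (λ i → 1-x (suc i)) g (λ _ → refl) k)) (eq (g (suc k)) (g k))
    where
    eq : ∀ a b → 1ℤ * a + -1ℤ * b ≡ a - b
    eq = solveℤ

  ⊛-congʳ : ∀ f {g h} → g ≗ h → f ⊛ g ≗ f ⊛ h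
  ⊛-congʳ f g≗h zero = cong (λ a → f 0 * a + 0ℤ) (g≗h 0)
  ⊛-congʳ f g≗h (suc k) = cong₂ (λ a b → f 0 * a + b) (g≗h (suc k)) (⊛-congʳ (λ i → f (suc i)) g≗h k)

  ⊛-suc : ∀ f g k → (f ⊛ g) k ≡ f 0 * g k + shift ((λ i → f (suc i)) ⊛ g) k
  ⊛-suc f g zero    = refl
  ⊛-suc f g (suc k) = refl

  ⊛-D : ∀ f g → f ⊛ D g ≗ D (f ⊛ g)
  ⊛-D f g zero = eq (f 0) (g 0)
    where
    eq : ∀ a b → a * (b - 0ℤ) + 0ℤ ≡ (a * b + 0ℤ) - 0ℤ
    eq = solveℤ
  ⊛-D f g (suc k) = begin
    f 0 * (g (suc k) - g k) + (f′ ⊛ D g) k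
      ≡⟨ cong (_+_ (f 0 * (g (suc k) - g k))) (⊛-D f′ g k) ⟩
    f 0 * (g (suc k) - g k) + ((f′ ⊛ g) k - shift (f′ ⊛ g) k)
      ≡⟨ eq (f 0) (g (suc k)) (g k) ((f′ ⊛ g) k) (shift (f′ ⊛ g) k) ⟩
    (f 0 * g (suc k) + (f′ ⊛ g) k) - (f 0 * g k + shift (f′ ⊛ g) k)
      ≡⟨ cong (_-_ (f 0 * g (suc k) + (f′ ⊛ g) k)) (⊛-suc f g k) ⟨
    (f 0 * g (suc k) + (f′ ⊛ g) k) - (f ⊛ g) k ∎
    where
    f′ : PowerSeries
    f′ i = f (suc i)
    eq : ∀ a b c d s → a * (b - c) + (d - s) ≡ (a * b + d) - (a * c + s)
    eq = solveℤ

  ⊛-[1-x]^ : ∀ d f → f ⊛ ([1-x]^ d) ≗ iter D d f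
  ⊛-[1-x]^ zero f = ⊛-one f
  ⊛-[1-x]^ (suc d) f k = trans (⊛-congʳ f (1-x⊛ ([1-x]^ d)) k)
    (trans (⊛-D f ([1-x]^ d) k) (D-cong (⊛-[1-x]^ d f) k))

  iter-D-linear : ∀ n a f g → iter D n (λ k → f k - a * g k) ≗ (λ k → iter D n f k - a * iter D n g k)
  iter-D-linear zero a f g k = refl
  iter-D-linear (suc n) a f g k = trans (D-cong (iter-D-linear n a f g) k) (lemma k)
    where
    eq : ∀ a p q r s → (p - a * q) - (r - a * s) ≡ (p - r) - a * (q - s)
    eq = solveℤ
    lemma : D (λ k → iter D n f k - a * iter D n g k) ≗ (λ k → D (iter D n f) k - a * D (iter D n g) k)
    lemma zero = eq₀ a (iter D n f 0) (iter D n g 0)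
      where
      eq₀ : ∀ a p q → (p - a * q) - 0ℤ ≡ (p - 0ℤ) - a * (q - 0ℤ)
      eq₀ = solveℤ
    lemma (suc k) = eq a (iter D n f (suc k)) (iter D n g (suc k)) (iter D n f k) (iter D n g k)

  -- c n m is the number of vectors of ℤⁿ with 1-norm m.

  c : ℕ → PowerSeries
  c zero    zero    = 1ℤ
  c zero    (suc m) = 0ℤ
  c (suc n) zero    = c n zero
  c (suc n) (suc m) = c (suc n) m + (c n m + c n (suc m))

  -- One more coordinate contributes `1 + 2x + 2x² + ... = (1 + x) / (1 - x)`.
  D-c : ∀ n → D (c (suc n)) ≗ E (c n)
  D-c n zero    = eq (c n 0)
    where
    eq : ∀ a → a - 0ℤ ≡ a + 0ℤ
    eq = solveℤ
  D-c n (suc m) = eq (c (suc n) m) (c n m) (c n (suc m))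
    where
    eq : ∀ a b c → (a + (b + c)) - a ≡ c + b
    eq = solveℤ

  D-E-comm : ∀ f → D (E f) ≗ E (D f)
  D-E-comm f zero = eq (f 0)
    where
    eq : ∀ a → (a + 0ℤ) - 0ℤ ≡ (a - 0ℤ) + 0ℤ
    eq = solveℤ
  D-E-comm f (suc k) = eq (f (suc k)) (f k) (shift f k)
    where
    eq : ∀ a b s → (a + b) - (b + s) ≡ (a - b) + (b - s)
    eq = solveℤ

  iter-D-E : ∀ n f → iter D n (E f) ≗ E (iter D n f)
  iter-D-E zero f k = refl
  iter-D-E (suc n) f k = trans (D-cong (iter-D-E n f) k) (D-E-comm (iter D n f) k)

  iter-D-D : ∀ n f → iter D n (D f) ≗ D (iter D n f)
  iter-D-D zero f k = refl
  iter-D-D (suc n) f k = D-cong (iter-D-D n f) k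

  one≗c₀ : one ≗ c 0
  one≗c₀ zero    = refl
  one≗c₀ (suc k) = refl

  -- Σ c n m xᵐ = ((1 + x) / (1 - x))ⁿ.
  iter-D-c : ∀ n → iter D n (c n) ≗ iter E n one
  iter-D-c zero k = sym (one≗c₀ k)
  iter-D-c (suc n) k = trans (sym (iter-D-D n (c (suc n)) k))
    (trans (iter-cong D-cong n (D-c n) k) (trans (iter-D-E n (c n) k) (E-cong (iter-D-c n) k)))

  even odd : PowerSeries → PowerSeries
  even f k = f (k ℕ.+ k)
  odd f k = f (suc (k ℕ.+ k))

  -- e′ n k is the number of vectors of ℤⁿ with 1-norm less than k and of the other parity.

  e′ : ℕ → PowerSeries
  e′ n zero          = 0ℤ
  e′ n (suc zero)    = c n 0
  e′ n (suc (suc k)) = e′ n k + c n (suc k)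

  -- The two-step recursion of `e′` is division by `1 - x²`, which factors into `D` and `E`.
  E-D-e : ∀ n → E (D (e′ n)) ≗ shift (c n)
  E-D-e n zero = refl
  E-D-e n (suc zero) = eq (c n 0)
    where
    eq : ∀ a → (a - 0ℤ) + (0ℤ - 0ℤ) ≡ a
    eq = solveℤ
  E-D-e n (suc (suc k)) = eq (e′ n k) (e′ n (suc k)) (c n (suc k))
    where
    eq : ∀ a b c → ((a + c) - b) + (b - a) ≡ c
    eq = solveℤ

  E-injective : ∀ {f g} → E f ≗ E g → f ≗ g
  E-injective {f} {g} Ef≗Eg zero = trans (sym (ℤₚ.+-identityʳ (f 0))) (trans (Ef≗Eg 0) (ℤₚ.+-identityʳ (g 0)))
  E-injective {f} {g} Ef≗Eg (suc k) = ∙-cancelʳ (f k) (f (suc k)) (g (suc k))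
    (trans (Ef≗Eg (suc k)) (cong (_+_ (g (suc k))) (sym (E-injective {f} {g} Ef≗Eg k))))

  shift-E : ∀ f → shift (E f) ≗ E (shift f)
  shift-E f zero    = refl
  shift-E f (suc k) = refl

  shift-D : ∀ f → shift (D f) ≗ D (shift f)
  shift-D f zero    = refl
  shift-D f (suc k) = refl

  iter-D-shift : ∀ n f → iter D n (shift f) ≗ shift (iter D n f)
  iter-D-shift zero f k = refl
  iter-D-shift (suc n) f k = trans (D-cong (iter-D-shift n f) k) (sym (shift-D (iter D n f) k))

  -- The series of `e′ (suc n)` is `x / (1 - x²)` times `((1 + x) / (1 - x))ⁿ⁺¹`, so `(1 - x)ⁿ⁺²`
  -- clears it to `x (1 + x)ⁿ`. The surplus factor `1 + x` is cancelled by `E-injective`.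
  iter-D-e : ∀ n → iter D (2 ℕ.+ n) (e′ (suc n)) ≗ shift (iter E n one)
  iter-D-e n = E-injective λ k → begin
    E (iter D (2 ℕ.+ n) (e′ (suc n))) k
      ≡⟨ E-cong (iter-D-D (suc n) (e′ (suc n))) k ⟨
    E (iter D (suc n) (D (e′ (suc n)))) k
      ≡⟨ iter-D-E (suc n) (D (e′ (suc n))) k ⟨
    iter D (suc n) (E (D (e′ (suc n)))) k
      ≡⟨ iter-cong D-cong (suc n) (E-D-e (suc n)) k ⟩
    iter D (suc n) (shift (c (suc n))) k
      ≡⟨ iter-D-shift (suc n) (c (suc n)) k ⟩
    shift (iter D (suc n) (c (suc n))) k
      ≡⟨ shift-cong (iter-D-c (suc n)) k ⟩
    shift (E (iter E n one)) k
      ≡⟨ shift-E (iter E n one) k ⟩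
    E (shift (iter E n one)) k ∎

  even-cong : ∀ {f g} → f ≗ g → even f ≗ even g
  even-cong f≗g k = f≗g (k ℕ.+ k)

  even-E : ∀ f k → even (E f) k ≡ even f k + shift (odd f) k
  even-E f zero    = refl
  even-E f (suc k) rewrite ℕₚ.+-suc k k = refl

  odd-E : ∀ f k → odd (E f) k ≡ even f k + odd f k
  odd-E f k = ℤₚ.+-comm (odd f k) (even f k)

  -- `D ∘ E` multiplies by `1 - s²`, and `s²` is the variable of the even part.
  even-D-E : ∀ f → even (D (E f)) ≗ D (even f)
  even-D-E f zero = eq (f 0)
    where
    eq : ∀ a → (a + 0ℤ) - 0ℤ ≡ a - 0ℤ
    eq = solveℤ
  even-D-E f (suc k) rewrite ℕₚ.+-suc k k = eq (f (suc (suc (k ℕ.+ k)))) (f (suc (k ℕ.+ k))) (f (k ℕ.+ k))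
    where
    eq : ∀ a b c → (a + b) - (b + c) ≡ a - c
    eq = solveℤ

  iter-D-even : ∀ n f → iter D n (even f) ≗ even (iter E n (iter D n f))
  iter-D-even zero f k = refl
  iter-D-even (suc n) f k = begin
    D (iter D n (even f)) k
      ≡⟨ D-cong (iter-D-even n f) k ⟩
    D (even (iter E n (iter D n f))) k
      ≡⟨ even-D-E (iter E n (iter D n f)) k ⟨
    even (D (E (iter E n (iter D n f)))) k
      ≡⟨ D-E-comm (iter E n (iter D n f)) (k ℕ.+ k) ⟩
    E (D (iter E n (iter D n f))) (k ℕ.+ k)
      ≡⟨ E-cong (D-iter-E n (iter D n f)) (k ℕ.+ k) ⟩
    even (iter E (suc n) (iter D (suc n) f)) k ∎
    where
    D-iter-E : ∀ n g → D (iter E n g) ≗ iter E n (D g)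
    D-iter-E zero g k = refl
    D-iter-E (suc n) g k = trans (D-E-comm (iter E n g) k) (E-cong (D-iter-E n g) k)

  -- Coefficients of the closed form.

  coeff-+ : ∀ p q k → coeff (p +ₚ q) k ≡ coeff p k + coeff q k
  coeff-+ [] q k = sym (ℤₚ.+-identityˡ (coeff q k))
  coeff-+ (a ∷ p) [] k = sym (ℤₚ.+-identityʳ (coeff (a ∷ p) k))
  coeff-+ (a ∷ p) (b ∷ q) zero = refl
  coeff-+ (a ∷ p) (b ∷ q) (suc k) = coeff-+ p q k

  coeff-X* : ∀ p k → coeff (X* p) k ≡ shift (coeff p) k
  coeff-X* p zero = refl
  coeff-X* p (suc k) = refl

  coeff-scale : ∀ a p k → coeff (scale a p) k ≡ a * coeff p k
  coeff-scale a [] k = sym (ℤₚ.*-zeroʳ a)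
  coeff-scale a (b ∷ p) zero = refl
  coeff-scale a (b ∷ p) (suc k) = coeff-scale a p k

  coeff-1 : coeff (1ℤ ∷ []) ≗ one
  coeff-1 zero = refl
  coeff-1 (suc k) = refl

  coeff-[1+x]^ : ∀ n → coeff ([1+x]^ₚ n) ≗ iter E n one
  coeff-[1+x]^ zero k = coeff-1 k
  coeff-[1+x]^ (suc n) k = trans (coeff-+ ([1+x]^ₚ n) (X* ([1+x]^ₚ n)) k)
    (cong₂ _+_ (coeff-[1+x]^ n k) (trans (coeff-X* ([1+x]^ₚ n) k) (shift-cong (coeff-[1+x]^ n) k)))

  -- Taking `s` as the series variable, `wₚ k` and `vₚ k` are the even and odd parts of `(1 + s)²ᵏ`;
  -- the two inductions are mutual because a factor `1 + s` mixes them.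
  coeff-wₚ : ∀ k → coeff (wₚ k) ≗ even (iter E (k ℕ.+ k) one)
  coeff-vₚ : ∀ k → coeff (vₚ k) ≗ odd (iter E (k ℕ.+ k) one)

  module _ (k : ℕ) where
    private
      f : PowerSeries
      f = iter E (k ℕ.+ k) one
    coeff-step₁ : coeff (wₚ k +ₚ X* vₚ k) ≗ even (E f)
    coeff-step₁ i = trans (coeff-+ (wₚ k) (X* vₚ k) i)
      (trans (cong₂ _+_ (coeff-wₚ k i) (trans (coeff-X* (vₚ k) i) (shift-cong (coeff-vₚ k) i)))
             (sym (even-E f i)))
    coeff-step₂ : coeff (wₚ k +ₚ vₚ k) ≗ odd (E f)
    coeff-step₂ i = trans (coeff-+ (wₚ k) (vₚ k) i)
      (trans (cong₂ _+_ (coeff-wₚ k i) (coeff-vₚ k i)) (sym (odd-E f i)))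

  coeff-wₚ zero zero = refl
  coeff-wₚ zero (suc i) = refl
  coeff-wₚ (suc k) i = begin
    coeff (wₚ (suc k)) i
      ≡⟨ coeff-+ (wₚ k +ₚ X* vₚ k) (X* (wₚ k +ₚ vₚ k)) i ⟩
    coeff (wₚ k +ₚ X* vₚ k) i + coeff (X* (wₚ k +ₚ vₚ k)) i
      ≡⟨ cong₂ _+_ (coeff-step₁ k i) (trans (coeff-X* (wₚ k +ₚ vₚ k) i) (shift-cong (coeff-step₂ k) i)) ⟩
    even (E f) i + shift (odd (E f)) i
      ≡⟨ even-E (E f) i ⟨
    even (E (E f)) i
      ≡⟨ cong (λ m → even (iter E (suc m) one) i) (ℕₚ.+-suc k k) ⟨
    even (iter E (suc k ℕ.+ suc k) one) i ∎
    where
    f : PowerSeries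
    f = iter E (k ℕ.+ k) one
  coeff-vₚ zero i = refl
  coeff-vₚ (suc k) i = begin
    coeff (vₚ (suc k)) i
      ≡⟨ coeff-+ (wₚ k +ₚ X* vₚ k) (wₚ k +ₚ vₚ k) i ⟩
    coeff (wₚ k +ₚ X* vₚ k) i + coeff (wₚ k +ₚ vₚ k) i
      ≡⟨ cong₂ _+_ (coeff-step₁ k i) (coeff-step₂ k i) ⟩
    even (E f) i + odd (E f) i
      ≡⟨ odd-E (E f) i ⟨
    odd (E (E f)) i
      ≡⟨ cong (λ m → odd (iter E (suc m) one) i) (ℕₚ.+-suc k k) ⟨
    odd (iter E (suc k ℕ.+ suc k) one) i ∎
    where
    f : PowerSeries
    f = iter E (k ℕ.+ k) one

  iter-+ : ∀ T m n f → iter T (m ℕ.+ n) f ≡ iter T m (iter T n f)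
  iter-+ T zero n f = refl
  iter-+ T (suc m) n f = cong T (iter-+ T m n f)

  coeff-closedForm : ∀ n S → (∀ k → S k ≡ c (2 ℕ.+ n) (k ℕ.+ k) - (+ 2 * + (2 ℕ.+ n)) * e′ (suc n) k) →
    iter D (2 ℕ.+ n) S ≗ coeff (closedFormₚ n)
  coeff-closedForm n S S≗ k = begin
    iter D d S k
      ≡⟨ iter-cong D-cong d S≗ k ⟩
    iter D d (λ k → even (c d) k - a * e′ (suc n) k) k
      ≡⟨ iter-D-linear d a (even (c d)) (e′ (suc n)) k ⟩
    iter D d (even (c d)) k - a * iter D d (e′ (suc n)) k
      ≡⟨ cong₂ (λ p q → p - a * q) lemma (trans (iter-D-e n k) (shift-cong (λ i → sym (coeff-[1+x]^ n i)) k)) ⟩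
    coeff (wₚ d) k - a * shift (coeff ([1+x]^ₚ n)) k
      ≡⟨ cong (_+_ (coeff (wₚ d) k)) (ℤₚ.neg-distribˡ-* a (shift (coeff ([1+x]^ₚ n)) k)) ⟩
    coeff (wₚ d) k + ℤ.- a * shift (coeff ([1+x]^ₚ n)) k
      ≡⟨ cong (_+_ (coeff (wₚ d) k)) (trans (coeff-scale (ℤ.- a) (X* ([1+x]^ₚ n)) k) (cong (ℤ.- a *_) (coeff-X* ([1+x]^ₚ n) k))) ⟨
    coeff (wₚ d) k + coeff (scale (ℤ.- a) (X* ([1+x]^ₚ n))) k
      ≡⟨ coeff-+ (wₚ d) (scale (ℤ.- a) (X* ([1+x]^ₚ n))) k ⟨
    coeff (closedFormₚ n) k ∎
    where
    d : ℕ
    d = 2 ℕ.+ n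
    a : ℤ
    a = + 2 * + d
    -- The factor `(1 - x)ᵈ` enters the even part as `(1 - s²)ᵈ`, and `((1 + s) / (1 - s))ᵈ (1 -
    -- s²)ᵈ = (1 + s)²ᵈ`.
    lemma : iter D d (even (c d)) k ≡ coeff (wₚ d) k
    lemma = begin
      iter D d (even (c d)) k
        ≡⟨ iter-D-even d (c d) k ⟩
      even (iter E d (iter D d (c d))) k
        ≡⟨ even-cong (iter-cong E-cong d (iter-D-c d)) k ⟩
      even (iter E d (iter E d one)) k
        ≡⟨ cong (λ f → even f k) (iter-+ E d d one) ⟨
      even (iter E (d ℕ.+ d) one) k
        ≡⟨ coeff-wₚ d k ⟨
      coeff (wₚ d) k ∎

-- Word length in the root lattice.

module WordLength where

  open import Data.Nat as ℕ using (ℕ; zero; suc; _≤_; _<_; z≤n; s≤s)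
  import Data.Nat.Properties as ℕₚ
  open import Data.Nat.Tactic.RingSolver using () renaming (solve-∀ to solveℕ)
  open import Data.Integer as ℤ using (ℤ; +_; -[1+_]; 0ℤ; 1ℤ; -1ℤ; ∣_∣)
  import Data.Integer.Properties as ℤₚ
  open import Data.Parity as ℙ using (0ℙ; 1ℙ)
  import Data.Parity.Properties as ℙₚ
  open import Data.Fin as Fin using (Fin; zero; suc)
  import Data.Fin.Properties as Finₚ
  open import Data.Vec using ([]; _∷_; replicate; lookup; _[_]≔_)
  import Data.Vec.Properties as Vecₚ
  import Data.Vec.Functional as Vector
  open import Data.List as List using (List; []; _∷_)
  open import Data.List.Membership.Propositional using (_∈_; find; lose)
  open import Data.List.Membership.Propositional.Properties using (∈-filter⁺; ∈-filter⁻; ∈-cartesianProduct⁺; ∈-allFin; ∈-concatMap⁺; ∈-concatMap⁻)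
  open import Data.List.Relation.Unary.Any using (here; there)
  open import Data.List.Relation.Unary.All as All using (All; []; _∷_)
  open import Data.Product using (_×_; _,_; proj₁; proj₂; ∃-syntax)
  open import Data.Sum using (_⊎_; inj₁; inj₂)
  open import Relation.Nullary using (¬_; Dec; yes; no; ¬?; contradiction; _×-dec_; _⊎-dec_)
  open import Relation.Binary.PropositionalEquality
  open import Relation.Binary.Definitions using (tri<; tri≈; tri>)
  open import Function using (_∘_; case_of_)
  open import Relation.Nullary.Decidable using (decidable-stable)

  norm : ∀ {n} → ℤ^ n → ℕ
  norm []      = 0
  norm (a ∷ v) = ∣ a ∣ ℕ.+ norm v

  -- In dimension at least 2 these turn out to be the vectors of length at most `k`: even norm
  -- places `v` in the lattice, and a generator has norm 2 and entries at most 1.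
  Ball : ∀ {n} → ℕ → ℤ^ n → Set
  Ball k v = ℕ.parity (norm v) ≡ 0ℙ × norm v ≤ k ℕ.+ k × (∀ i → ∣ lookup v i ∣ ≤ k)

  0ᵛ : ∀ {n} → ℤ^ n
  0ᵛ {n} = replicate n 0ℤ

  norm-0ᵛ : ∀ n → norm (0ᵛ {n}) ≡ 0
  norm-0ᵛ zero    = refl
  norm-0ᵛ (suc n) = norm-0ᵛ n

  norm-⊕ : ∀ {n} (u v : ℤ^ n) → norm (u ⊕ v) ≤ norm u ℕ.+ norm v
  norm-⊕ []      []      = z≤n
  norm-⊕ (a ∷ u) (b ∷ v) = begin
    ∣ a ℤ.+ b ∣ ℕ.+ norm (u ⊕ v)                   ≤⟨ ℕₚ.+-mono-≤ (ℤₚ.∣i+j∣≤∣i∣+∣j∣ a b) (norm-⊕ u v) ⟩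
    (∣ a ∣ ℕ.+ ∣ b ∣) ℕ.+ (norm u ℕ.+ norm v)      ≡⟨ eq (∣ a ∣) (∣ b ∣) (norm u) (norm v) ⟩
    (∣ a ∣ ℕ.+ norm u) ℕ.+ (∣ b ∣ ℕ.+ norm v)      ∎
    where
    open ℕₚ.≤-Reasoning
    eq : ∀ a b c d → (a ℕ.+ b) ℕ.+ (c ℕ.+ d) ≡ (a ℕ.+ c) ℕ.+ (b ℕ.+ d)
    eq = solveℕ

  suc-flip : ∀ {m n} → ℕ.parity m ≡ ℕ.parity n → ℕ.parity (suc m) ≡ ℕ.parity (suc n)
  suc-flip {m} {n} eq = trans (ℙₚ.+-homo-+ 1 m) (trans (cong (ℙ._+_ 1ℙ) eq) (sym (ℙₚ.+-homo-+ 1 n)))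

  parity-⊖ : ∀ m n → ℕ.parity ∣ m ℤ.⊖ n ∣ ≡ ℕ.parity (m ℕ.+ n)
  parity-⊖ zero    n       = cong ℕ.parity (ℤₚ.∣⊖∣-≤ {0} {n} z≤n)
  parity-⊖ (suc m) zero    = cong ℕ.parity (sym (ℕₚ.+-identityʳ (suc m)))
  parity-⊖ (suc m) (suc n) = trans (cong (ℕ.parity ∘ ∣_∣) (ℤₚ.[1+m]⊖[1+n]≡m⊖n m n))
    (trans (parity-⊖ m n) (cong (ℕ.parity ∘ suc) (sym (ℕₚ.+-suc m n))))

  parity-∣+∣ : ∀ a b → ℕ.parity ∣ a ℤ.+ b ∣ ≡ ℕ.parity (∣ a ∣ ℕ.+ ∣ b ∣)
  parity-∣+∣ (+ m)    (+ n)    = refl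
  parity-∣+∣ (+ m)    -[1+ n ] = parity-⊖ m (suc n)
  parity-∣+∣ -[1+ m ] (+ n)    = trans (parity-⊖ n (suc m)) (cong ℕ.parity (ℕₚ.+-comm n (suc m)))
  parity-∣+∣ -[1+ m ] -[1+ n ] = cong (ℕ.parity ∘ suc) (sym (ℕₚ.+-suc m n))

  parity-+-cong : ∀ {a b c d} → ℕ.parity a ≡ ℕ.parity c → ℕ.parity b ≡ ℕ.parity d → ℕ.parity (a ℕ.+ b) ≡ ℕ.parity (c ℕ.+ d)
  parity-+-cong {a} {b} {c} {d} p q = trans (ℙₚ.+-homo-+ a b) (trans (cong₂ ℙ._+_ p q) (sym (ℙₚ.+-homo-+ c d)))

  parity-⊕ : ∀ {n} (u v : ℤ^ n) → ℕ.parity (norm (u ⊕ v)) ≡ ℕ.parity (norm u ℕ.+ norm v)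
  parity-⊕ []      []      = refl
  parity-⊕ (a ∷ u) (b ∷ v) = trans (parity-+-cong {∣ a ℤ.+ b ∣} {norm (u ⊕ v)} {∣ a ∣ ℕ.+ ∣ b ∣} {norm u ℕ.+ norm v} (parity-∣+∣ a b) (parity-⊕ u v))
    (cong ℕ.parity (eq (∣ a ∣) (∣ b ∣) (norm u) (norm v)))
    where
    eq : ∀ a b c d → (a ℕ.+ b) ℕ.+ (c ℕ.+ d) ≡ (a ℕ.+ c) ℕ.+ (b ℕ.+ d)
    eq = solveℕ

  norm-• : ∀ {n} a (v : ℤ^ n) → norm (a • v) ≡ ∣ a ∣ ℕ.* norm v
  norm-• a []      = sym (ℕₚ.*-zeroʳ ∣ a ∣)
  norm-• a (b ∷ v) = trans (cong₂ ℕ._+_ (ℤₚ.abs-* a b) (norm-• a v)) (sym (ℕₚ.*-distribˡ-+ (∣ a ∣) (∣ b ∣) (norm v)))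

  lookup-⊕ : ∀ {n} (u v : ℤ^ n) i → lookup (u ⊕ v) i ≡ lookup u i ℤ.+ lookup v i
  lookup-⊕ u v i = Vecₚ.lookup-zipWith ℤ._+_ i u v

  lookup-• : ∀ {n} a (v : ℤ^ n) i → lookup (a • v) i ≡ a ℤ.* lookup v i
  lookup-• a v i = Vecₚ.lookup-map i (a ℤ.*_) v

  ⊕-comm : ∀ {n} (u v : ℤ^ n) → u ⊕ v ≡ v ⊕ u
  ⊕-comm = Vecₚ.zipWith-comm ℤₚ.+-comm

  ⊕-assoc : ∀ {n} (u v w : ℤ^ n) → (u ⊕ v) ⊕ w ≡ u ⊕ (v ⊕ w)
  ⊕-assoc = Vecₚ.zipWith-assoc ℤₚ.+-assoc

  •-distribʳ : ∀ {n} a b (v : ℤ^ n) → (a ℤ.+ b) • v ≡ a • v ⊕ b • v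
  •-distribʳ a b []      = refl
  •-distribʳ a b (x ∷ v) = cong₂ _∷_ (ℤₚ.*-distribʳ-+ x a b) (•-distribʳ a b v)

  •-zeroˡ : ∀ {n} (v w : ℤ^ n) → 0ℤ • v ⊕ w ≡ w
  •-zeroˡ []      []      = refl
  •-zeroˡ (x ∷ v) (y ∷ w) = cong₂ _∷_ (ℤₚ.+-identityˡ y) (•-zeroˡ v w)

  •-identityˡ : ∀ {n} (v : ℤ^ n) → 1ℤ • v ≡ v
  •-identityˡ []      = refl
  •-identityˡ (x ∷ v) = cong₂ _∷_ (ℤₚ.*-identityˡ x) (•-identityˡ v)

  •0ᵛ-⊕ : ∀ {n} a (v : ℤ^ n) → a • 0ᵛ ⊕ v ≡ v
  •0ᵛ-⊕ a []      = refl
  •0ᵛ-⊕ a (x ∷ v) = cong₂ _∷_ (trans (cong (ℤ._+ x) (ℤₚ.*-zeroʳ a)) (ℤₚ.+-identityˡ x)) (•0ᵛ-⊕ a v)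

  •e-⊕ : ∀ {n} a (i : Fin n) v → a • e i ⊕ v ≡ v [ i ]≔ (a ℤ.+ lookup v i)
  •e-⊕ a zero    (x ∷ v) = cong₂ _∷_ (cong (ℤ._+ x) (ℤₚ.*-identityʳ a)) (•0ᵛ-⊕ a v)
  •e-⊕ a (suc i) (x ∷ v) = cong₂ _∷_ (trans (cong (ℤ._+ x) (ℤₚ.*-zeroʳ a)) (ℤₚ.+-identityˡ x)) (•e-⊕ a i v)

  norm-update : ∀ {n} (v : ℤ^ n) i a → norm (v [ i ]≔ a) ℕ.+ ∣ lookup v i ∣ ≡ norm v ℕ.+ ∣ a ∣
  norm-update (x ∷ v) zero a = eq (∣ a ∣) (norm v) (∣ x ∣)
    where
    eq : ∀ a n x → (a ℕ.+ n) ℕ.+ x ≡ (x ℕ.+ n) ℕ.+ a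
    eq = solveℕ
  norm-update (x ∷ v) (suc i) a = trans (ℕₚ.+-assoc (∣ x ∣) (norm (v [ i ]≔ a)) (∣ lookup v i ∣))
    (trans (cong (∣ x ∣ ℕ.+_) (norm-update v i a)) (sym (ℕₚ.+-assoc (∣ x ∣) (norm v) (∣ a ∣))))

  lookup-0ᵛ : ∀ {n} (i : Fin n) → lookup 0ᵛ i ≡ 0ℤ
  lookup-0ᵛ i = Vecₚ.lookup-replicate i 0ℤ

  norm-e : ∀ {n} (i : Fin n) → norm (e i) ≡ 1
  norm-e {n} i = ℕₚ.+-cancelʳ-≡ 0 (norm (e i)) 1 (begin
    norm (e i) ℕ.+ 0                    ≡⟨ cong (λ x → norm (e i) ℕ.+ ∣ x ∣) (lookup-0ᵛ i) ⟨
    norm (e i) ℕ.+ ∣ lookup 0ᵛ i ∣      ≡⟨ norm-update 0ᵛ i 1ℤ ⟩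
    norm (0ᵛ {n}) ℕ.+ 1                 ≡⟨ cong (ℕ._+ 1) (norm-0ᵛ n) ⟩
    1 ∎)
    where open ≡-Reasoning

  lookup-e-≢ : ∀ {n} {i j : Fin n} → i ≢ j → lookup (e j) i ≡ 0ℤ
  lookup-e-≢ {i = i} {j} i≢j = trans (Vecₚ.lookup∘updateAt′ i j i≢j 0ᵛ) (lookup-0ᵛ i)

  lookup≤norm : ∀ {n} (v : ℤ^ n) i → ∣ lookup v i ∣ ≤ norm v
  lookup≤norm v i = ℕₚ.m+n≤o⇒n≤o (norm (v [ i ]≔ 0ℤ)) (ℕₚ.≤-reflexive (trans (norm-update v i 0ℤ) (ℕₚ.+-identityʳ (norm v))))

  -- Generators and the lower bound on length.

  Generator : ∀ {n} → ℤ^ n → Set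
  Generator m = norm m ≡ 2 × (∀ i → ∣ lookup m i ∣ ≤ 1)

  generator : ∀ {n} a b {i j : Fin n} → ∣ a ∣ ≡ 1 → ∣ b ∣ ≡ 1 → i ≢ j → Generator (a • e i ⊕ b • e j)
  generator {n} a b {i} {j} ∣a∣≡1 ∣b∣≡1 i≢j = subst Generator (sym m≡) (norm≡2 , entries)
    where
    u : ℤ^ n
    u = b • e j
    uᵢ≡0 : lookup u i ≡ 0ℤ
    uᵢ≡0 = trans (lookup-• b (e j) i) (trans (cong (b ℤ.*_) (lookup-e-≢ i≢j)) (ℤₚ.*-zeroʳ b))
    m≡ : a • e i ⊕ u ≡ u [ i ]≔ a
    m≡ = trans (•e-⊕ a i u) (cong (u [ i ]≔_) (trans (cong (λ x → a ℤ.+ x) uᵢ≡0) (ℤₚ.+-identityʳ a)))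
    norm-u : norm u ≡ 1
    norm-u = trans (norm-• b (e j)) (cong₂ ℕ._*_ ∣b∣≡1 (norm-e j))
    norm≡2 : norm (u [ i ]≔ a) ≡ 2
    norm≡2 = trans (sym (ℕₚ.+-identityʳ _)) (trans (cong (λ x → norm (u [ i ]≔ a) ℕ.+ ∣ x ∣) (sym uᵢ≡0))
      (trans (norm-update u i a) (cong₂ ℕ._+_ norm-u ∣a∣≡1)))
    entries : ∀ l → ∣ lookup (u [ i ]≔ a) l ∣ ≤ 1
    entries l with l Finₚ.≟ i
    ... | yes refl = ℕₚ.≤-reflexive (trans (cong ∣_∣ (Vecₚ.lookup∘updateAt i u)) ∣a∣≡1)
    ... | no l≢i = subst₂ _≤_ (cong ∣_∣ (sym (Vecₚ.lookup∘updateAt′ l i l≢i u))) norm-u (lookup≤norm u l)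

  orderedPairs : ∀ n → List (Fin n × Fin n)
  orderedPairs n = List.filter (λ (i , j) → i Finₚ.<? j) (List.cartesianProduct (List.allFin n) (List.allFin n))

  M-D-generators : ∀ n → All Generator (M-D n)
  M-D-generators n = All.tabulate λ m∈ → case find (∈-concatMap⁻ _ {xs = orderedPairs n} m∈) of λ
    { ((i , j) , ij∈ , m∈signs) → lemma i j (proj₂ (∈-filter⁻ (λ (i , j) → i Finₚ.<? j) {xs = List.cartesianProduct (List.allFin n) (List.allFin n)} ij∈)) m∈signs }
    where
    lemma : ∀ i j {m} → i Fin.< j →
      m ∈ (1ℤ • e i ⊕ 1ℤ • e j) ∷ (1ℤ • e i ⊕ -1ℤ • e j) ∷ (-1ℤ • e i ⊕ 1ℤ • e j) ∷ (-1ℤ • e i ⊕ -1ℤ • e j) ∷ [] → Generator m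
    lemma i j i<j (here refl)                         = generator 1ℤ 1ℤ refl refl (Finₚ.<⇒≢ i<j)
    lemma i j i<j (there (here refl))                 = generator 1ℤ -1ℤ refl refl (Finₚ.<⇒≢ i<j)
    lemma i j i<j (there (there (here refl)))         = generator -1ℤ 1ℤ refl refl (Finₚ.<⇒≢ i<j)
    lemma i j i<j (there (there (there (here refl)))) = generator -1ℤ -1ℤ refl refl (Finₚ.<⇒≢ i<j)

  data IsSign : ℤ → Set where
    plus  : IsSign 1ℤ
    minus : IsSign -1ℤ

  ∣sign∣≡1 : ∀ {a} → IsSign a → ∣ a ∣ ≡ 1
  ∣sign∣≡1 plus  = refl
  ∣sign∣≡1 minus = refl

  ∈-M-D-< : ∀ {n a b} {i j : Fin n} → IsSign a → IsSign b → i Fin.< j → a • e i ⊕ b • e j ∈ M-D n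
  ∈-M-D-< {n} {i = i} {j} a± b± i<j = ∈-concatMap⁺ _ (lose (∈-filter⁺ (λ (i , j) → i Finₚ.<? j)
    (∈-cartesianProduct⁺ (∈-allFin i) (∈-allFin j)) i<j) (position a± b±))
    where
    position : ∀ {a b} → IsSign a → IsSign b → a • e i ⊕ b • e j ∈
      (1ℤ • e i ⊕ 1ℤ • e j) ∷ (1ℤ • e i ⊕ -1ℤ • e j) ∷ (-1ℤ • e i ⊕ 1ℤ • e j) ∷ (-1ℤ • e i ⊕ -1ℤ • e j) ∷ []
    position plus  plus  = here refl
    position plus  minus = there (here refl)
    position minus plus  = there (there (here refl))
    position minus minus = there (there (there (here refl)))

  ∈-M-D : ∀ {n a b} {i j : Fin n} → IsSign a → IsSign b → i ≢ j → a • e i ⊕ b • e j ∈ M-D n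
  ∈-M-D {n} {a} {b} {i} {j} a± b± i≢j with Finₚ.<-cmp i j
  ... | tri< i<j _ _ = ∈-M-D-< a± b± i<j
  ... | tri≈ _ i≡j _ = contradiction i≡j i≢j
  ... | tri> _ _ j<i = subst (_∈ M-D n) (⊕-comm (b • e j) (a • e i)) (∈-M-D-< b± a± j<i)

  Ball-⊕ : ∀ {n k l} (u v : ℤ^ n) → Ball k u → Ball l v → Ball (k ℕ.+ l) (u ⊕ v)
  Ball-⊕ {k = k} {l} u v (pu , nu , mu) (pv , nv , mv) =
    trans (parity-⊕ u v) (parity-+-cong {norm u} {norm v} {0} {0} pu pv) ,
    (begin
      norm (u ⊕ v)                         ≤⟨ norm-⊕ u v ⟩
      norm u ℕ.+ norm v                    ≤⟨ ℕₚ.+-mono-≤ nu nv ⟩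
      (k ℕ.+ k) ℕ.+ (l ℕ.+ l)              ≡⟨ eq k l ⟩
      (k ℕ.+ l) ℕ.+ (k ℕ.+ l)              ∎) ,
    (λ i → begin
      ∣ lookup (u ⊕ v) i ∣                 ≡⟨ cong ∣_∣ (lookup-⊕ u v i) ⟩
      ∣ lookup u i ℤ.+ lookup v i ∣        ≤⟨ ℤₚ.∣i+j∣≤∣i∣+∣j∣ (lookup u i) (lookup v i) ⟩
      ∣ lookup u i ∣ ℕ.+ ∣ lookup v i ∣    ≤⟨ ℕₚ.+-mono-≤ (mu i) (mv i) ⟩
      k ℕ.+ l                              ∎)
    where
    open ℕₚ.≤-Reasoning
    eq : ∀ k l → (k ℕ.+ k) ℕ.+ (l ℕ.+ l) ≡ (k ℕ.+ l) ℕ.+ (k ℕ.+ l)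
    eq = solveℕ

  Ball-• : ∀ {n} k (m : ℤ^ n) → Generator m → Ball k ((+ k) • m)
  Ball-• k m (norm≡2 , entries) =
    trans (cong ℕ.parity norm≡) (trans (ℙₚ.+-homo-+ k k) (ℙₚ.p+p≡0ℙ (ℕ.parity k))) ,
    ℕₚ.≤-reflexive norm≡ ,
    (λ i → begin
      ∣ lookup ((+ k) • m) i ∣   ≡⟨ cong ∣_∣ (lookup-• (+ k) m i) ⟩
      ∣ + k ℤ.* lookup m i ∣     ≡⟨ ℤₚ.abs-* (+ k) (lookup m i) ⟩
      k ℕ.* ∣ lookup m i ∣       ≤⟨ ℕₚ.*-monoʳ-≤ k (entries i) ⟩
      k ℕ.* 1                    ≡⟨ ℕₚ.*-identityʳ k ⟩
      k                          ∎)
    where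
    open ℕₚ.≤-Reasoning
    norm≡ : norm ((+ k) • m) ≡ k ℕ.+ k
    norm≡ = trans (norm-• (+ k) m) (trans (cong (k ℕ.*_) norm≡2) (eq k))
      where
      eq : ∀ k → k ℕ.* 2 ≡ k ℕ.+ k
      eq = solveℕ

  Ball-0ᵛ : ∀ {n} → Ball 0 (0ᵛ {n})
  Ball-0ᵛ {n} = cong ℕ.parity (norm-0ᵛ n) , ℕₚ.≤-reflexive (norm-0ᵛ n) ,
    λ i → ℕₚ.≤-reflexive (cong ∣_∣ (lookup-0ᵛ i))

  -- Each use of a generator preserves the parity of the norm, raises the norm by at most 2 and each
  -- entry by at most 1.
  combination-Ball : ∀ {n} (M : List (ℤ^ n)) → All Generator M → ∀ c → Ball (sumℕ c) (combination M c)
  combination-Ball []      []        c = Ball-0ᵛ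
  combination-Ball (m ∷ M) (gen ∷ gens) c =
    Ball-⊕ ((+ c zero) • m) (combination M (c ∘ suc)) (Ball-• (c zero) m gen) (combination-Ball M gens (c ∘ suc))

  Sum : ∀ {n} → List (ℤ^ n) → ℤ^ n → ℕ → Set
  Sum M v s = ∃[ c ] (combination M c ≡ v × sumℕ c ≡ s)

  Sum-0ᵛ : ∀ {n} (M : List (ℤ^ n)) → Sum M 0ᵛ 0
  Sum-0ᵛ []      = (λ ()) , refl , refl
  Sum-0ᵛ (m ∷ M) with Sum-0ᵛ M
  ... | c , comb , sum = 0 Vector.∷ c , trans (•-zeroˡ m (combination M c)) comb , sum

  Sum-⊕ : ∀ {n} {M : List (ℤ^ n)} {m v s} → m ∈ M → Sum M v s → Sum M (m ⊕ v) (suc s)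
  Sum-⊕ {M = m ∷ M} (here refl) (c , refl , refl) = suc (c zero) Vector.∷ (c ∘ suc) , (begin
      (+ suc (c zero)) • m ⊕ combination M (c ∘ suc)
        ≡⟨ cong (_⊕ combination M (c ∘ suc)) (•-distribʳ 1ℤ (+ c zero) m) ⟩
      (1ℤ • m ⊕ (+ c zero) • m) ⊕ combination M (c ∘ suc)
        ≡⟨ cong (λ u → (u ⊕ (+ c zero) • m) ⊕ combination M (c ∘ suc)) (•-identityˡ m) ⟩
      (m ⊕ (+ c zero) • m) ⊕ combination M (c ∘ suc)
        ≡⟨ ⊕-assoc m ((+ c zero) • m) (combination M (c ∘ suc)) ⟩
      m ⊕ ((+ c zero) • m ⊕ combination M (c ∘ suc)) ∎) , refl
    where open ≡-Reasoning
  Sum-⊕ {M = m′ ∷ M} {m} (there m∈M) (c , refl , refl) with Sum-⊕ m∈M (c ∘ suc , refl , refl)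
  ... | c′ , comb , sum = c zero Vector.∷ c′ , (begin
      (+ c zero) • m′ ⊕ combination M c′
        ≡⟨ cong ((+ c zero) • m′ ⊕_) comb ⟩
      (+ c zero) • m′ ⊕ (m ⊕ combination M (c ∘ suc))
        ≡⟨ ⊕-assoc ((+ c zero) • m′) m (combination M (c ∘ suc)) ⟨
      ((+ c zero) • m′ ⊕ m) ⊕ combination M (c ∘ suc)
        ≡⟨ cong (_⊕ combination M (c ∘ suc)) (⊕-comm ((+ c zero) • m′) m) ⟩
      (m ⊕ (+ c zero) • m′) ⊕ combination M (c ∘ suc)
        ≡⟨ ⊕-assoc m ((+ c zero) • m′) (combination M (c ∘ suc)) ⟩
      m ⊕ ((+ c zero) • m′ ⊕ combination M (c ∘ suc)) ∎) ,
    trans (cong (c zero ℕ.+_) sum) (ℕₚ.+-suc (c zero) (sumℕ (c ∘ suc)))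
    where open ≡-Reasoning

  -- Descent: writing a vector of the ball as a short sum.

  parity-double : ∀ k → ℕ.parity (k ℕ.+ k) ≡ 0ℙ
  parity-double k = trans (ℙₚ.+-homo-+ k k) (ℙₚ.p+p≡0ℙ (ℕ.parity k))

  -- A zero entry has to move away from 0. That case serves vectors with only one nonzero
  -- coordinate, since a generator always changes two.
  towards-0 : ∀ x → ∃[ a ] ∃[ y ] (IsSign a × x ≡ a ℤ.+ y × (∣ x ∣ ≡ suc ∣ y ∣ ⊎ ∣ x ∣ ≡ 0 × ∣ y ∣ ≡ 1))
  towards-0 (+ zero)       = 1ℤ , -1ℤ , plus , refl , inj₂ (refl , refl)
  towards-0 (+ suc m)      = 1ℤ , + m , plus , refl , inj₁ refl
  towards-0 -[1+ zero ]    = -1ℤ , + 0 , minus , refl , inj₁ refl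
  towards-0 -[1+ suc m ]   = -1ℤ , -[1+ m ] , minus , refl , inj₁ refl

  update-split : ∀ {n} (v : ℤ^ n) i a y → lookup v i ≡ a ℤ.+ y → v ≡ a • e i ⊕ (v [ i ]≔ y)
  update-split v i a y vᵢ≡ = sym (begin
    a • e i ⊕ (v [ i ]≔ y)                                   ≡⟨ •e-⊕ a i (v [ i ]≔ y) ⟩
    (v [ i ]≔ y) [ i ]≔ (a ℤ.+ lookup (v [ i ]≔ y) i)        ≡⟨ Vecₚ.[]≔-idempotent v i ⟩
    v [ i ]≔ (a ℤ.+ lookup (v [ i ]≔ y) i)                   ≡⟨ cong (λ z → v [ i ]≔ (a ℤ.+ z)) (Vecₚ.lookup∘update i v y) ⟩
    v [ i ]≔ (a ℤ.+ y)                                       ≡⟨ cong (v [ i ]≔_) vᵢ≡ ⟨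
    v [ i ]≔ lookup v i                                      ≡⟨ Vecₚ.[]≔-lookup v i ⟩
    v                                                        ∎)
    where open ≡-Reasoning

  norm-erase : ∀ {n} (v : ℤ^ n) i → norm (v [ i ]≔ 0ℤ) ℕ.+ ∣ lookup v i ∣ ≡ norm v
  norm-erase v i = trans (norm-update v i 0ℤ) (ℕₚ.+-identityʳ (norm v))

  two≤norm : ∀ {n} (v : ℤ^ n) {i j} → j ≢ i → ∣ lookup v j ∣ ℕ.+ ∣ lookup v i ∣ ≤ norm v
  two≤norm v {i} {j} j≢i = begin
    ∣ lookup v j ∣ ℕ.+ ∣ lookup v i ∣                  ≡⟨ cong (λ z → ∣ z ∣ ℕ.+ ∣ lookup v i ∣) (Vecₚ.lookup∘update′ j≢i v 0ℤ) ⟨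
    ∣ lookup (v [ i ]≔ 0ℤ) j ∣ ℕ.+ ∣ lookup v i ∣      ≤⟨ ℕₚ.+-monoˡ-≤ (∣ lookup v i ∣) (lookup≤norm (v [ i ]≔ 0ℤ) j) ⟩
    norm (v [ i ]≔ 0ℤ) ℕ.+ ∣ lookup v i ∣              ≡⟨ norm-erase v i ⟩
    norm v                                             ∎
    where open ℕₚ.≤-Reasoning

  three≤norm : ∀ {n} (v : ℤ^ n) {i j l} → j ≢ i → l ≢ i → l ≢ j → ∣ lookup v l ∣ ℕ.+ ∣ lookup v j ∣ ℕ.+ ∣ lookup v i ∣ ≤ norm v
  three≤norm v {i} {j} {l} j≢i l≢i l≢j = begin
    ∣ lookup v l ∣ ℕ.+ ∣ lookup v j ∣ ℕ.+ ∣ lookup v i ∣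
      ≡⟨ cong₂ (λ y z → ∣ y ∣ ℕ.+ ∣ z ∣ ℕ.+ ∣ lookup v i ∣) (Vecₚ.lookup∘update′ l≢i v 0ℤ) (Vecₚ.lookup∘update′ j≢i v 0ℤ) ⟨
    ∣ lookup (v [ i ]≔ 0ℤ) l ∣ ℕ.+ ∣ lookup (v [ i ]≔ 0ℤ) j ∣ ℕ.+ ∣ lookup v i ∣
      ≤⟨ ℕₚ.+-monoˡ-≤ (∣ lookup v i ∣) (two≤norm (v [ i ]≔ 0ℤ) l≢j) ⟩
    norm (v [ i ]≔ 0ℤ) ℕ.+ ∣ lookup v i ∣
      ≡⟨ norm-erase v i ⟩
    norm v ∎
    where open ℕₚ.≤-Reasoning

  norm≡0 : ∀ {n} (v : ℤ^ n) → (∀ i → ∣ lookup v i ∣ ≡ 0) → norm v ≡ 0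
  norm≡0 []      v≡0 = refl
  norm≡0 (x ∷ v) v≡0 = cong₂ ℕ._+_ (v≡0 zero) (norm≡0 v (v≡0 ∘ suc))

  norm-single : ∀ {n} (v : ℤ^ n) i → (∀ j → j ≢ i → ∣ lookup v j ∣ ≡ 0) → norm v ≡ ∣ lookup v i ∣
  norm-single v i v≡0 = trans (sym (norm-erase v i)) (cong (ℕ._+ ∣ lookup v i ∣) (norm≡0 (v [ i ]≔ 0ℤ) zeros))
    where
    zeros : ∀ j → ∣ lookup (v [ i ]≔ 0ℤ) j ∣ ≡ 0
    zeros j with j Finₚ.≟ i
    ... | yes refl = cong ∣_∣ (Vecₚ.lookup∘update i v 0ℤ)
    ... | no j≢i = trans (cong ∣_∣ (Vecₚ.lookup∘update′ j≢i v 0ℤ)) (v≡0 j j≢i)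

  Descent : ∀ {n} → ℕ → ℤ^ n → Set
  Descent {n} k v = ∃[ m ] ∃[ v′ ] (m ∈ M-D n × v ≡ m ⊕ v′ × Ball k v′)

  even-remainder : ∀ {n} (m v : ℤ^ n) → Generator m → ℕ.parity (norm (m ⊕ v)) ≡ 0ℙ → ℕ.parity (norm v) ≡ 0ℙ
  even-remainder m v (norm≡2 , _) even-sum =
    trans (sym (parity-+-cong {norm m} {norm v} {0} {norm v} (cong ℕ.parity norm≡2) refl)) (trans (sym (parity-⊕ m v)) even-sum)

  -- Subtract `a e i + b e j`. The last hypothesis bounds the new norm by `2k`, with the old entries
  -- moved to the other side to avoid truncated subtraction.
  descend : ∀ {n} k (v : ℤ^ n) i j {a b y z} → j ≢ i → ℕ.parity (norm v) ≡ 0ℙ →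
    IsSign a → lookup v i ≡ a ℤ.+ y → IsSign b → lookup v j ≡ b ℤ.+ z →
    ∣ y ∣ ≤ k → ∣ z ∣ ≤ k → (∀ l → l ≢ i → l ≢ j → ∣ lookup v l ∣ ≤ k) →
    norm v ℕ.+ (∣ y ∣ ℕ.+ ∣ z ∣) ≤ (k ℕ.+ k) ℕ.+ (∣ lookup v i ∣ ℕ.+ ∣ lookup v j ∣) → Descent k v
  descend {n} k v i j {a} {b} {y} {z} j≢i even-v a± vᵢ≡ b± vⱼ≡ y≤k z≤k others≤k norm≤ =
    m , v″ , ∈-M-D a± b± (j≢i ∘ sym) , v≡ , parity″ , norm″ , entries
    where
    v′ v″ m : ℤ^ n
    v′ = v [ i ]≔ y
    v″ = v′ [ j ]≔ z
    m = a • e i ⊕ b • e j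
    v′ⱼ≡ : lookup v′ j ≡ lookup v j
    v′ⱼ≡ = Vecₚ.lookup∘update′ j≢i v y
    v≡ : v ≡ m ⊕ v″
    v≡ = trans (update-split v i a y vᵢ≡)
      (trans (cong (a • e i ⊕_) (update-split v′ j b z (trans v′ⱼ≡ vⱼ≡))) (sym (⊕-assoc (a • e i) (b • e j) v″)))
    parity″ : ℕ.parity (norm v″) ≡ 0ℙ
    parity″ = even-remainder m v″ (generator a b (∣sign∣≡1 a±) (∣sign∣≡1 b±) (j≢i ∘ sym)) (trans (cong (ℕ.parity ∘ norm) (sym v≡)) even-v)
    norm-eq : norm v″ ℕ.+ (∣ lookup v i ∣ ℕ.+ ∣ lookup v j ∣) ≡ norm v ℕ.+ (∣ y ∣ ℕ.+ ∣ z ∣)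
    norm-eq = begin
      norm v″ ℕ.+ (∣ lookup v i ∣ ℕ.+ ∣ lookup v j ∣)
        ≡⟨ cong (λ x → norm v″ ℕ.+ (∣ lookup v i ∣ ℕ.+ ∣ x ∣)) v′ⱼ≡ ⟨
      norm v″ ℕ.+ (∣ lookup v i ∣ ℕ.+ ∣ lookup v′ j ∣)
        ≡⟨ swap (norm v″) (∣ lookup v i ∣) (∣ lookup v′ j ∣) ⟩
      norm v″ ℕ.+ ∣ lookup v′ j ∣ ℕ.+ ∣ lookup v i ∣
        ≡⟨ cong (ℕ._+ ∣ lookup v i ∣) (norm-update v′ j z) ⟩
      norm v′ ℕ.+ ∣ z ∣ ℕ.+ ∣ lookup v i ∣
        ≡⟨ swap′ (norm v′) (∣ z ∣) (∣ lookup v i ∣) ⟩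
      norm v′ ℕ.+ ∣ lookup v i ∣ ℕ.+ ∣ z ∣
        ≡⟨ cong (ℕ._+ ∣ z ∣) (norm-update v i y) ⟩
      norm v ℕ.+ ∣ y ∣ ℕ.+ ∣ z ∣
        ≡⟨ ℕₚ.+-assoc (norm v) (∣ y ∣) (∣ z ∣) ⟩
      norm v ℕ.+ (∣ y ∣ ℕ.+ ∣ z ∣) ∎
      where
      open ≡-Reasoning
      swap : ∀ a b c → a ℕ.+ (b ℕ.+ c) ≡ a ℕ.+ c ℕ.+ b
      swap = solveℕ
      swap′ : ∀ a b c → a ℕ.+ b ℕ.+ c ≡ a ℕ.+ c ℕ.+ b
      swap′ = solveℕ
    norm″ : norm v″ ≤ k ℕ.+ k
    norm″ = ℕₚ.+-cancelʳ-≤ (∣ lookup v i ∣ ℕ.+ ∣ lookup v j ∣) (norm v″) (k ℕ.+ k) (ℕₚ.≤-trans (ℕₚ.≤-reflexive norm-eq) norm≤)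
    entries : ∀ l → ∣ lookup v″ l ∣ ≤ k
    entries l with l Finₚ.≟ j
    ... | yes refl = subst (λ x → ∣ x ∣ ≤ k) (sym (Vecₚ.lookup∘update j v′ z)) z≤k
    ... | no l≢j with l Finₚ.≟ i
    ...   | yes refl = subst (λ x → ∣ x ∣ ≤ k) (sym (trans (Vecₚ.lookup∘update′ l≢j v′ z) (Vecₚ.lookup∘update i v y))) y≤k
    ...   | no l≢i = subst (λ x → ∣ x ∣ ≤ k) (sym (trans (Vecₚ.lookup∘update′ l≢j v′ z) (Vecₚ.lookup∘update′ l≢i v y))) (others≤k l l≢i l≢j)

  descend-nonzero : ∀ {n} k (v : ℤ^ n) i j → j ≢ i → Ball (suc k) v →
    ∣ lookup v i ∣ ≢ 0 → ∣ lookup v j ∣ ≢ 0 → (∀ l → l ≢ i → l ≢ j → ∣ lookup v l ∣ ≤ k) → Descent k v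
  descend-nonzero k v i j j≢i (even-v , norm≤ , entries≤) vᵢ≢0 vⱼ≢0 others≤k
    with towards-0 (lookup v i) | towards-0 (lookup v j)
  ... | _ , _ , _ , _ , inj₂ (vᵢ≡0 , _) | _ = contradiction vᵢ≡0 vᵢ≢0
  ... | _ , _ , _ , _ , inj₁ _ | _ , _ , _ , _ , inj₂ (vⱼ≡0 , _) = contradiction vⱼ≡0 vⱼ≢0
  ... | a , y , a± , vᵢ≡ , inj₁ ∣vᵢ∣≡ | b , z , b± , vⱼ≡ , inj₁ ∣vⱼ∣≡ =
    descend k v i j j≢i even-v a± vᵢ≡ b± vⱼ≡
      (ℕₚ.≤-pred (subst (_≤ suc k) ∣vᵢ∣≡ (entries≤ i))) (ℕₚ.≤-pred (subst (_≤ suc k) ∣vⱼ∣≡ (entries≤ j))) others≤k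
      (begin
        norm v ℕ.+ (∣ y ∣ ℕ.+ ∣ z ∣)                          ≤⟨ ℕₚ.+-monoˡ-≤ (∣ y ∣ ℕ.+ ∣ z ∣) norm≤ ⟩
        suc k ℕ.+ suc k ℕ.+ (∣ y ∣ ℕ.+ ∣ z ∣)                 ≡⟨ eq k (∣ y ∣) (∣ z ∣) ⟩
        (k ℕ.+ k) ℕ.+ (suc ∣ y ∣ ℕ.+ suc ∣ z ∣)               ≡⟨ cong₂ (λ p q → (k ℕ.+ k) ℕ.+ (p ℕ.+ q)) ∣vᵢ∣≡ ∣vⱼ∣≡ ⟨
        (k ℕ.+ k) ℕ.+ (∣ lookup v i ∣ ℕ.+ ∣ lookup v j ∣)     ∎)
    where
    open ℕₚ.≤-Reasoning
    eq : ∀ k y z → suc k ℕ.+ suc k ℕ.+ (y ℕ.+ z) ≡ (k ℕ.+ k) ℕ.+ (suc y ℕ.+ suc z)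
    eq = solveℕ

  -- Entry `i` drops to absolute value `k` and a unit appears at `j`, so the norm stays at `k + 1`.
  -- Since `k + 1` is even, `k ≥ 1`, and therefore `k + 1 ≤ 2k`.
  descend-single : ∀ {n} k (v : ℤ^ n) i j → j ≢ i → ℕ.parity (norm v) ≡ 0ℙ →
    ∣ lookup v i ∣ ≡ suc k → (∀ l → l ≢ i → ∣ lookup v l ∣ ≡ 0) → Descent k v
  descend-single k v i j j≢i even-v vᵢ≡1+k others≡0
    with towards-0 (lookup v i) | towards-0 (lookup v j)
  ... | _ , _ , _ , _ , inj₂ (vᵢ≡0 , _) | _ = contradiction (trans (sym vᵢ≡1+k) vᵢ≡0) (λ ())
  ... | _ , _ , _ , _ , inj₁ _ | _ , _ , _ , _ , inj₁ vⱼ≡1+ = contradiction (trans (sym (others≡0 j j≢i)) vⱼ≡1+) (λ ())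
  ... | a , y , a± , vᵢ≡ , inj₁ ∣vᵢ∣≡ | b , z , b± , vⱼ≡ , inj₂ (∣vⱼ∣≡ , ∣z∣≡1) =
    descend k v i j j≢i even-v a± vᵢ≡ b± vⱼ≡ (ℕₚ.≤-reflexive ∣y∣≡k) (ℕₚ.≤-trans (ℕₚ.≤-reflexive ∣z∣≡1) 1≤k)
      (λ l l≢i _ → subst (_≤ k) (sym (others≡0 l l≢i)) z≤n)
      (begin
        norm v ℕ.+ (∣ y ∣ ℕ.+ ∣ z ∣)                          ≡⟨ cong₂ ℕ._+_ norm≡1+k (cong₂ ℕ._+_ ∣y∣≡k ∣z∣≡1) ⟩
        suc k ℕ.+ (k ℕ.+ 1)                                   ≤⟨ ℕₚ.+-monoʳ-≤ (suc k) (ℕₚ.+-monoʳ-≤ k 1≤k) ⟩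
        suc k ℕ.+ (k ℕ.+ k)                                   ≡⟨ eq k ⟩
        (k ℕ.+ k) ℕ.+ (suc k ℕ.+ 0)                           ≡⟨ cong₂ (λ p q → (k ℕ.+ k) ℕ.+ (p ℕ.+ q)) vᵢ≡1+k (others≡0 j j≢i) ⟨
        (k ℕ.+ k) ℕ.+ (∣ lookup v i ∣ ℕ.+ ∣ lookup v j ∣)     ∎)
    where
    open ℕₚ.≤-Reasoning
    eq : ∀ k → suc k ℕ.+ (k ℕ.+ k) ≡ (k ℕ.+ k) ℕ.+ (suc k ℕ.+ 0)
    eq = solveℕ
    ∣y∣≡k : ∣ y ∣ ≡ k
    ∣y∣≡k = ℕₚ.suc-injective (trans (sym ∣vᵢ∣≡) vᵢ≡1+k)
    norm≡1+k : norm v ≡ suc k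
    norm≡1+k = trans (norm-single v i others≡0) vᵢ≡1+k
    positive : ∀ {k} → ℕ.parity (suc k) ≡ 0ℙ → 1 ≤ k
    positive {suc k} _ = s≤s z≤n
    1≤k : 1 ≤ k
    1≤k = positive (trans (cong ℕ.parity (sym norm≡1+k)) even-v)

  -- Dimension at least 2 enters the length computation here: a multiple of one `e i` needs a second
  -- coordinate.
  other : ∀ {n} (i : Fin (suc (suc n))) → ∃[ j ] (j ≢ i)
  other zero    = suc zero , λ ()
  other (suc i) = zero , λ ()

  -- If some entry has absolute value `k + 1`, pair it with any other nonzero one: the norm bound
  -- `2k + 2` leaves at most `k` for a third. If all entries are at most `k` but the norm exceeds
  -- `2k`, two nonzero entries exist, because a single one would have norm at most `k`; any two will
  -- do.
  step : ∀ {n} k (v : ℤ^ (suc (suc n))) → Ball (suc k) v → Ball k v ⊎ Descent k v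
  step k v ball@(even-v , norm≤ , entries≤) with Finₚ.any? (λ i → ∣ lookup v i ∣ ℕ.≟ suc k)
  ... | yes (i , vᵢ≡1+k) with Finₚ.any? (λ j → ¬? (j Finₚ.≟ i) ×-dec ¬? (∣ lookup v j ∣ ℕ.≟ 0))
  ...   | yes (j , j≢i , vⱼ≢0) = inj₂ (descend-nonzero k v i j j≢i ball
            (λ vᵢ≡0 → contradiction (trans (sym vᵢ≡1+k) vᵢ≡0) (λ ())) vⱼ≢0 others≤k)
    where
    others≤k : ∀ l → l ≢ i → l ≢ j → ∣ lookup v l ∣ ≤ k
    others≤k l l≢i l≢j = ℕₚ.≤-pred (ℕₚ.+-cancelʳ-≤ (suc k) (suc ∣ lookup v l ∣) (suc k) (begin
      suc ∣ lookup v l ∣ ℕ.+ suc k                              ≡⟨ cong (ℕ._+ suc k) (ℕₚ.+-comm (∣ lookup v l ∣) 1) ⟨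
      ∣ lookup v l ∣ ℕ.+ 1 ℕ.+ suc k                            ≤⟨ ℕₚ.+-monoˡ-≤ (suc k) (ℕₚ.+-monoʳ-≤ (∣ lookup v l ∣) (ℕₚ.n≢0⇒n>0 vⱼ≢0)) ⟩
      ∣ lookup v l ∣ ℕ.+ ∣ lookup v j ∣ ℕ.+ suc k               ≡⟨ cong (∣ lookup v l ∣ ℕ.+ ∣ lookup v j ∣ ℕ.+_) vᵢ≡1+k ⟨
      ∣ lookup v l ∣ ℕ.+ ∣ lookup v j ∣ ℕ.+ ∣ lookup v i ∣      ≤⟨ three≤norm v j≢i l≢i l≢j ⟩
      norm v                                                    ≤⟨ norm≤ ⟩
      suc k ℕ.+ suc k                                           ∎))
      where open ℕₚ.≤-Reasoning
  ...   | no none = inj₂ (descend-single k v i (proj₁ (other i)) (proj₂ (other i)) even-v vᵢ≡1+k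
            (λ l l≢i → decidable-stable (∣ lookup v l ∣ ℕ.≟ 0) (λ vₗ≢0 → none (l , l≢i , vₗ≢0))))
  step k v ball@(even-v , norm≤ , entries≤) | no none with norm v ℕ.≤? k ℕ.+ k
  ... | yes norm≤2k = inj₁ (even-v , norm≤2k , λ i → ℕₚ.≤-pred (ℕₚ.≤∧≢⇒< (entries≤ i) (λ eq → none (i , eq))))
  ... | no norm≰2k with Finₚ.any? (λ i → ¬? (∣ lookup v i ∣ ℕ.≟ 0))
  ...   | no zeros = contradiction (subst (_≤ k ℕ.+ k) (sym (norm≡0 v λ i → decidable-stable (∣ lookup v i ∣ ℕ.≟ 0) (λ vᵢ≢0 → zeros (i , vᵢ≢0)))) z≤n) norm≰2k
  ...   | yes (i , vᵢ≢0) with Finₚ.any? (λ j → ¬? (j Finₚ.≟ i) ×-dec ¬? (∣ lookup v j ∣ ℕ.≟ 0))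
  ...     | yes (j , j≢i , vⱼ≢0) = inj₂ (descend-nonzero k v i j j≢i ball vᵢ≢0 vⱼ≢0 (λ l _ _ → ℕₚ.≤-pred (ℕₚ.≤∧≢⇒< (entries≤ l) (λ eq → none (l , eq)))))
  ...     | no zeros = contradiction (begin
              norm v           ≡⟨ norm-single v i (λ l l≢i → decidable-stable (∣ lookup v l ∣ ℕ.≟ 0) (λ vₗ≢0 → zeros (l , l≢i , vₗ≢0))) ⟩
              ∣ lookup v i ∣   ≤⟨ ℕₚ.≤-pred (ℕₚ.≤∧≢⇒< (entries≤ i) (λ eq → none (i , eq))) ⟩
              k                ≤⟨ ℕₚ.m≤m+n k k ⟩
              k ℕ.+ k          ∎) norm≰2k
    where open ℕₚ.≤-Reasoning

  Ball⇒Sum : ∀ {n} k (v : ℤ^ (suc (suc n))) → Ball k v → ∃[ s ] (s ≤ k × Sum (M-D (suc (suc n))) v s)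
  Ball⇒Sum {n} zero v (_ , norm≤0 , _) = 0 , z≤n , subst (λ u → Sum (M-D (suc (suc n))) u 0) (sym (v≡0ᵛ v (ℕₚ.n≤0⇒n≡0 norm≤0))) (Sum-0ᵛ (M-D (suc (suc n))))
    where
    v≡0ᵛ : ∀ {n} (v : ℤ^ n) → norm v ≡ 0 → v ≡ 0ᵛ
    v≡0ᵛ []      eq = refl
    v≡0ᵛ (x ∷ v) eq = cong₂ _∷_ (ℤₚ.∣i∣≡0⇒i≡0 (ℕₚ.m+n≡0⇒m≡0 (∣ x ∣) eq)) (v≡0ᵛ v (ℕₚ.m+n≡0⇒n≡0 (∣ x ∣) eq))
  Ball⇒Sum (suc k) v ball with step k v ball
  ... | inj₁ ball′ with Ball⇒Sum k v ball′
  ...   | s , s≤k , sum = s , ℕₚ.m≤n⇒m≤1+n s≤k , sum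
  Ball⇒Sum (suc k) v ball | inj₂ (m , v′ , m∈ , refl , ball′) with Ball⇒Sum k v′ ball′
  ...   | s , s≤k , sum = suc s , s≤s s≤k , Sum-⊕ m∈ sum

  -- The length of a vector of Dₙ is the maximum of its largest absolute
  -- coordinate and half its 1-norm.
  Sphere : ∀ {n} → ℕ → ℤ^ n → Set
  Sphere k v = Ball k v × (norm v ≡ k ℕ.+ k ⊎ ∃[ i ] (∣ lookup v i ∣ ≡ k))

  Sphere? : ∀ {n} k (v : ℤ^ n) → Dec (Sphere k v)
  Sphere? k v = ((ℕ.parity (norm v) ℙₚ.≟ 0ℙ) ×-dec (norm v ℕ.≤? k ℕ.+ k) ×-dec Finₚ.all? (λ i → ∣ lookup v i ∣ ℕ.≤? k))
    ×-dec ((norm v ℕ.≟ k ℕ.+ k) ⊎-dec Finₚ.any? (λ i → ∣ lookup v i ∣ ℕ.≟ k))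

  double-cancel-≤ : ∀ {k l} → k ℕ.+ k ≤ l ℕ.+ l → k ≤ l
  double-cancel-≤ {k} {l} 2k≤2l = ℕₚ.≮⇒≥ (λ l<k → ℕₚ.<⇒≱ (ℕₚ.+-mono-< l<k l<k) 2k≤2l)

  Sphere⇒minimal : ∀ {n} k s (v : ℤ^ n) → Sphere k v → Ball s v → k ≤ s
  Sphere⇒minimal k s v (_ , inj₁ norm≡2k) (_ , norm≤ , _) = double-cancel-≤ (subst (_≤ s ℕ.+ s) norm≡2k norm≤)
  Sphere⇒minimal k s v (_ , inj₂ (i , vᵢ≡k)) (_ , _ , entries≤) = subst (_≤ s) vᵢ≡k (entries≤ i)

  -- If neither bound is attained, all entries are at most `k - 1`, and the norm, being even and
  -- below `2k`, is at most `2k - 2`. Then `v` is in the smaller ball and has a shorter sum.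
  -- Decidability removes the double negation.
  HasLength⇒Sphere : ∀ {n} v k → HasLength (M-D (suc (suc n))) v k → Sphere k v
  HasLength⇒Sphere {n} v k ((c , comb , sum) , minimal) = ball , decidable-stable (norm v ℕ.≟ k ℕ.+ k ⊎-dec Finₚ.any? (λ i → ∣ lookup v i ∣ ℕ.≟ k)) (inner k ball minimal)
    where
    M : List (ℤ^ (suc (suc n)))
    M = M-D (suc (suc n))
    ball : Ball k v
    ball = subst₂ Ball sum comb (combination-Ball M (M-D-generators (suc (suc n))) c)
    inner : ∀ k → Ball k v → (∀ c → combination M c ≡ v → k ≤ sumℕ c) → ¬ ¬ (norm v ≡ k ℕ.+ k ⊎ ∃[ i ] (∣ lookup v i ∣ ≡ k))
    inner zero (_ , norm≤0 , _) _ ¬sphere = ¬sphere (inj₁ (ℕₚ.n≤0⇒n≡0 norm≤0))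
    inner (suc k) (even-v , norm≤ , entries≤) minimal ¬sphere with Ball⇒Sum k v ball′
      where
      norm<1+2k : norm v < suc (suc (k ℕ.+ k))
      norm<1+2k = ℕₚ.≤∧≢⇒< (subst (norm v ≤_) (cong suc (ℕₚ.+-suc k k)) norm≤) (λ eq → ¬sphere (inj₁ (trans eq (cong suc (sym (ℕₚ.+-suc k k))))))
      norm≢1+2k : norm v ≢ suc (k ℕ.+ k)
      norm≢1+2k eq = contradiction (trans (sym even-v) (trans (cong ℕ.parity eq) (suc-flip {k ℕ.+ k} {0} (parity-double k)))) (λ ())
      ball′ : Ball k v
      ball′ = even-v , ℕₚ.≤-pred (ℕₚ.≤∧≢⇒< (ℕₚ.≤-pred norm<1+2k) norm≢1+2k) ,
        λ i → ℕₚ.≤-pred (ℕₚ.≤∧≢⇒< (entries≤ i) (λ eq → ¬sphere (inj₂ (i , eq))))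
    ... | s , s≤k , c′ , comb′ , sum′ = ℕₚ.<⇒≱ (s≤s s≤k) (subst (suc k ≤_) sum′ (minimal c′ comb′))

  Sphere⇒HasLength : ∀ {n} v k → Sphere k v → HasLength (M-D (suc (suc n))) v k
  Sphere⇒HasLength {n} v k sphere@(ball , _) with Ball⇒Sum k v ball
  ... | s , s≤k , c , comb , sum = (c , comb , ℕₚ.≤-antisym (subst (_≤ k) (sym sum) s≤k) (minimal c comb)) , minimal
    where
    minimal : ∀ c → combination (M-D (suc (suc n))) c ≡ v → k ≤ sumℕ c
    minimal c refl = Sphere⇒minimal k (sumℕ c) v sphere (combination-Ball (M-D (suc (suc n))) (M-D-generators (suc (suc n))) c)

-- Sphere sizes by summation over boxes.

module Counting where

  open import Data.Nat as ℕ using (ℕ; zero; suc; _≤_; _<_; z≤n; s≤s)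
  import Data.Nat.Properties as ℕₚ
  open import Data.Nat.Tactic.RingSolver using () renaming (solve-∀ to solveℕ)
  open import Data.Integer as ℤ using (ℤ; +_; -[1+_]; 0ℤ; 1ℤ; -1ℤ; ∣_∣; _+_; _*_; _-_)
  import Data.Integer.Properties as ℤₚ
  open import Data.Integer.Tactic.RingSolver using () renaming (solve-∀ to solveℤ)
  open import Data.Parity using (0ℙ; 1ℙ)
  import Data.Parity.Properties as ℙₚ
  open import Data.Fin using (zero; suc)
  import Data.Fin.Properties as Finₚ
  open import Data.Vec using ([]; _∷_; lookup)
  open import Data.Vec.Properties using (∷-injective)
  open import Data.List as List using (List; []; _∷_; length; map; _++_; cartesianProductWith)
  open import Data.List.Membership.Propositional using (_∈_)
  open import Data.List.Membership.Propositional.Properties using (∈-filter⁺; ∈-filter⁻; ∈-cartesianProductWith⁺)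
  open import Data.List.Relation.Unary.Any using (here; there)
  open import Data.List.Relation.Unary.All as All using (All; []; _∷_)
  open import Data.List.Relation.Unary.AllPairs using ([]; _∷_)
  open import Data.List.Relation.Unary.Unique.Propositional using (Unique)
  import Data.List.Relation.Unary.Unique.Propositional.Properties as Uniqueₚ
  open import Data.List.Relation.Binary.BagAndSetEquality using (∼bag⇒↭)
  open import Data.List.Relation.Binary.Permutation.Propositional.Properties using (↭-length)
  open import Data.List.Membership.Propositional.Properties.WithK using (unique∧set⇒bag)
  open import Data.Product using (_,_; proj₂)
  open import Data.Sum using (inj₁; inj₂)
  open import Relation.Nullary using (¬_; yes; no; contradiction)
  open import Relation.Unary using (Decidable)
  open import Relation.Binary.Definitions using (tri<; tri≈; tri>)
  open import Relation.Binary.PropositionalEquality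
  open import Function using (_∘_)
  open import Function.Bundles using (mk⇔; module Equivalence)
  open Series using (c; e′)
  open WordLength

  ∑ : ∀ {A : Set} → List A → (A → ℤ) → ℤ
  ∑ []       F = 0ℤ
  ∑ (x ∷ xs) F = F x + ∑ xs F

  module _ {A : Set} where

    ∑-cong : ∀ (xs : List A) {F G} → (∀ x → F x ≡ G x) → ∑ xs F ≡ ∑ xs G
    ∑-cong []       F≡G = refl
    ∑-cong (x ∷ xs) F≡G = cong₂ _+_ (F≡G x) (∑-cong xs F≡G)

    ∑-+ : ∀ (xs : List A) F G → ∑ xs (λ x → F x + G x) ≡ ∑ xs F + ∑ xs G
    ∑-+ []       F G = refl
    ∑-+ (x ∷ xs) F G = trans (cong (_+_ (F x + G x)) (∑-+ xs F G)) (eq (F x) (G x) (∑ xs F) (∑ xs G))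
      where
      eq : ∀ a b c d → (a + b) + (c + d) ≡ (a + c) + (b + d)
      eq = solveℤ

    ∑-* : ∀ (xs : List A) r F → ∑ xs (λ x → r * F x) ≡ r * ∑ xs F
    ∑-* []       r F = sym (ℤₚ.*-zeroʳ r)
    ∑-* (x ∷ xs) r F = trans (cong (_+_ (r * F x)) (∑-* xs r F)) (sym (ℤₚ.*-distribˡ-+ r (F x) (∑ xs F)))

    ∑-0 : ∀ (xs : List A) → ∑ xs (λ _ → 0ℤ) ≡ 0ℤ
    ∑-0 []       = refl
    ∑-0 (x ∷ xs) = trans (ℤₚ.+-identityˡ _) (∑-0 xs)

    ∑-++ : ∀ (xs ys : List A) F → ∑ (xs ++ ys) F ≡ ∑ xs F + ∑ ys F
    ∑-++ []       ys F = sym (ℤₚ.+-identityˡ (∑ ys F))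
    ∑-++ (x ∷ xs) ys F = trans (cong (_+_ (F x)) (∑-++ xs ys F)) (sym (ℤₚ.+-assoc (F x) (∑ xs F) (∑ ys F)))

  ∑-map : ∀ {A B : Set} (f : A → B) xs F → ∑ (map f xs) F ≡ ∑ xs (F ∘ f)
  ∑-map f []       F = refl
  ∑-map f (x ∷ xs) F = cong (_+_ (F (f x))) (∑-map f xs F)

  ∑-swap : ∀ {A B : Set} (xs : List A) (ys : List B) (F : A → B → ℤ) → ∑ xs (λ x → ∑ ys (F x)) ≡ ∑ ys (λ y → ∑ xs (λ x → F x y))
  ∑-swap []       ys F = sym (∑-0 ys)
  ∑-swap (x ∷ xs) ys F = trans (cong (_+_ (∑ ys (F x))) (∑-swap xs ys F)) (sym (∑-+ ys (F x) (λ y → ∑ xs (λ x → F x y))))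

  ∑-cartesianProductWith : ∀ {A B C : Set} (f : A → B → C) xs ys F →
    ∑ (cartesianProductWith f xs ys) F ≡ ∑ xs (λ x → ∑ ys (F ∘ f x))
  ∑-cartesianProductWith f []       ys F = refl
  ∑-cartesianProductWith f (x ∷ xs) ys F = trans (∑-++ (map (f x) ys) (cartesianProductWith f xs ys) F)
    (cong₂ _+_ (∑-map (f x) ys F) (∑-cartesianProductWith f xs ys F))

  length-filter : ∀ {A : Set} {P : A → Set} (P? : Decidable P) Φ → (∀ x → P x → Φ x ≡ 1ℤ) → (∀ x → ¬ P x → Φ x ≡ 0ℤ) →
    ∀ xs → + length (List.filter P? xs) ≡ ∑ xs Φ
  length-filter P? Φ Φ≡1 Φ≡0 [] = refl
  length-filter P? Φ Φ≡1 Φ≡0 (x ∷ xs) with P? x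
  ... | yes p = cong₂ _+_ (sym (Φ≡1 x p)) (length-filter P? Φ Φ≡1 Φ≡0 xs)
  ... | no ¬p = trans (length-filter P? Φ Φ≡1 Φ≡0 xs) (trans (sym (ℤₚ.+-identityˡ (∑ xs Φ))) (cong (_+ ∑ xs Φ) (sym (Φ≡0 x ¬p))))

  -- Repetition-free lists with the same members are permutations of each other, so the given
  -- enumeration can be exchanged for a filtered one.
  cardinality : ∀ {A : Set} {P Q : A → Set} {s} → HasCardinality P s → (∀ x → P x → Q x) → (∀ x → Q x → P x) → (Q? : Decidable Q) →
    ∀ xs → Unique xs → (∀ x → Q x → x ∈ xs) → s ≡ length (List.filter Q? xs)
  cardinality (ys , unique-ys , ys⇔P , refl) P⇒Q Q⇒P Q? xs unique-xs Q⇒∈ =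
    ↭-length (∼bag⇒↭ (unique∧set⇒bag unique-ys (Uniqueₚ.filter⁺ Q? unique-xs) λ {x} → mk⇔
      (λ x∈ → let q = P⇒Q x (Equivalence.to (ys⇔P x) x∈) in ∈-filter⁺ Q? (Q⇒∈ x q) q)
      (λ x∈ → Equivalence.from (ys⇔P x) (Q⇒P x (proj₂ (∈-filter⁻ Q? {xs = xs} x∈))))))

  -- Boxes and sums over them.

  interval : ℕ → List ℤ
  interval zero    = 0ℤ ∷ []
  interval (suc K) = + suc K ∷ -[1+ K ] ∷ interval K

  ∈-interval⁺ : ∀ K a → ∣ a ∣ ≤ K → a ∈ interval K
  ∈-interval⁺ zero    (+ zero) _ = here refl
  ∈-interval⁺ (suc K) a ∣a∣≤1+K with ∣ a ∣ ℕ.≟ suc K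
  ... | no ∣a∣≢ = there (there (∈-interval⁺ K a (ℕₚ.≤-pred (ℕₚ.≤∧≢⇒< ∣a∣≤1+K ∣a∣≢))))
  ∈-interval⁺ (suc K) (+ _)    _ | yes refl = here refl
  ∈-interval⁺ (suc K) -[1+ _ ] _ | yes refl = there (here refl)

  ∈-interval⁻ : ∀ K → All (λ a → ∣ a ∣ ≤ K) (interval K)
  ∈-interval⁻ zero    = z≤n ∷ []
  ∈-interval⁻ (suc K) = ℕₚ.≤-refl ∷ ℕₚ.≤-refl ∷ All.map ℕₚ.m≤n⇒m≤1+n (∈-interval⁻ K)

  interval-unique : ∀ K → Unique (interval K)
  interval-unique zero    = [] ∷ []
  interval-unique (suc K) = ((λ ()) ∷ All.map (fresh refl) (∈-interval⁻ K)) ∷ All.map (fresh refl) (∈-interval⁻ K) ∷ interval-unique K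
    where
    fresh : ∀ {a b} → ∣ a ∣ ≡ suc K → ∣ b ∣ ≤ K → a ≢ b
    fresh ∣a∣≡ ∣b∣≤K refl = ℕₚ.<⇒≱ ℕₚ.≤-refl (subst (_≤ K) ∣a∣≡ ∣b∣≤K)

  box : ℕ → ∀ n → List (ℤ^ n)
  box K zero    = [] ∷ []
  box K (suc n) = cartesianProductWith _∷_ (interval K) (box K n)

  ∈-box⁺ : ∀ K {n} (v : ℤ^ n) → (∀ i → ∣ lookup v i ∣ ≤ K) → v ∈ box K n
  ∈-box⁺ K []      _        = here refl
  ∈-box⁺ K (a ∷ v) entries≤ = ∈-cartesianProductWith⁺ _∷_ (∈-interval⁺ K a (entries≤ zero)) (∈-box⁺ K v (entries≤ ∘ suc))

  box-unique : ∀ K n → Unique (box K n)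
  box-unique K zero    = [] ∷ []
  box-unique K (suc n) = Uniqueₚ.cartesianProductWith⁺ _∷_ ∷-injective (interval-unique K) (box-unique K n)

  ∑-interval-0 : ∀ K (f : ℕ → ℤ) → (∀ a → f a ≡ 0ℤ) → ∑ (interval K) (f ∘ ∣_∣) ≡ 0ℤ
  ∑-interval-0 K f f≡0 = trans (∑-cong (interval K) (f≡0 ∘ ∣_∣)) (∑-0 (interval K))

  ∑-interval-at-0 : ∀ K (f : ℕ → ℤ) → (∀ a → f (suc a) ≡ 0ℤ) → ∑ (interval K) (f ∘ ∣_∣) ≡ f 0
  ∑-interval-at-0 zero    f f≡0 = ℤₚ.+-identityʳ (f 0)
  ∑-interval-at-0 (suc K) f f≡0 = trans (cong₂ _+_ (f≡0 K) (cong₂ _+_ (f≡0 K) (∑-interval-at-0 K f f≡0)))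
    (trans (ℤₚ.+-identityˡ (0ℤ + f 0)) (ℤₚ.+-identityˡ (f 0)))

  ∑-interval-at-suc : ∀ K (f : ℕ → ℤ) b → 0 < b → b ≤ K → (∀ a → a ≢ b → f a ≡ 0ℤ) → ∑ (interval K) (f ∘ ∣_∣) ≡ f b + f b
  ∑-interval-at-suc zero    f (suc b) _ () _
  ∑-interval-at-suc (suc K) f b 0<b b≤1+K f≡0 with b ℕ.≟ suc K
  ... | yes refl = trans (cong (λ z → f b + (f b + z)) (rest K ℕₚ.≤-refl)) (cong (_+_ (f b)) (ℤₚ.+-identityʳ (f b)))
    where
    rest : ∀ L → L ≤ K → ∑ (interval L) (f ∘ ∣_∣) ≡ 0ℤ
    rest zero    _     = cong (_+ 0ℤ) (f≡0 0 (λ ()))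
    rest (suc L) 1+L≤K = cong₂ (λ y z → y + (y + z)) (f≡0 (suc L) (ℕₚ.<⇒≢ (s≤s 1+L≤K))) (rest L (ℕₚ.<⇒≤ 1+L≤K))
  ... | no b≢ = trans (cong₂ (λ y z → y + (y + z)) (f≡0 (suc K) (b≢ ∘ sym)) (∑-interval-at-suc K f b 0<b (ℕₚ.≤-pred (ℕₚ.≤∧≢⇒< b≤1+K b≢)) f≡0))
    (trans (ℤₚ.+-identityˡ _) (ℤₚ.+-identityˡ _))

  ∑-box-suc : ∀ K n F → ∑ (box K (suc n)) F ≡ ∑ (interval K) (λ a → ∑ (box K n) (λ u → F (a ∷ u)))
  ∑-box-suc K n F = ∑-cartesianProductWith _∷_ (interval K) (box K n) F

  -- Indicators of `m = l` and `m < l` with integer values, so that case counts become ring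
  -- identities.
  δ less : ℕ → ℕ → ℤ
  δ zero    zero    = 1ℤ
  δ zero    (suc l) = 0ℤ
  δ (suc m) zero    = 0ℤ
  δ (suc m) (suc l) = δ m l
  less m       zero    = 0ℤ
  less zero    (suc l) = 1ℤ
  less (suc m) (suc l) = less m l

  δ-refl : ∀ m → δ m m ≡ 1ℤ
  δ-refl zero    = refl
  δ-refl (suc m) = δ-refl m

  δ-≢ : ∀ {m l} → m ≢ l → δ m l ≡ 0ℤ
  δ-≢ {zero}  {zero}  m≢l = contradiction refl m≢l
  δ-≢ {zero}  {suc l} m≢l = refl
  δ-≢ {suc m} {zero}  m≢l = refl
  δ-≢ {suc m} {suc l} m≢l = δ-≢ (m≢l ∘ cong suc)

  less-< : ∀ {m l} → m < l → less m l ≡ 1ℤ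
  less-< {zero}  (s≤s _)   = refl
  less-< {suc m} (s≤s m<l) = less-< m<l

  less-≥ : ∀ {m l} → l ≤ m → less m l ≡ 0ℤ
  less-≥ z≤n       = refl
  less-≥ (s≤s l≤m) = less-≥ l≤m

  less-suc : ∀ l m → less l (suc m) ≡ less l m + δ m l
  less-suc zero    zero    = refl
  less-suc zero    (suc m) = refl
  less-suc (suc l) zero    = refl
  less-suc (suc l) (suc m) = less-suc l m

  δ-subst : ∀ m l (f : ℕ → ℤ) → δ m l * f l ≡ δ m l * f m
  δ-subst m l f with m ℕ.≟ l
  ... | yes refl = refl
  ... | no m≢l = trans (cong (_* f l) (δ-≢ m≢l)) (sym (cong (_* f m) (δ-≢ m≢l)))

  ev : ℕ → ℤ
  ev m with ℕ.parity m
  ... | 0ℙ = 1ℤ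
  ... | 1ℙ = 0ℤ

  ev-even : ∀ {m} → ℕ.parity m ≡ 0ℙ → ev m ≡ 1ℤ
  ev-even {m} eq with ℕ.parity m
  ... | 0ℙ = refl
  ev-even () | 1ℙ

  ev-odd : ∀ {m} → ℕ.parity m ≢ 0ℙ → ev m ≡ 0ℤ
  ev-odd {m} ≢0 with ℕ.parity m
  ... | 0ℙ = contradiction refl ≢0
  ... | 1ℙ = refl

  ev-double : ∀ k → ev (k ℕ.+ k) ≡ 1ℤ
  ev-double k = ev-even {k ℕ.+ k} (parity-double k)

  ev-1+double : ∀ k → ev (suc (k ℕ.+ k)) ≡ 0ℤ
  ev-1+double k = ev-odd {suc (k ℕ.+ k)} λ eq → contradiction (trans (sym eq) (suc-flip {k ℕ.+ k} {0} (parity-double k))) (λ ())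

  -- `∣a∣ = m - l` has two solutions for `l < m`, one for `l = m` and none beyond; `m ≤ K` keeps
  -- them in the interval.
  ∑-interval-δ : ∀ K m l → m ≤ K → ∑ (interval K) (λ a → δ m (∣ a ∣ ℕ.+ l)) ≡ (less l m + less l m) + δ m l
  ∑-interval-δ K m l m≤K with ℕₚ.<-cmp l m
  ... | tri< l<m l≢m _ = trans
    (∑-interval-at-suc K (λ a → δ m (a ℕ.+ l)) (m ℕ.∸ l) (ℕₚ.m<n⇒0<n∸m l<m) (ℕₚ.≤-trans (ℕₚ.m∸n≤m m l) m≤K)
      (λ a a≢ → δ-≢ λ m≡a+l → a≢ (trans (sym (ℕₚ.m+n∸n≡m a l)) (cong (ℕ._∸ l) (sym m≡a+l)))))
    (trans (cong₂ _+_ δ≡1 δ≡1) (sym (cong₂ (λ p q → (p + p) + q) (less-< l<m) (δ-≢ (l≢m ∘ sym)))))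
    where
    δ≡1 : δ m (m ℕ.∸ l ℕ.+ l) ≡ 1ℤ
    δ≡1 = trans (cong (δ m) (ℕₚ.m∸n+n≡m (ℕₚ.<⇒≤ l<m))) (δ-refl m)
  ... | tri≈ _ refl _ = trans
    (∑-interval-at-0 K (λ a → δ m (a ℕ.+ l)) (λ a → δ-≢ (ℕₚ.<⇒≢ (s≤s (ℕₚ.m≤n+m l a)))))
    (trans (sym (ℤₚ.+-identityˡ (δ m m))) (cong (λ p → (p + p) + δ m m) (sym (less-≥ (ℕₚ.≤-refl {m})))))
  ... | tri> _ l≢m m<l = trans
    (∑-interval-0 K (λ a → δ m (a ℕ.+ l)) (λ a → δ-≢ (ℕₚ.<⇒≢ (ℕₚ.<-≤-trans m<l (ℕₚ.m≤n+m l a)))))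
    (sym (cong₂ (λ p q → (p + p) + q) (less-≥ (ℕₚ.<⇒≤ m<l)) (δ-≢ (l≢m ∘ sym))))

  -- Splitting off a coordinate leaves weight 2 on vectors of norm below `m` and weight 1 at `m`.
  -- Raising `m` to `m + 1` adds `c n m + c n (suc m)`, the recursion of `c`.
  ∑-box-δ : ∀ K n m → m ≤ K → ∑ (box K n) (λ u → δ m (norm u)) ≡ c n m
  ∑-box-less+δ : ∀ K n m → m ≤ K → ∑ (box K n) (λ u → (less (norm u) m + less (norm u) m) + δ m (norm u)) ≡ c (suc n) m

  ∑-box-δ K zero    zero    _   = refl
  ∑-box-δ K zero    (suc m) _   = refl
  ∑-box-δ K (suc n) m       m≤K = begin
    ∑ (box K (suc n)) (λ u → δ m (norm u))
      ≡⟨ ∑-box-suc K n (λ u → δ m (norm u)) ⟩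
    ∑ (interval K) (λ a → ∑ (box K n) (λ u → δ m (∣ a ∣ ℕ.+ norm u)))
      ≡⟨ ∑-swap (interval K) (box K n) (λ a u → δ m (∣ a ∣ ℕ.+ norm u)) ⟩
    ∑ (box K n) (λ u → ∑ (interval K) (λ a → δ m (∣ a ∣ ℕ.+ norm u)))
      ≡⟨ ∑-cong (box K n) (λ u → ∑-interval-δ K m (norm u) m≤K) ⟩
    ∑ (box K n) (λ u → (less (norm u) m + less (norm u) m) + δ m (norm u))
      ≡⟨ ∑-box-less+δ K n m m≤K ⟩
    c (suc n) m ∎
    where open ≡-Reasoning

  ∑-box-less+δ K n zero    _     = trans (∑-cong (box K n) (λ u → ℤₚ.+-identityˡ (δ 0 (norm u)))) (∑-box-δ K n 0 z≤n)
  ∑-box-less+δ K n (suc m) 1+m≤K = begin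
    ∑ (box K n) (λ u → (less (norm u) (suc m) + less (norm u) (suc m)) + δ (suc m) (norm u))
      ≡⟨ ∑-cong (box K n) (λ u → trans (cong (λ p → (p + p) + δ (suc m) (norm u)) (less-suc (norm u) m))
           (eq (less (norm u) m) (δ m (norm u)) (δ (suc m) (norm u)))) ⟩
    ∑ (box K n) (λ u → ((less (norm u) m + less (norm u) m) + δ m (norm u)) + (δ m (norm u) + δ (suc m) (norm u)))
      ≡⟨ ∑-+ (box K n) (λ u → (less (norm u) m + less (norm u) m) + δ m (norm u)) (λ u → δ m (norm u) + δ (suc m) (norm u)) ⟩
    ∑ (box K n) (λ u → (less (norm u) m + less (norm u) m) + δ m (norm u)) + ∑ (box K n) (λ u → δ m (norm u) + δ (suc m) (norm u))
      ≡⟨ cong₂ _+_ (∑-box-less+δ K n m m≤K)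
           (trans (∑-+ (box K n) (λ u → δ m (norm u)) (λ u → δ (suc m) (norm u))) (cong₂ _+_ (∑-box-δ K n m m≤K) (∑-box-δ K n (suc m) 1+m≤K))) ⟩
    c (suc n) (suc m) ∎
    where
    open ≡-Reasoning
    m≤K : m ≤ K
    m≤K = ℕₚ.<⇒≤ 1+m≤K
    eq : ∀ p d d′ → ((p + d) + (p + d)) + d′ ≡ ((p + p) + d) + (d + d′)
    eq = solveℤ

  ∑ᶜ : ∀ {n} → (ℕ → ℤ) → ℤ^ n → ℤ
  ∑ᶜ f []      = 0ℤ
  ∑ᶜ f (a ∷ v) = f ∣ a ∣ + ∑ᶜ f v

  ∑ᶜ-0 : ∀ {n} f (v : ℤ^ n) → (∀ i → f ∣ lookup v i ∣ ≡ 0ℤ) → ∑ᶜ f v ≡ 0ℤ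
  ∑ᶜ-0 f []      f≡0 = refl
  ∑ᶜ-0 f (a ∷ v) f≡0 = cong₂ _+_ (f≡0 zero) (∑ᶜ-0 f v (f≡0 ∘ suc))

  -- At most one coordinate exceeds half of the 1-norm.
  ∑ᶜ-single : ∀ {n} f r (v : ℤ^ n) i → norm v < r ℕ.+ r → (∀ a → a < r → f a ≡ 0ℤ) → r ≤ ∣ lookup v i ∣ → ∑ᶜ f v ≡ f ∣ lookup v i ∣
  ∑ᶜ-single f r (a ∷ v) zero norm< f≡0 r≤ = trans (cong (_+_ (f ∣ a ∣)) (∑ᶜ-0 f v λ i → f≡0 _ (ℕₚ.≤-<-trans (lookup≤norm v i) norm-v<r))) (ℤₚ.+-identityʳ (f ∣ a ∣))
    where
    norm-v<r : norm v < r
    norm-v<r = ℕₚ.+-cancelˡ-< r (norm v) r (ℕₚ.≤-<-trans (ℕₚ.+-monoˡ-≤ (norm v) r≤) norm<)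
  ∑ᶜ-single f r (a ∷ v) (suc i) norm< f≡0 r≤ = trans (cong₂ _+_ (f≡0 (∣ a ∣) a<r)
    (∑ᶜ-single f r v i (ℕₚ.≤-<-trans (ℕₚ.m≤n+m (norm v) (∣ a ∣)) norm<) f≡0 r≤)) (ℤₚ.+-identityˡ _)
    where
    a<r : ∣ a ∣ < r
    a<r = ℕₚ.+-cancelʳ-< r (∣ a ∣) r (ℕₚ.≤-<-trans (ℕₚ.+-monoʳ-≤ (∣ a ∣) (ℕₚ.≤-trans r≤ (lookup≤norm v i))) norm<)

  -- By symmetry of the box every coordinate contributes as much as the first. `f` takes the norm as
  -- an argument so that the induction can absorb the split-off coordinate into it.
  ∑-box-∑ᶜ : ∀ K n (f : ℕ → ℕ → ℤ) → ∑ (box K (suc n)) (λ v → ∑ᶜ (λ b → f b (norm v)) v) ≡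
    + suc n * ∑ (box K n) (λ u → ∑ (interval K) (λ a → f ∣ a ∣ (∣ a ∣ ℕ.+ norm u)))
  ∑-box-∑ᶜ K zero f = begin
    ∑ (box K 1) (λ v → ∑ᶜ (λ b → f b (norm v)) v)
      ≡⟨ ∑-box-suc K 0 (λ v → ∑ᶜ (λ b → f b (norm v)) v) ⟩
    ∑ (interval K) (λ a → (f ∣ a ∣ (∣ a ∣ ℕ.+ 0) + 0ℤ) + 0ℤ)
      ≡⟨ ∑-cong (interval K) (λ a → trans (ℤₚ.+-identityʳ _) (ℤₚ.+-identityʳ _)) ⟩
    ∑ (interval K) (λ a → f ∣ a ∣ (∣ a ∣ ℕ.+ 0))
      ≡⟨ ℤₚ.+-identityʳ _ ⟨
    ∑ (interval K) (λ a → f ∣ a ∣ (∣ a ∣ ℕ.+ 0)) + 0ℤ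
      ≡⟨ ℤₚ.*-identityˡ _ ⟨
    1ℤ * (∑ (interval K) (λ a → f ∣ a ∣ (∣ a ∣ ℕ.+ 0)) + 0ℤ) ∎
    where open ≡-Reasoning
  ∑-box-∑ᶜ K (suc n) f = begin
    ∑ (box K (2 ℕ.+ n)) (λ v → ∑ᶜ (λ b → f b (norm v)) v)
      ≡⟨ ∑-box-suc K (suc n) (λ v → ∑ᶜ (λ b → f b (norm v)) v) ⟩
    ∑ I (λ a → ∑ B (λ u → f ∣ a ∣ (∣ a ∣ ℕ.+ norm u) + ∑ᶜ (λ b → f b (∣ a ∣ ℕ.+ norm u)) u))
      ≡⟨ ∑-cong I (λ a → ∑-+ B (λ u → f ∣ a ∣ (∣ a ∣ ℕ.+ norm u)) (λ u → ∑ᶜ (λ b → f b (∣ a ∣ ℕ.+ norm u)) u)) ⟩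
    ∑ I (λ a → ∑ B (λ u → f ∣ a ∣ (∣ a ∣ ℕ.+ norm u)) + ∑ B (λ u → ∑ᶜ (λ b → f b (∣ a ∣ ℕ.+ norm u)) u))
      ≡⟨ ∑-+ I (λ a → ∑ B (λ u → f ∣ a ∣ (∣ a ∣ ℕ.+ norm u))) (λ a → ∑ B (λ u → ∑ᶜ (λ b → f b (∣ a ∣ ℕ.+ norm u)) u)) ⟩
    ∑ I (λ a → ∑ B (λ u → f ∣ a ∣ (∣ a ∣ ℕ.+ norm u))) + ∑ I (λ a → ∑ B (λ u → ∑ᶜ (λ b → f b (∣ a ∣ ℕ.+ norm u)) u))
      ≡⟨ cong₂ _+_ (∑-swap I B (λ a u → f ∣ a ∣ (∣ a ∣ ℕ.+ norm u))) inner ⟩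
    Z + + suc n * Z
      ≡⟨ cong (_+ + suc n * Z) (ℤₚ.*-identityˡ Z) ⟨
    1ℤ * Z + + suc n * Z
      ≡⟨ ℤₚ.*-distribʳ-+ Z 1ℤ (+ suc n) ⟨
    + suc (suc n) * Z ∎
    where
    open ≡-Reasoning
    I : List ℤ
    I = interval K
    B : List (ℤ^ (suc n))
    B = box K (suc n)
    Z : ℤ
    Z = ∑ B (λ u → ∑ I (λ a → f ∣ a ∣ (∣ a ∣ ℕ.+ norm u)))
    rotate : ∀ a b m → a ℕ.+ (b ℕ.+ m) ≡ b ℕ.+ (a ℕ.+ m)
    rotate = solveℕ
    inner : ∑ I (λ a → ∑ B (λ u → ∑ᶜ (λ b → f b (∣ a ∣ ℕ.+ norm u)) u)) ≡ + suc n * Z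
    inner = begin
      ∑ I (λ a → ∑ B (λ u → ∑ᶜ (λ b → f b (∣ a ∣ ℕ.+ norm u)) u))
        ≡⟨ ∑-cong I (λ a → ∑-box-∑ᶜ K n (λ b m → f b (∣ a ∣ ℕ.+ m))) ⟩
      ∑ I (λ a → + suc n * ∑ (box K n) (λ u → ∑ I (λ b → f ∣ b ∣ (∣ a ∣ ℕ.+ (∣ b ∣ ℕ.+ norm u)))))
        ≡⟨ ∑-* I (+ suc n) (λ a → ∑ (box K n) (λ u → ∑ I (λ b → f ∣ b ∣ (∣ a ∣ ℕ.+ (∣ b ∣ ℕ.+ norm u))))) ⟩
      + suc n * ∑ I (λ a → ∑ (box K n) (λ u → ∑ I (λ b → f ∣ b ∣ (∣ a ∣ ℕ.+ (∣ b ∣ ℕ.+ norm u)))))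
        ≡⟨ cong (+ suc n *_) (∑-cong I (λ a → ∑-cong (box K n) (λ u → ∑-cong I (λ b → cong (f ∣ b ∣) (rotate (∣ a ∣) (∣ b ∣) (norm u)))))) ⟩
      + suc n * ∑ I (λ a → ∑ (box K n) (λ u → ∑ I (λ b → f ∣ b ∣ (∣ b ∣ ℕ.+ norm (a ∷ u)))))
        ≡⟨ cong (+ suc n *_) (∑-box-suc K n (λ u → ∑ I (λ b → f ∣ b ∣ (∣ b ∣ ℕ.+ norm u)))) ⟨
      + suc n * Z ∎

  -- Summed over the coordinates of a vector of 1-norm m, the correction turns
  -- the indicator of m = 2k into that of Sphere k.
  correction : ℕ → ℕ → ℕ → ℤ
  correction k a m = δ k a * (less m (k ℕ.+ k) * ev m) - less k a * δ (k ℕ.+ k) m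

  -- From the vectors of norm `2k`, those with an entry beyond `k` are removed; the even ones of
  -- smaller norm with an entry of absolute value `k` are added. Such an entry is unique in both
  -- cases, so a sum over coordinates counts each vector once.
  sphereIndicator : ∀ {n} → ℕ → ℤ^ n → ℤ
  sphereIndicator k v = δ (k ℕ.+ k) (norm v) + ∑ᶜ (λ a → correction k a (norm v)) v

  module _ {n} (k : ℕ) (v : ℤ^ n) where
    private
      N : ℕ
      N = norm v
      f : ℕ → ℤ
      f a = correction k a N

    indicator-above : k ℕ.+ k < N → sphereIndicator k v ≡ 0ℤ
    indicator-above 2k<N = cong₂ _+_ δ≡0 (∑ᶜ-0 f v λ i → f≡0 (∣ lookup v i ∣))
      where
      δ≡0 : δ (k ℕ.+ k) N ≡ 0ℤ
      δ≡0 = δ-≢ (ℕₚ.<⇒≢ 2k<N)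
      f≡0 : ∀ a → f a ≡ 0ℤ
      f≡0 a = trans (cong₂ (λ p q → δ k a * (p * ev N) - less k a * q) (less-≥ (ℕₚ.<⇒≤ 2k<N)) δ≡0) (eq (δ k a) (ev N) (less k a))
        where
        eq : ∀ p q r → p * (0ℤ * q) - r * 0ℤ ≡ 0ℤ
        eq = solveℤ

    module _ (N≡2k : N ≡ k ℕ.+ k) where
      private
        δ≡1 : δ (k ℕ.+ k) N ≡ 1ℤ
        δ≡1 = trans (cong (δ (k ℕ.+ k)) N≡2k) (δ-refl (k ℕ.+ k))
        f≡ : ∀ a → f a ≡ ℤ.- less k a
        f≡ a = trans (cong₂ (λ p q → δ k a * (p * ev N) - less k a * q) (less-≥ (ℕₚ.≤-reflexive (sym N≡2k))) δ≡1) (eq (δ k a) (ev N) (less k a))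
          where
          eq : ∀ p q r → p * (0ℤ * q) - r * 1ℤ ≡ ℤ.- r
          eq = solveℤ

      indicator-inside : (∀ i → ∣ lookup v i ∣ ≤ k) → sphereIndicator k v ≡ 1ℤ
      indicator-inside entries≤ = cong₂ _+_ δ≡1 (∑ᶜ-0 f v λ i → trans (f≡ (∣ lookup v i ∣)) (cong ℤ.-_ (less-≥ (entries≤ i))))

      indicator-outside : ∀ i → k < ∣ lookup v i ∣ → sphereIndicator k v ≡ 0ℤ
      indicator-outside i k<vᵢ = cong₂ _+_ δ≡1 (trans
        -- The threshold is `k + 1` because the norm equals `2k`; below norm `2k` the threshold is
        -- `k` itself.
        (∑ᶜ-single f (suc k) v i (subst (_< suc k ℕ.+ suc k) (sym N≡2k) (ℕₚ.+-mono-< ℕₚ.≤-refl ℕₚ.≤-refl))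
          (λ a a<1+k → trans (f≡ a) (cong ℤ.-_ (less-≥ (ℕₚ.≤-pred a<1+k)))) k<vᵢ)
        (trans (f≡ (∣ lookup v i ∣)) (cong ℤ.-_ (less-< k<vᵢ))))

    module _ (N<2k : N < k ℕ.+ k) where
      private
        δ≡0 : δ (k ℕ.+ k) N ≡ 0ℤ
        δ≡0 = δ-≢ (ℕₚ.<⇒≢ N<2k ∘ sym)
        f≡ : ∀ a → f a ≡ δ k a * ev N
        f≡ a = trans (cong₂ (λ p q → δ k a * (p * ev N) - less k a * q) (less-< N<2k) δ≡0) (eq (δ k a) (ev N) (less k a))
          where
          eq : ∀ p q r → p * (1ℤ * q) - r * 0ℤ ≡ p * q
          eq = solveℤ

      indicator-odd : ℕ.parity N ≢ 0ℙ → sphereIndicator k v ≡ 0ℤ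
      indicator-odd odd-N = cong₂ _+_ δ≡0 (∑ᶜ-0 f v λ i →
        trans (f≡ (∣ lookup v i ∣)) (trans (cong (δ k ∣ lookup v i ∣ *_) (ev-odd {N} odd-N)) (ℤₚ.*-zeroʳ (δ k ∣ lookup v i ∣))))

      indicator-below : (∀ i → ∣ lookup v i ∣ ≢ k) → sphereIndicator k v ≡ 0ℤ
      indicator-below vᵢ≢k = cong₂ _+_ δ≡0 (∑ᶜ-0 f v λ i →
        trans (f≡ (∣ lookup v i ∣)) (cong (_* ev N) (δ-≢ (vᵢ≢k i ∘ sym))))

      indicator-on : ∀ i → ∣ lookup v i ∣ ≡ k → ℕ.parity N ≡ 0ℙ → sphereIndicator k v ≡ 1ℤ
      indicator-on i vᵢ≡k even-N = cong₂ _+_ δ≡0 (trans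
        (∑ᶜ-single f k v i N<2k (λ a a<k → trans (f≡ a) (cong (_* ev N) (δ-≢ (ℕₚ.<⇒≢ a<k ∘ sym)))) (ℕₚ.≤-reflexive (sym vᵢ≡k)))
        (trans (f≡ (∣ lookup v i ∣)) (cong₂ _*_ (trans (cong (δ k) vᵢ≡k) (δ-refl k)) (ev-even {N} even-N))))

      entries≤k : ∀ i → ∣ lookup v i ∣ ≡ k → ∀ j → ∣ lookup v j ∣ ≤ k
      entries≤k i vᵢ≡k j with j Finₚ.≟ i
      ... | yes refl = ℕₚ.≤-reflexive vᵢ≡k
      ... | no j≢i = ℕₚ.<⇒≤ (ℕₚ.+-cancelʳ-< k (∣ lookup v j ∣) k (ℕₚ.≤-<-trans (subst (λ z → ∣ lookup v j ∣ ℕ.+ z ≤ N) vᵢ≡k (two≤norm v j≢i)) N<2k))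

    Sphere⇒indicator : Sphere k v → sphereIndicator k v ≡ 1ℤ
    Sphere⇒indicator ((even-N , N≤2k , entries≤) , reached) with N ℕ.≟ k ℕ.+ k | reached
    ... | yes N≡2k | _               = indicator-inside N≡2k entries≤
    ... | no N≢2k  | inj₁ N≡2k       = contradiction N≡2k N≢2k
    ... | no N≢2k  | inj₂ (i , vᵢ≡k) = indicator-on (ℕₚ.≤∧≢⇒< N≤2k N≢2k) i vᵢ≡k even-N

    ¬Sphere⇒indicator : ¬ Sphere k v → sphereIndicator k v ≡ 0ℤ
    ¬Sphere⇒indicator ¬sphere with ℕₚ.<-cmp N (k ℕ.+ k)
    ... | tri> _ _ 2k<N = indicator-above 2k<N
    ... | tri≈ _ N≡2k _ with Finₚ.any? (λ i → k ℕ.<? ∣ lookup v i ∣)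
    ...   | yes (i , k<vᵢ) = indicator-outside N≡2k i k<vᵢ
    ...   | no none = contradiction
            ((trans (cong ℕ.parity N≡2k) (parity-double k) , ℕₚ.≤-reflexive N≡2k , λ i → ℕₚ.≮⇒≥ (λ k<vᵢ → none (i , k<vᵢ))) , inj₁ N≡2k) ¬sphere
    ¬Sphere⇒indicator ¬sphere | tri< N<2k _ _ with ℕ.parity N ℙₚ.≟ 0ℙ
    ...   | no odd-N = indicator-odd N<2k odd-N
    ...   | yes even-N with Finₚ.any? (λ i → ∣ lookup v i ∣ ℕ.≟ k)
    ...     | no none = indicator-below N<2k (λ i vᵢ≡k → none (i , vᵢ≡k))
    ...     | yes (i , vᵢ≡k) = contradiction ((even-N , ℕₚ.<⇒≤ N<2k , entries≤k N<2k i vᵢ≡k) , inj₂ (i , vᵢ≡k)) ¬sphere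

  ρ : ℕ → ℕ → ℤ
  ρ k l = less l k * (1ℤ - ev (k ℕ.+ l))

  -- Passing from `k` to `k + 2` admits the new values `l = k` and `l = k + 1`, and only the second
  -- differs from `k` in parity.
  ρ-suc-suc : ∀ k l → ρ (suc (suc k)) l ≡ ρ k l + δ (suc k) l
  ρ-suc-suc k l = begin
    less l (suc (suc k)) * (1ℤ - ev (k ℕ.+ l))
      ≡⟨ cong (_* (1ℤ - ev (k ℕ.+ l))) (trans (less-suc l (suc k)) (cong (_+ δ (suc k) l) (less-suc l k))) ⟩
    ((less l k + δ k l) + δ (suc k) l) * (1ℤ - ev (k ℕ.+ l))
      ≡⟨ distrib (less l k) (δ k l) (δ (suc k) l) (1ℤ - ev (k ℕ.+ l)) ⟩
    ρ k l + (δ k l * (1ℤ - ev (k ℕ.+ l)) + δ (suc k) l * (1ℤ - ev (k ℕ.+ l)))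
      ≡⟨ cong₂ (λ p q → ρ k l + (p + q)) (δ-subst k l (λ l → 1ℤ - ev (k ℕ.+ l))) (δ-subst (suc k) l (λ l → 1ℤ - ev (k ℕ.+ l))) ⟩
    ρ k l + (δ k l * (1ℤ - ev (k ℕ.+ k)) + δ (suc k) l * (1ℤ - ev (k ℕ.+ suc k)))
      ≡⟨ cong₂ (λ p q → ρ k l + (δ k l * (1ℤ - p) + δ (suc k) l * (1ℤ - q))) (ev-double k) (trans (cong ev (ℕₚ.+-suc k k)) (ev-1+double k)) ⟩
    ρ k l + (δ k l * 0ℤ + δ (suc k) l * 1ℤ)
      ≡⟨ cong (_+_ (ρ k l)) (eq (δ k l) (δ (suc k) l)) ⟩
    ρ k l + δ (suc k) l ∎
    where
    open ≡-Reasoning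
    distrib : ∀ a b c d → ((a + b) + c) * d ≡ a * d + (b * d + c * d)
    distrib = solveℤ
    eq : ∀ a b → a * 0ℤ + b * 1ℤ ≡ b
    eq = solveℤ

  ∑-box-ρ : ∀ K n k → k ≤ K → ∑ (box K n) (λ u → ρ k (norm u)) ≡ e′ n k
  ∑-box-ρ K n zero          _     = trans (∑-cong (box K n) (λ u → cong (_* (1ℤ - ev (norm u))) (less-≥ {norm u} {0} z≤n))) (∑-0 (box K n))
  ∑-box-ρ K n (suc zero)    1≤K   = trans (∑-cong (box K n) (λ u → ρ₁ (norm u))) (∑-box-δ K n 0 z≤n)
    where
    ρ₁ : ∀ l → ρ 1 l ≡ δ 0 l
    ρ₁ zero    = refl
    ρ₁ (suc l) = cong (_* (1ℤ - ev l)) (less-≥ {suc l} {1} (s≤s z≤n))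
  ∑-box-ρ K n (suc (suc k)) 2+k≤K = trans (∑-cong (box K n) (λ u → ρ-suc-suc k (norm u)))
    (trans (∑-+ (box K n) (λ u → ρ k (norm u)) (λ u → δ (suc k) (norm u)))
      (cong₂ _+_ (∑-box-ρ K n k (ℕₚ.<⇒≤ (ℕₚ.<⇒≤ 2+k≤K))) (∑-box-δ K n (suc k) (ℕₚ.<⇒≤ 2+k≤K))))

  -- Let the other coordinates have norm `l < k`. The entries `±k` are added when `k + l` is even,
  -- and `±(2k - l)`, which lie beyond `k`, are always removed. The net effect is `-2` for odd
  -- `k + l` and 0 for even; for `l ≥ k` nothing happens.
  ∑-interval-correction : ∀ k l → ∑ (interval (k ℕ.+ k)) (λ a → correction k (∣ a ∣) (∣ a ∣ ℕ.+ l)) ≡ ℤ.- (+ 2) * ρ k l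
  ∑-interval-correction k l = begin
    ∑ I (λ a → correction k (∣ a ∣) (∣ a ∣ ℕ.+ l))
      ≡⟨ ∑-cong I (λ a → cong (_+_ (first (∣ a ∣))) (sym (ℤₚ.-1*i≡-i (second (∣ a ∣))))) ⟩
    ∑ I (λ a → first (∣ a ∣) + -1ℤ * second (∣ a ∣))
      ≡⟨ trans (∑-+ I (first ∘ ∣_∣) (λ a → -1ℤ * second (∣ a ∣))) (cong (_+_ (∑ I (first ∘ ∣_∣))) (∑-* I -1ℤ (second ∘ ∣_∣))) ⟩
    ∑ I (first ∘ ∣_∣) + -1ℤ * ∑ I (second ∘ ∣_∣)
      ≡⟨ cong₂ (λ p q → p + -1ℤ * q) (∑-first k) ∑-second ⟩
    (less l k * ev (k ℕ.+ l) + less l k * ev (k ℕ.+ l)) + -1ℤ * (less l k + less l k)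
      ≡⟨ eq (less l k) (ev (k ℕ.+ l)) ⟩
    ℤ.- (+ 2) * ρ k l ∎
    where
    open ≡-Reasoning
    I : List ℤ
    I = interval (k ℕ.+ k)
    first second : ℕ → ℤ
    first a = δ k a * (less (a ℕ.+ l) (k ℕ.+ k) * ev (a ℕ.+ l))
    second a = less k a * δ (k ℕ.+ k) (a ℕ.+ l)
    eq : ∀ p q → (p * q + p * q) + -1ℤ * (p + p) ≡ ℤ.- (+ 2) * (p * (1ℤ - q))
    eq = solveℤ
    less-+ : ∀ k m n → less (k ℕ.+ m) (k ℕ.+ n) ≡ less m n
    less-+ zero    m n = refl
    less-+ (suc k) m n = less-+ k m n
    ∑-first : ∀ k → ∑ (interval (k ℕ.+ k)) (λ a → δ k (∣ a ∣) * (less (∣ a ∣ ℕ.+ l) (k ℕ.+ k) * ev (∣ a ∣ ℕ.+ l))) ≡ less l k * ev (k ℕ.+ l) + less l k * ev (k ℕ.+ l)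
    -- At `k = 0` the entry has one sign instead of two, but both sides vanish because no `l` is
    -- below 0.
    ∑-first zero = cong₂ _+_ (trans (ℤₚ.*-identityˡ _) (cong (_* ev l) (less-≥ {l} {0} z≤n))) (sym (cong (_* ev l) (less-≥ {l} {0} z≤n)))
    ∑-first k@(suc _) = trans (∑-interval-at-suc (k ℕ.+ k) (λ a → δ k a * (less (a ℕ.+ l) (k ℕ.+ k) * ev (a ℕ.+ l))) k (s≤s z≤n) (ℕₚ.m≤m+n k k) (λ a a≢k → cong (_* (less (a ℕ.+ l) (k ℕ.+ k) * ev (a ℕ.+ l))) (δ-≢ (a≢k ∘ sym))))
      (cong (λ x → x + x) (trans (cong (_* (less (k ℕ.+ l) (k ℕ.+ k) * ev (k ℕ.+ l))) (δ-refl k))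
        (trans (ℤₚ.*-identityˡ _) (cong (_* ev (k ℕ.+ l)) (less-+ k l k)))))
    ∑-second : ∑ I (second ∘ ∣_∣) ≡ less l k + less l k
    ∑-second with l ℕ.<? k
    ... | yes l<k = trans
      (∑-interval-at-suc (k ℕ.+ k) second b 0<b (ℕₚ.m∸n≤m (k ℕ.+ k) l) (λ a a≢b → trans
        (cong (less k a *_) (δ-≢ λ 2k≡a+l → a≢b (trans (sym (ℕₚ.m+n∸n≡m a l)) (cong (ℕ._∸ l) (sym 2k≡a+l))))) (ℤₚ.*-zeroʳ (less k a))))
      (cong (λ x → x + x) (trans (cong₂ _*_ (less-< k<b) (trans (cong (δ (k ℕ.+ k)) b+l≡2k) (δ-refl (k ℕ.+ k)))) (sym (less-< l<k))))
      where
      b : ℕ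
      b = k ℕ.+ k ℕ.∸ l
      b+l≡2k : b ℕ.+ l ≡ k ℕ.+ k
      b+l≡2k = ℕₚ.m∸n+n≡m (ℕₚ.≤-trans (ℕₚ.<⇒≤ l<k) (ℕₚ.m≤m+n k k))
      k<b : k < b
      k<b = ℕₚ.+-cancelʳ-< l k b (ℕₚ.<-≤-trans (ℕₚ.+-monoʳ-< k l<k) (ℕₚ.≤-reflexive (sym b+l≡2k)))
      0<b : 0 < b
      0<b = ℕₚ.≤-<-trans z≤n k<b
    ... | no l≮k = trans (∑-interval-0 (k ℕ.+ k) second zeros) (sym (cong (λ x → x + x) (less-≥ (ℕₚ.≮⇒≥ l≮k))))
      where
      zeros : ∀ a → second a ≡ 0ℤ
      zeros a with k ℕ.<? a
      ... | yes k<a = trans (cong (less k a *_) (δ-≢ (ℕₚ.<⇒≢ (ℕₚ.+-mono-<-≤ k<a (ℕₚ.≮⇒≥ l≮k))))) (ℤₚ.*-zeroʳ (less k a))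
      ... | no k≮a = cong (_* δ (k ℕ.+ k) (a ℕ.+ l)) (less-≥ (ℕₚ.≮⇒≥ k≮a))

  sphere-size : ∀ n k s → HasCardinality (λ v → HasLength (M-D (2 ℕ.+ n)) v k) s →
    + s ≡ c (2 ℕ.+ n) (k ℕ.+ k) - (+ 2 * + (2 ℕ.+ n)) * e′ (suc n) k
  sphere-size n k s card = begin
    + s
      ≡⟨ cong +_ (cardinality card (λ v → HasLength⇒Sphere v k) (λ v → Sphere⇒HasLength v k) (Sphere? k) (box K d) (box-unique K d)
           (λ v ((_ , _ , entries≤) , _) → ∈-box⁺ K v (λ i → ℕₚ.≤-trans (entries≤ i) (ℕₚ.m≤m+n k k)))) ⟩
    + length (List.filter (Sphere? k) (box K d))
      ≡⟨ length-filter (Sphere? k) (sphereIndicator k) (Sphere⇒indicator k) (¬Sphere⇒indicator k) (box K d) ⟩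
    ∑ (box K d) (sphereIndicator k)
      ≡⟨ ∑-+ (box K d) (λ v → δ K (norm v)) (λ v → ∑ᶜ (λ a → correction k a (norm v)) v) ⟩
    ∑ (box K d) (λ v → δ K (norm v)) + ∑ (box K d) (λ v → ∑ᶜ (λ a → correction k a (norm v)) v)
      ≡⟨ cong₂ _+_ (∑-box-δ K d K ℕₚ.≤-refl) (∑-box-∑ᶜ K (suc n) (correction k)) ⟩
    c d K + + d * ∑ (box K (suc n)) (λ u → ∑ (interval K) (λ a → correction k (∣ a ∣) (∣ a ∣ ℕ.+ norm u)))
      ≡⟨ cong (λ z → c d K + + d * z) (trans (∑-cong (box K (suc n)) (λ u → ∑-interval-correction k (norm u)))
           (trans (∑-* (box K (suc n)) (ℤ.- (+ 2)) (λ u → ρ k (norm u))) (cong (ℤ.- (+ 2) *_) (∑-box-ρ K (suc n) k (ℕₚ.m≤m+n k k))))) ⟩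
    c d K + + d * (ℤ.- (+ 2) * e′ (suc n) k)
      ≡⟨ eq (c d K) (+ d) (e′ (suc n) k) ⟩
    c d K - (+ 2 * + d) * e′ (suc n) k ∎
    where
    open ≡-Reasoning
    K d : ℕ
    -- The box has to hold every vector of norm `2k`, including those outside the sphere that the
    -- correction removes.
    K = k ℕ.+ k
    d = 2 ℕ.+ n
    eq : ∀ a b c → a + b * (ℤ.- (+ 2) * c) ≡ a - (+ 2 * b) * c
    eq = solveℤ

-- From sphere sizes to real-rootedness.

open import Data.Nat using (ℕ; _≤_; suc; s≤s)
open import Data.Integer using (+_)
open import Relation.Binary.PropositionalEquality using (sym; trans)
open import Data.Product using (_,_)
open GaussianRationals using (realRooted-closedForm)
open Series using (⊛-[1-x]^; coeff-closedForm)
open Counting using (sphere-size)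

theorem2p1 : ∀ (n : ℕ) → 2 ≤ n → ∀ (h : Polynomial) → IsCoordinatorPolynomialD n h → RealRooted h
theorem2p1 (suc (suc n)) _ h (S , card , S⊛[1-x]^n≗h) = realRooted-closedForm n h λ k →
  trans (sym (S⊛[1-x]^n≗h k))
    (trans (⊛-[1-x]^ (suc (suc n)) (λ j → + S j) k)
      (coeff-closedForm n (λ j → + S j) (λ j → sphere-size n j (S j) (card j)) k))
theorem2p1 (suc 0) (s≤s ())
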